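{- Let $G=C_2^4\oplus C_{2n}$ with $n>70$ odd. Then $\nu(G)=\nu_2 (G)=\mathsf d (G)-1$.
   Context: $C_m$ denotes the cyclic group of order $m$. For a finite abelian group $G$ (written additively) let $G^{\bullet} = G\setminus\{0\}$. A sequence over $G$ is a finite unordered sequence of elements of $G$ with repetition allowed (an element of the free abelian monoid with basis $G$, written multiplicatively; the empty sequence is allowed); $|T|$ is the length of $T$, and $\Sigma(T)$ is the set of all sums of nonempty subsequences of $T$. $T$ is zero-sum free if $0\notin\Sigma(T)$. $\mathsf d(G)$ is the maximal length of a zero-sum free sequence over $G$. For nontrivial $G$, $\nu(G)$ is the smallest integer $\ell$ such that for every zero-sum free sequence $T$ over $G$ with $|T|\ge \ell$ there are a subgroup $H\subsetneq G$ and some $\alpha\in G\setminus H$ with $G^{\bullet}\setminus\Sigma(T)\subseteq\alpha+H$. For a prime divisor $p$ of $|G|$, $\nu_p(G)$ is the smallest integer $\ell$ such that for every zero-sum free sequence $T$ over $G$ with $|T|\ge\ell$ there are a subgroup $H\subseteq G$ with index $(G:H)=p$ and some $\alpha\in G\setminus H$ with $G^{\bullet}\setminus\Sigma(T)\subseteq\alpha+H$. -}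

module Defs where

open import Algebra.Bundles using (AbelianGroup)
open import Algebra.Structures using (IsAbelianGroup)
import Algebra.Construct.DirectProduct as DirectProduct
open import Data.Fin.Base using (Fin; toℕ)
open import Data.Fin.Properties using (toℕ-fromℕ<; toℕ-injective; toℕ<n)
open import Data.List.Base using (List; []; length; foldr)
open import Data.List.Relation.Binary.Sublist.Propositional using () renaming (_⊆_ to _⊑_)
open import Data.Nat.Base using (ℕ; _+_; _∸_; _≤_; _≥_; NonZero)
open import Data.Nat.DivMod
open import Data.Nat.Properties using (+-assoc; +-comm; m∸n+n≡m; <⇒≤)
open import Data.Product.Base using (_×_; _,_; ∃; ∃-syntax)
open import Data.Product using (∃!)
open import Level using (0ℓ)
open import Relation.Binary.PropositionalEquality
open import Relation.Unary using (Pred; U; _∈_; _∉_; _⊆_; _⊂_; _∖_)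

module _ (m : ℕ) .{{_ : NonZero m}} where

  private
    toℕ-mod : ∀ k → toℕ (k mod m) ≡ k % m
    toℕ-mod k = toℕ-fromℕ< (m%n<n k m)

    infixl 6 _⊹_
    _⊹_ : Fin m → Fin m → Fin m
    i ⊹ j = (toℕ i + toℕ j) mod m

    neg : Fin m → Fin m
    neg i = (m ∸ toℕ i) mod m

    mod-cong : ∀ {j k} → j % m ≡ k % m → j mod m ≡ k mod m
    mod-cong {j} {k} eq = toℕ-injective (trans (toℕ-mod j) (trans eq (sym (toℕ-mod k))))

    %-absorbˡ : ∀ j k → (j % m + k) % m ≡ (j + k) % m
    %-absorbˡ j k = begin
      (j % m + k) % m          ≡⟨ %-distribˡ-+ (j % m) k m ⟩
      (j % m % m + k % m) % m  ≡⟨ cong (λ x → (x + k % m) % m) (m%n%n≡m%n j m) ⟩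
      (j % m + k % m) % m      ≡⟨ %-distribˡ-+ j k m ⟨
      (j + k) % m              ∎
      where open ≡-Reasoning

    mod-toℕ : ∀ i → toℕ i mod m ≡ i
    mod-toℕ i = toℕ-injective (trans (toℕ-mod (toℕ i)) (m<n⇒m%n≡m (toℕ<n i)))

    absorbˡ : ∀ j k → (toℕ (j mod m) + k) mod m ≡ (j + k) mod m
    absorbˡ j k = mod-cong (trans (cong (λ x → (x + k) % m) (toℕ-mod j)) (%-absorbˡ j k))

    ⊹-comm : ∀ i j → i ⊹ j ≡ j ⊹ i
    ⊹-comm i j = cong (_mod m) (+-comm (toℕ i) (toℕ j))

    ⊹-assoc : ∀ i j k → (i ⊹ j) ⊹ k ≡ i ⊹ (j ⊹ k)
    ⊹-assoc i j k = begin
      (i ⊹ j) ⊹ k                      ≡⟨ absorbˡ (toℕ i + toℕ j) (toℕ k) ⟩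
      (toℕ i + toℕ j + toℕ k) mod m    ≡⟨ cong (_mod m) (+-assoc (toℕ i) _ _) ⟩
      (toℕ i + (toℕ j + toℕ k)) mod m  ≡⟨ cong (_mod m) (+-comm (toℕ i) _) ⟩
      (toℕ j + toℕ k + toℕ i) mod m    ≡⟨ absorbˡ (toℕ j + toℕ k) (toℕ i) ⟨
      (j ⊹ k) ⊹ i                      ≡⟨ ⊹-comm (j ⊹ k) i ⟩
      i ⊹ (j ⊹ k)                      ∎
      where open ≡-Reasoning

    ⊹-identityˡ : ∀ i → 0 mod m ⊹ i ≡ i
    ⊹-identityˡ i = trans (absorbˡ 0 (toℕ i)) (mod-toℕ i)

    ⊹-inverseˡ : ∀ i → neg i ⊹ i ≡ 0 mod m
    ⊹-inverseˡ i = begin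
      neg i ⊹ i                    ≡⟨ absorbˡ (m ∸ toℕ i) (toℕ i) ⟩
      (m ∸ toℕ i + toℕ i) mod m    ≡⟨ cong (_mod m) (m∸n+n≡m (<⇒≤ (toℕ<n i))) ⟩
      m mod m                      ≡⟨ mod-cong ([m+n]%n≡m%n 0 m) ⟩
      0 mod m                      ∎
      where open ≡-Reasoning

    isAbelianGroup : IsAbelianGroup _≡_ _⊹_ (0 mod m) neg
    isAbelianGroup = record
      { isGroup = record
        { isMonoid = record
          { isSemigroup = record
            { isMagma = record
              { isEquivalence = isEquivalence
              ; ∙-cong = cong₂ _⊹_
              }
            ; assoc = ⊹-assoc
            }
          ; identity = ⊹-identityˡ , λ i → trans (⊹-comm i _) (⊹-identityˡ i)
          }
        ; inverse = ⊹-inverseˡ , λ i → trans (⊹-comm i _) (⊹-inverseˡ i)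
        ; ⁻¹-cong = cong neg
        }
      ; comm = ⊹-comm
      }

  -- The residues 0, …, m - 1 under addition modulo m.
  C : AbelianGroup 0ℓ 0ℓ
  C = record { isAbelianGroup = isAbelianGroup }

infixr 5 _⊕_
_⊕_ : AbelianGroup 0ℓ 0ℓ → AbelianGroup 0ℓ 0ℓ → AbelianGroup 0ℓ 0ℓ
_⊕_ = DirectProduct.abelianGroup

IsLeast : ∀ {a} → Pred ℕ a → Pred ℕ a
IsLeast P k = P k × (∀ ℓ → P ℓ → k ≤ ℓ)

IsGreatest : ∀ {a} → Pred ℕ a → Pred ℕ a
IsGreatest P k = P k × (∀ ℓ → P ℓ → ℓ ≤ k)

-- The definitions below are meant for finite G, with ν for nontrivial G and ν_p
-- for primes p dividing the order of G. The invariants are given as relations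
-- "k is the value of the invariant"; values are unique by antisymmetry of ≤.
module _ (G : AbelianGroup 0ℓ 0ℓ) where

  open AbelianGroup G renaming (_∙_ to _+ᴳ_; ε to 0ᴳ; _⁻¹ to -ᴳ_)

  -- Sequences over G are unordered; a list is an enumeration of the terms
  -- with multiplicity, and nothing below depends on the order chosen.
  Sequence : Set
  Sequence = List Carrier

  sum : Sequence → Carrier
  sum = foldr _+ᴳ_ 0ᴳ

  -- Up to reordering, the subsequences of T are the order-preserving
  -- sublists of any enumeration of T.
  Σ : Sequence → Pred Carrier 0ℓ
  Σ T g = ∃[ S ] S ⊑ T × S ≢ [] × sum S ≈ g

  ZeroSumFree : Sequence → Set
  ZeroSumFree T = 0ᴳ ∉ Σ T

  G• : Pred Carrier 0ℓ
  G• g = g ≉ 0ᴳ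

  record IsSubgroup (H : Pred Carrier 0ℓ) : Set where
    field
      resp-≈     : ∀ {x y} → x ≈ y → x ∈ H → y ∈ H
      0-closed   : 0ᴳ ∈ H
      +-closed   : ∀ {x y} → x ∈ H → y ∈ H → x +ᴳ y ∈ H
      neg-closed : ∀ {x} → x ∈ H → -ᴳ x ∈ H

  Coset : Carrier → Pred Carrier 0ℓ → Pred Carrier 0ℓ
  Coset α H g = ∃[ h ] h ∈ H × g ≈ α +ᴳ h

  -- (G : H) = p, witnessed by a system of p coset representatives.
  HasIndex : Pred Carrier 0ℓ → ℕ → Set
  HasIndex H p = ∃ λ (r : Fin p → Carrier) →
    ∀ g → ∃! _≡_ λ i → g ∈ Coset (r i) H

  MissesOnlyCoset : Sequence → Pred Carrier 0ℓ → Set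
  MissesOnlyCoset T H = ∃[ α ] α ∉ H × (G• ∖ Σ T) ⊆ Coset α H

  Is-d : ℕ → Set
  Is-d = IsGreatest λ ℓ → ∃[ T ] ZeroSumFree T × length T ≡ ℓ

  Is-ν : ℕ → Set₁
  Is-ν = IsLeast λ ℓ → ∀ T → ZeroSumFree T → length T ≥ ℓ →
    ∃[ H ] IsSubgroup H × H ⊂ U × MissesOnlyCoset T H

  Is-νₚ : ℕ → ℕ → Set₁
  Is-νₚ p = IsLeast λ ℓ → ∀ T → ZeroSumFree T → length T ≥ ℓ →
    ∃[ H ] IsSubgroup H × HasIndex H p × MissesOnlyCoset T H

{-# OPTIONS --safe #-}
module Submission where

-- Let T be zero-sum free of length 2n + 3. Pair off terms of T that agree modulo 2G.
-- The sums of the pairs lie in 2G, which is cyclic of order n, and Scherk's theorem on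
-- subset sums there forces almost all of them to be equal. Rearranging pairs shows that
-- the common sum is 2e for a term e that occurs twice in T. Such pairs, with e, represent
-- the small multiples of e. Hence for every g with g T zero-sum free, a subsequence X of
-- the remaining terms has few terms, and every nonempty subsequence of X with sum in ⟨e⟩
-- has sum c e with 1 ≤ c ≤ |X| − 5.
--
-- With p : G → G / (2G + ⟨e⟩) = F₂⁴ this is a problem about such weights c. If two terms
-- have the same p-value, then dividing out an involution lowers the rank; the extremal
-- case is a simplex code: seven terms off a hyperplane of F₂⁴ in which the subsequences
-- with p-sum 0 are the complements of the lines of the Fano plane. All other terms of g T
-- are equal to e, except for at most one which is determined by the seven. The seven terms
-- therefore yield a character of G that is nontrivial on every g extending T; as the
-- missed elements are the negatives of these g, they lie in one coset of its kernel.
--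
-- Conversely, if u v T is zero-sum free, then −u, −v and −(u + v) are missed by Σ(T) and
-- no coset other than the subgroup contains all three. So ν(G) ≥ d(G) − 1, d(G) ≤ 2n + 4,
-- and equality is attained by e^(2n − 3) and seven terms of the above form.

open import Defs
open import Data.Nat using (ℕ; _*_; _∸_; _>_; NonZero)
open import Data.Nat.Divisibility using (_∤_)
open import Data.Nat.Properties using (m*n≢0)
open import Data.Product using (_×_; ∃-syntax)

open import Algebra.Bundles using (AbelianGroup)
import Algebra.Properties.AbelianGroup as AbelianGroupProperties
import Algebra.Solver.CommutativeMonoid as CommutativeMonoidSolver
open import Algebra.Structures using (IsAbelianGroup)
open import Data.Bool.Base using (Bool; true; false; if_then_else_; _∧_; _xor_; not)
open import Data.Bool.Properties as Boolₚ using (xor-assoc; xor-comm; xor-same; xor-identityʳ; ∧-distribˡ-xor; ∧-zeroʳ)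
open import Data.Empty using (⊥; ⊥-elim)
open import Data.Fin.Base as Fin using (Fin; toℕ; fromℕ<)
import Data.Fin.Properties as Finₚ
open import Data.List.Base as List using (List; []; _∷_; _++_; length; map; foldr; replicate; filter; filterᵇ; applyUpTo)
import Data.List.Membership.DecPropositional as DecMembership
open import Data.List.Membership.Propositional as Membership using (_∈_)
open import Data.List.Membership.Propositional.Properties using (∈-map⁻; ∈-filter⁺; ∈-filter⁻; ∈-++⁻; ∈-++⁺ˡ; ∈-applyUpTo⁻; ∈-lookup)
open import Data.List.Properties
  using (length-++; ++-assoc; ++-identityʳ; length-map; map-++; map-∘; ∷-injective; length-applyUpTo; length-replicate
  ; filter-all; filter-none; filter-++; filter-accept; filter-reject; filter-some)
open import Data.List.Relation.Binary.Permutation.Propositional as Perm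
  using (_↭_; prep; swap; ↭-sym; ↭-refl; ↭-trans; ↭-reflexive; ↭⇒↭ₛ; module PermutationReasoning)
open import Data.List.Relation.Binary.Permutation.Propositional.Properties
  using (shift; shifts; ++⁺ˡ; ++⁺ʳ; ++⁺; ++-comm; ↭-length; All-resp-↭; ∈-resp-↭; map⁺; drop-∷; ↭-map-inv; ↭-empty-inv; filter-↭)
import Data.List.Relation.Binary.Permutation.Setoid.Properties as PermSetoidₚ
open import Data.List.Relation.Binary.Sublist.Heterogeneous.Properties using () renaming (++ʳ to ⊆-++ʳ; ++ˡ to ⊆-++ˡ)
open import Data.List.Relation.Binary.Sublist.Propositional using (_⊆_; []; _∷_; _∷ʳ_; ⊆-refl; ⊆-trans)
open import Data.List.Relation.Unary.All as All using (All; []; _∷_)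
import Data.List.Relation.Unary.All.Properties as Allₚ
open import Data.List.Relation.Unary.AllPairs as AllPairs using (AllPairs; []; _∷_; allPairs?)
import Data.List.Relation.Unary.AllPairs.Properties as AllPairsₚ
open import Data.List.Relation.Unary.Any using (here; there)
import Data.List.Relation.Unary.Any.Properties as Anyₚ
open import Data.Nat.Base using (zero; suc; _+_; _^_; _≤_; _≥_; _<_; z≤n; s≤s; s≤s⁻¹; ⌊_/2⌋)
open import Data.Nat.Divisibility using (divides)
open import Data.Nat.DivMod
open import Data.Nat.ListAction using () renaming (sum to ℕsum)
open import Data.Nat.ListAction.Properties using (sum-++)
open import Data.Nat.Properties
open import Data.Nat.Tactic.RingSolver using (solve-∀)
open import Data.Product.Base using (_,_; ∃; ∃₂; proj₁; proj₂)
import Data.Product.Properties as Productₚ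
open import Data.Sum.Base using (_⊎_; inj₁; inj₂)
open import Data.Unit.Base using (tt)
open import Data.Vec.Base as Vec using (Vec; []; _∷_; toList; fromList)
open import Data.Vec.Properties as Vecₚ using (zipWith-assoc; zipWith-comm; zipWith-identityʳ; zipWith-identityˡ)
open import Function.Base using (_∘_; case_of_)
open import Level using (0ℓ)
open import Relation.Binary.Definitions using (DecidableEquality; tri<; tri≈; tri>)
open import Relation.Binary.PropositionalEquality as ≡ using (_≡_; _≢_; cong; cong₂; subst)
import Relation.Binary.Reasoning.Setoid
open import Relation.Nullary using (¬_; Dec; yes; no; contradiction)
open import Relation.Nullary.Decidable using (toWitness; map′; _×-dec_; _⊎-dec_; _→-dec_; ¬?)
open import Relation.Unary using (Pred; U; _∖_; _⊂_)

-- The measure throughout is the deficiency d: all weights of blocks of X are at most |X| - d. For g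
-- T it is 5, because X and the reserve of multiples of e have 2n + 4 terms together and the reserve
-- must not complete a block to the multiple 2n. In rank r, k + r terms carry k independent
-- relations, and d = r + 1 confines the weights of these to 1, ..., k - 1. So k = 1 is impossible,
-- k = 2 fails by parity, and k = 3 forces seven different labels on r + 3 terms: too many in rank
-- 3, exactly enough in rank 4. Thus d = 4 is impossible in rank 3 and d = 6 in rank 4; every
-- configuration that would lead to one of these is excluded. Longer lists are shortened by removing
-- blocks whose weight is at least their length. The pairs and e are found in T and not in g T, so
-- that all g share e and the map to F₂⁴; characters obtained for different g could not be compared
-- otherwise. From n > 70 the order 2n of e is at least 142, so that sums of two weights below 71
-- can be read off from multiples of e.

private variable
  r k n : ℕ
  E : Set

-- Linear algebra over F₂

F : ℕ → Set
F r = Vec Bool r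

infixl 6 _⊞_
_⊞_ : F r → F r → F r
_⊞_ = Vec.zipWith _xor_

𝟎 : F r
𝟎 = Vec.replicate _ false

_≟ᶠ_ : (u v : F r) → Dec (u ≡ v)
_≟ᶠ_ = Vecₚ.≡-dec Boolₚ._≟_

⊞-assoc : (u v w : F r) → (u ⊞ v) ⊞ w ≡ u ⊞ (v ⊞ w)
⊞-assoc = zipWith-assoc xor-assoc

⊞-comm : (u v : F r) → u ⊞ v ≡ v ⊞ u
⊞-comm = zipWith-comm xor-comm

⊞-identityʳ : (u : F r) → u ⊞ 𝟎 ≡ u
⊞-identityʳ = zipWith-identityʳ xor-identityʳ

⊞-identityˡ : (u : F r) → 𝟎 ⊞ u ≡ u
⊞-identityˡ = zipWith-identityˡ (λ _ → ≡.refl)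

⊞-self : (u : F r) → u ⊞ u ≡ 𝟎
⊞-self []      = ≡.refl
⊞-self (b ∷ u) = cong₂ _∷_ (xor-same b) (⊞-self u)

⊞-cancelˡ : (u v : F r) → u ⊞ (u ⊞ v) ≡ v
⊞-cancelˡ u v = begin
  u ⊞ (u ⊞ v)  ≡⟨ ⊞-assoc u u v ⟨
  (u ⊞ u) ⊞ v  ≡⟨ cong (_⊞ v) (⊞-self u) ⟩
  𝟎 ⊞ v        ≡⟨ ⊞-identityˡ v ⟩
  v            ∎
  where open ≡.≡-Reasoning

⊞-zero⇒≡ : (u v : F r) → u ⊞ v ≡ 𝟎 → u ≡ v
⊞-zero⇒≡ u v eq = begin
  u            ≡⟨ ⊞-identityʳ u ⟨
  u ⊞ 𝟎        ≡⟨ cong (u ⊞_) eq ⟨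
  u ⊞ (u ⊞ v)  ≡⟨ ⊞-cancelˡ u v ⟩
  v            ∎
  where open ≡.≡-Reasoning

⊞-interchange : (a b c d : F r) → (a ⊞ b) ⊞ (c ⊞ d) ≡ (a ⊞ c) ⊞ (b ⊞ d)
⊞-interchange a b c d = begin
  (a ⊞ b) ⊞ (c ⊞ d)  ≡⟨ ⊞-assoc a b _ ⟩
  a ⊞ (b ⊞ (c ⊞ d))  ≡⟨ cong (a ⊞_) (⊞-assoc b c d) ⟨
  a ⊞ ((b ⊞ c) ⊞ d)  ≡⟨ cong (λ x → a ⊞ (x ⊞ d)) (⊞-comm b c) ⟩
  a ⊞ ((c ⊞ b) ⊞ d)  ≡⟨ cong (a ⊞_) (⊞-assoc c b d) ⟩
  a ⊞ (c ⊞ (b ⊞ d))  ≡⟨ ⊞-assoc a c _ ⟨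
  (a ⊞ c) ⊞ (b ⊞ d)  ∎
  where open ≡.≡-Reasoning

xor-interchange : ∀ a b c d → (a xor b) xor (c xor d) ≡ (a xor c) xor (b xor d)
xor-interchange a b c d = Vecₚ.∷-injective (⊞-interchange (a ∷ []) (b ∷ []) (c ∷ []) (d ∷ [])) .proj₁

dot : F r → F r → Bool
dot []      []      = false
dot (a ∷ u) (b ∷ v) = (a ∧ b) xor dot u v

dot-⊞ʳ : (l u v : F r) → dot l (u ⊞ v) ≡ dot l u xor dot l v
dot-⊞ʳ []      []      []      = ≡.refl
dot-⊞ʳ (a ∷ l) (b ∷ u) (c ∷ v) = begin
  (a ∧ (b xor c)) xor dot l (u ⊞ v)                ≡⟨ cong₂ _xor_ (∧-distribˡ-xor a b c) (dot-⊞ʳ l u v) ⟩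
  ((a ∧ b) xor (a ∧ c)) xor (dot l u xor dot l v)  ≡⟨ xor-interchange (a ∧ b) _ _ _ ⟩
  dot (a ∷ l) (b ∷ u) xor dot (a ∷ l) (c ∷ v)      ∎
  where open ≡.≡-Reasoning

dot-comm : (u v : F r) → dot u v ≡ dot v u
dot-comm []      []      = ≡.refl
dot-comm (a ∷ u) (b ∷ v) = cong₂ _xor_ (Boolₚ.∧-comm a b) (dot-comm u v)

dot-⊞ˡ : (l m u : F r) → dot (l ⊞ m) u ≡ dot l u xor dot m u
dot-⊞ˡ l m u = ≡.trans (dot-comm (l ⊞ m) u) (≡.trans (dot-⊞ʳ u l m) (cong₂ _xor_ (dot-comm u l) (dot-comm u m)))

dot-𝟎 : (u : F r) → dot u 𝟎 ≡ false
dot-𝟎 []      = ≡.refl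
dot-𝟎 (a ∷ u) = ≡.trans (cong (_xor dot u 𝟎) (∧-zeroʳ a)) (dot-𝟎 u)

dot-𝟎ˡ : (u : F r) → dot 𝟎 u ≡ false
dot-𝟎ˡ u = ≡.trans (dot-comm 𝟎 u) (dot-𝟎 u)

opaque
  detect : (f : F r) → f ≢ 𝟎 → ∃[ l ] dot l f ≡ true
  detect []          f≢𝟎 = contradiction ≡.refl f≢𝟎
  detect (true ∷ f)  f≢𝟎 = true ∷ 𝟎 , cong (true xor_) (dot-𝟎ˡ f)
  detect (false ∷ f) f≢𝟎 = let l , eq = detect f (f≢𝟎 ∘ cong (false ∷_)) in false ∷ l , eq

opaque
  -- If each of the two functionals detects only its own vector, their sum detects both.
  detect₂ : (f g : F r) → f ≢ 𝟎 → g ≢ 𝟎 → ∃[ l ] dot l f ≡ true × dot l g ≡ true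
  detect₂ f g f≢𝟎 g≢𝟎 with detect f f≢𝟎 | detect g g≢𝟎
  ... | l , lf | m , mg with dot l g in lg | dot m f in mf
  ... | true  | _     = l , lf , lg
  ... | false | true  = m , mf , mg
  ... | false | false = l ⊞ m
    , ≡.trans (dot-⊞ˡ l m f) (cong₂ _xor_ lf mf) , ≡.trans (dot-⊞ˡ l m g) (cong₂ _xor_ lg mg)

-- The quotient of F (suc r) by the line {𝟎, f}, for f ≢ 𝟎.
quot : F (suc r) → F (suc r) → F r
quot         (true ∷ f)  (true ∷ v)  = v ⊞ f
quot         (true ∷ f)  (false ∷ v) = v
quot {zero}  (false ∷ f) (b ∷ v)     = []
quot {suc r} (false ∷ f) (b ∷ v)     = b ∷ quot f v

quot-⊞ : (f u v : F (suc r)) → quot f (u ⊞ v) ≡ quot f u ⊞ quot f v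
quot-⊞ (true ∷ f) (true ∷ u) (true ∷ v) = ≡.sym (begin
  (u ⊞ f) ⊞ (v ⊞ f)  ≡⟨ ⊞-interchange u f v f ⟩
  (u ⊞ v) ⊞ (f ⊞ f)  ≡⟨ cong ((u ⊞ v) ⊞_) (⊞-self f) ⟩
  (u ⊞ v) ⊞ 𝟎        ≡⟨ ⊞-identityʳ _ ⟩
  u ⊞ v              ∎)
  where open ≡.≡-Reasoning
quot-⊞ (true ∷ f) (true ∷ u) (false ∷ v) = begin
  (u ⊞ v) ⊞ f  ≡⟨ ⊞-assoc u v f ⟩
  u ⊞ (v ⊞ f)  ≡⟨ cong (u ⊞_) (⊞-comm v f) ⟩
  u ⊞ (f ⊞ v)  ≡⟨ ⊞-assoc u f v ⟨
  (u ⊞ f) ⊞ v  ∎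
  where open ≡.≡-Reasoning
quot-⊞ (true ∷ f) (false ∷ u) (true ∷ v) = ⊞-assoc u v f
quot-⊞ (true ∷ f) (false ∷ u) (false ∷ v) = ≡.refl
quot-⊞ {zero} (false ∷ f) (b ∷ u) (c ∷ v) = ≡.refl
quot-⊞ {suc r} (false ∷ f) (b ∷ u) (c ∷ v) = cong ((b xor c) ∷_) (quot-⊞ f u v)

quot-self : (f : F (suc r)) → quot f f ≡ 𝟎
quot-self         (true ∷ f)  = ⊞-self f
quot-self {zero}  (false ∷ f) = ≡.refl
quot-self {suc r} (false ∷ f) = cong (false ∷_) (quot-self f)

quot-𝟎 : (f : F (suc r)) → quot f 𝟎 ≡ 𝟎
quot-𝟎         (true ∷ f)  = ≡.refl
quot-𝟎 {zero}  (false ∷ f) = ≡.refl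
quot-𝟎 {suc r} (false ∷ f) = cong (false ∷_) (quot-𝟎 f)

quot-kernel : (f v : F (suc r)) → f ≢ 𝟎 → quot f v ≡ 𝟎 → v ≡ 𝟎 ⊎ v ≡ f
quot-kernel (true ∷ f) (true ∷ v) f≢𝟎 eq = inj₂ (cong (true ∷_) (⊞-zero⇒≡ v f eq))
quot-kernel (true ∷ f) (false ∷ v) f≢𝟎 eq = inj₁ (cong (false ∷_) eq)
quot-kernel {zero} (false ∷ []) (b ∷ v) f≢𝟎 eq = contradiction ≡.refl f≢𝟎
quot-kernel {suc r} (false ∷ f) (false ∷ v) f≢𝟎 eq
  with quot-kernel f v (f≢𝟎 ∘ cong (false ∷_)) (Vecₚ.∷-injective eq .proj₂)
... | inj₁ v≡𝟎 = inj₁ (cong (false ∷_) v≡𝟎)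
... | inj₂ v≡f = inj₂ (cong (false ∷_) v≡f)

vsum : (E → F r) → List E → F r
vsum h []       = 𝟎
vsum h (x ∷ xs) = h x ⊞ vsum h xs

vsum-↭ : (h : E → F r) {xs ys : List E} → xs ↭ ys → vsum h xs ≡ vsum h ys
vsum-↭ h Perm.refl = ≡.refl
vsum-↭ h (prep x π) = cong (h x ⊞_) (vsum-↭ h π)
vsum-↭ h (swap {xs = xs} {ys = ys} x y π) = begin
  h x ⊞ (h y ⊞ vsum h xs)  ≡⟨ ⊞-assoc (h x) (h y) _ ⟨
  h x ⊞ h y ⊞ vsum h xs    ≡⟨ cong₂ _⊞_ (⊞-comm (h x) (h y)) (vsum-↭ h π) ⟩
  h y ⊞ h x ⊞ vsum h ys    ≡⟨ ⊞-assoc (h y) (h x) _ ⟩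
  h y ⊞ (h x ⊞ vsum h ys)  ∎
  where open ≡.≡-Reasoning
vsum-↭ h (Perm.trans π ρ) = ≡.trans (vsum-↭ h π) (vsum-↭ h ρ)

vsum-++ : (h : E → F r) (xs ys : List E) → vsum h (xs ++ ys) ≡ vsum h xs ⊞ vsum h ys
vsum-++ h []       ys = ≡.sym (⊞-identityˡ _)
vsum-++ h (x ∷ xs) ys = ≡.trans (cong (h x ⊞_) (vsum-++ h xs ys)) (≡.sym (⊞-assoc (h x) _ _))

vsum-quot : (f : F (suc r)) (h : E → F (suc r)) (xs : List E) → vsum (quot f ∘ h) xs ≡ quot f (vsum h xs)
vsum-quot f h []       = ≡.sym (quot-𝟎 f)
vsum-quot f h (x ∷ xs) = ≡.trans (cong (quot f (h x) ⊞_) (vsum-quot f h xs)) (≡.sym (quot-⊞ f (h x) _))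

dot-vsum : (l : F r) (h : E → F r) (xs : List E) → All (λ x → dot l (h x) ≡ false) xs → dot l (vsum h xs) ≡ false
dot-vsum l h []       []       = dot-𝟎 l
dot-vsum l h (x ∷ xs) (px ∷ pxs) = ≡.trans (dot-⊞ʳ l (h x) _) (cong₂ _xor_ px (dot-vsum l h xs pxs))

opaque
  -- The vector `f` is a sum over `x ∷ xs` iff `f` or `h x ⊞ f` is one over `xs`. If `l` and `m`
  -- exclude both, then `l`, `m` or `l ⊞ m` vanishes at `h x` and detects `f`. Later the first
  -- alternative supplies a block and the second lowers the rank.
  sep : (h : E → F r) (xs : List E) (f : F r) →
    (∃₂ λ ys zs → ys ++ zs ↭ xs × vsum h ys ≡ f) ⊎
    (∃[ l ] dot l f ≡ true × All (λ x → dot l (h x) ≡ false) xs)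
  sep h [] f with f ≟ᶠ 𝟎
  ... | yes f≡𝟎 = inj₁ ([] , [] , Perm.refl , ≡.sym f≡𝟎)
  ... | no  f≢𝟎 = let l , eq = detect f f≢𝟎 in inj₂ (l , eq , [])
  sep h (x ∷ xs) f with sep h xs f | sep h xs (h x ⊞ f)
  ... | inj₁ (ys , zs , π , eq) | _ = inj₁ (ys , x ∷ zs , Perm.trans (shift x ys zs) (prep x π) , eq)
  ... | inj₂ _ | inj₁ (ys , zs , π , eq) =
    inj₁ (x ∷ ys , zs , prep x π , ≡.trans (cong (h x ⊞_) eq) (⊞-cancelˡ (h x) f))
  ... | inj₂ (l , lf , lxs) | inj₂ (m , mf , mxs) with dot l (h x) in lx | dot m (h x) in mx
  ...   | false | _     = inj₂ (l , lf , lx ∷ lxs)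
  ...   | true  | false = inj₂ (m , ≡.trans (≡.sym (≡.trans (dot-⊞ʳ m (h x) f) (cong (_xor dot m f) mx))) mf , mx ∷ mxs)
  ...   | true  | true  = inj₂ (l ⊞ m
    , ≡.trans (dot-⊞ˡ l m f) (cong₂ _xor_ lf mf′)
    , ≡.trans (dot-⊞ˡ l m (h x)) (cong₂ _xor_ lx mx)
    ∷ All.zipWith (λ {y} (p , q) → ≡.trans (dot-⊞ˡ l m (h y)) (cong₂ _xor_ p q)) (lxs , mxs))
    where
    not-true : ∀ b → true xor b ≡ true → b ≡ false
    not-true false _ = ≡.refl
    mf′ : dot m f ≡ false
    mf′ = not-true _ (≡.trans (≡.sym (≡.trans (dot-⊞ʳ m (h x) f) (cong (_xor dot m f) mx))) mf)

opaque
  -- If `h x` is not a sum over `xs`, a relation is sought in the quotient by `h x`, whose dimension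
  -- is one less. It lifts, because the separating functional vanishes on `xs` but not at `h x`.
  dep : (h : E → F r) (xs : List E) → r < length xs →
    ∃[ y ] ∃₂ λ ys zs → y ∷ ys ++ zs ↭ xs × h y ⊞ vsum h ys ≡ 𝟎
  dep {r = r} h (x ∷ xs) r<xs with sep h xs (h x)
  ... | inj₁ (ys , zs , π , eq) = x , ys , zs , prep x π , ≡.trans (cong (h x ⊞_) eq) (⊞-self (h x))
  dep {r = zero} h (x ∷ xs) r<xs | inj₂ (l , lx , lxs) with [] ← l with [] ← h x with () ← lx
  dep {r = suc r} h (x ∷ xs) (s≤s r<xs) | inj₂ (l , lx , lxs)
    with dep (quot (h x) ∘ h) xs r<xs
  ... | y , ys , zs , π , eq = y , ys , x ∷ zs , Perm.trans (shift x (y ∷ ys) zs) (prep x π)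
    , in-kernel (quot-kernel (h x) _ hx≢𝟎 (≡.trans (≡.sym (vsum-quot (h x) h (y ∷ ys))) eq))
    where
    hx≢𝟎 : h x ≢ 𝟎
    hx≢𝟎 hx≡𝟎 with () ← ≡.trans (≡.sym lx) (≡.trans (cong (dot l) hx≡𝟎) (dot-𝟎 l))
    in-kernel : vsum h (y ∷ ys) ≡ 𝟎 ⊎ vsum h (y ∷ ys) ≡ h x → vsum h (y ∷ ys) ≡ 𝟎
    in-kernel (inj₁ eq′) = eq′
    in-kernel (inj₂ eq′) with () ← ≡.trans (≡.sym lx) (≡.trans (≡.sym (cong (dot l) eq′))
      (dot-vsum l h (y ∷ ys) (Allₚ.++⁻ˡ (y ∷ ys) (All-resp-↭ (↭-sym π) lxs))))

opaque
  partitionᵇ : (b : E → Bool) (xs : List E) → ∃₂ λ ts fs →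
    ts ++ fs ↭ xs × All (λ x → b x ≡ true) ts × All (λ x → b x ≡ false) fs
  partitionᵇ b [] = [] , [] , Perm.refl , [] , []
  partitionᵇ b (x ∷ xs) with partitionᵇ b xs | b x in bx
  ... | ts , fs , π , pt , pf | true  = x ∷ ts , fs , prep x π , bx ∷ pt , pf
  ... | ts , fs , π , pt , pf | false = ts , x ∷ fs , Perm.trans (shift x ts fs) (prep x π) , pt , bx ∷ pf

+-split-< : ∀ {c} a b → c + c < a + b → c < a ⊎ c < b
+-split-< {c} a b c+c<a+b with c <? a
... | yes c<a = inj₁ c<a
... | no  c≮a = inj₂ (+-cancelˡ-< c _ _ (<-≤-trans c+c<a+b (+-monoˡ-≤ b (≮⇒≥ c≮a))))

opaque
  pigeonhole : (h : E → F r) (xs : List E) → 2 ^ r < length xs →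
    ∃₂ λ x y → ∃[ zs ] x ∷ y ∷ zs ↭ xs × h x ≡ h y
  pigeonhole {r = zero} h (x ∷ y ∷ zs) _ = x , y , zs , Perm.refl , F0-≡ (h x) (h y)
    where
    F0-≡ : (u v : F 0) → u ≡ v
    F0-≡ [] [] = ≡.refl
  pigeonhole {r = zero} h (x ∷ []) (s≤s ())
  pigeonhole {r = suc r} h xs 2^r<xs with partitionᵇ (Vec.head ∘ h) xs
  ... | ts , fs , π , pt , pf with +-split-< (length ts) (length fs) 2·2^r<
    where
    2·2^r< : 2 ^ r + 2 ^ r < length ts + length fs
    2·2^r< = subst (2 ^ r + 2 ^ r <_) (≡.trans (≡.sym (↭-length π)) (length-++ ts))
               (subst (_< length xs) (cong (2 ^ r +_) (+-identityʳ (2 ^ r))) 2^r<xs)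
  ... | inj₁ 2^r<ts = glue (pigeonhole (Vec.tail ∘ h) ts 2^r<ts)
    where
    glue : (∃₂ λ x y → ∃[ zs ] x ∷ y ∷ zs ↭ ts × Vec.tail (h x) ≡ Vec.tail (h y)) → ∃₂ λ x y → ∃[ zs ] x ∷ y ∷ zs ↭ xs × h x ≡ h y
    glue (x , y , zs , ρ , eq) with hx ∷ hy ∷ _ ← All-resp-↭ (↭-sym ρ) pt with h x in ex | h y in ey
    ... | b ∷ u | c ∷ v = x , y , zs ++ fs , Perm.trans (++⁺ʳ fs ρ) π , ≡.trans ex (≡.trans (cong₂ _∷_ (≡.trans hx (≡.sym hy)) eq) (≡.sym ey))
  ... | inj₂ 2^r<fs = glue (pigeonhole (Vec.tail ∘ h) fs 2^r<fs)
    where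
    glue : (∃₂ λ x y → ∃[ zs ] x ∷ y ∷ zs ↭ fs × Vec.tail (h x) ≡ Vec.tail (h y)) → ∃₂ λ x y → ∃[ zs ] x ∷ y ∷ zs ↭ xs × h x ≡ h y
    glue (x , y , zs , ρ , eq) with hx ∷ hy ∷ _ ← All-resp-↭ (↭-sym ρ) pf with h x in ex | h y in ey
    ... | b ∷ u | c ∷ v = x , y , zs ++ ts , Perm.trans (++⁺ʳ ts ρ) (Perm.trans (++-comm fs ts) π) , ≡.trans ex (≡.trans (cong₂ _∷_ (≡.trans hx (≡.sym hy)) eq) (≡.sym ey))

-- The labels are the columns of a generator matrix of a binary code, and `word χ` is the support of
-- the codeword with coefficients χ. The symmetric difference of `word χ` and `word ψ` is
-- `word (χ ⊞ ψ)`.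
word : F k → List (F k × E) → List E
word χ []             = []
word χ ((l , x) ∷ ls) = if dot χ l then x ∷ word χ ls else word χ ls

coword : F k → List (F k × E) → List E
coword χ []             = []
coword χ ((l , x) ∷ ls) = if dot χ l then coword χ ls else x ∷ coword χ ls

word-coword : (χ : F k) (ls : List (F k × E)) → word χ ls ++ coword χ ls ↭ map proj₂ ls
word-coword χ [] = Perm.refl
word-coword χ ((l , x) ∷ ls) with dot χ l
... | true  = prep x (word-coword χ ls)
... | false = Perm.trans (shift x (word χ ls) _) (prep x (word-coword χ ls))

private
  scale : Bool → F r → F r
  scale b v = if b then v else 𝟎

  scale-xor : (a b : Bool) (v : F r) → scale (a xor b) v ≡ scale a v ⊞ scale b v
  scale-xor true  true  v = ≡.sym (⊞-self v)
  scale-xor true  false v = ≡.sym (⊞-identityʳ v)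
  scale-xor false b     v = ≡.sym (⊞-identityˡ _)

  scale-∧ : (a b : Bool) (v : F r) → scale (a ∧ b) v ≡ scale a (scale b v)
  scale-∧ true  b v = ≡.refl
  scale-∧ false b v = ≡.refl

  vsum-word : (h : E → F r) (χ : F k) (ls : List (F k × E)) →
    vsum h (word χ ls) ≡ vsum (λ (l , x) → scale (dot χ l) (h x)) ls
  vsum-word h χ [] = ≡.refl
  vsum-word h χ ((l , x) ∷ ls) with dot χ l
  ... | true  = cong (h x ⊞_) (vsum-word h χ ls)
  ... | false = ≡.trans (vsum-word h χ ls) (≡.sym (⊞-identityˡ _))

  vsum-cong : {g h : E → F r} (xs : List E) → (∀ x → g x ≡ h x) → vsum g xs ≡ vsum h xs
  vsum-cong []       g≗h = ≡.refl
  vsum-cong (x ∷ xs) g≗h = cong₂ _⊞_ (g≗h x) (vsum-cong xs g≗h)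

  vsum-⊞ : (g h : E → F r) (xs : List E) → vsum (λ x → g x ⊞ h x) xs ≡ vsum g xs ⊞ vsum h xs
  vsum-⊞ g h []       = ≡.sym (⊞-self 𝟎)
  vsum-⊞ g h (x ∷ xs) = ≡.trans (cong (g x ⊞ h x ⊞_) (vsum-⊞ g h xs)) (⊞-interchange (g x) (h x) _ _)

  vsum-scale : (b : Bool) (h : E → F r) (xs : List E) → vsum (λ x → scale b (h x)) xs ≡ scale b (vsum h xs)
  vsum-scale true  h xs       = ≡.refl
  vsum-scale false h []       = ≡.refl
  vsum-scale false h (x ∷ xs) = ≡.trans (⊞-identityˡ _) (vsum-scale false h xs)

  vsum-map : {D : Set} (h : E → F r) (g : D → E) (xs : List D) → vsum h (map g xs) ≡ vsum (h ∘ g) xs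
  vsum-map h g []       = ≡.refl
  vsum-map h g (x ∷ xs) = cong (h (g x) ⊞_) (vsum-map h g xs)

  mark : Bool → E → Bool × E
  mark b x = b , x

  retag : F k × (Bool × E) → F (suc k) × E
  retag (l , (b , x)) = b ∷ l , x

  word-retag : (b : Bool) (χ : F k) (ls : List (F k × (Bool × E))) → word χ ls ≢ [] → word (false ∷ χ) (map retag ls) ≢ []
  word-retag b χ [] ne eq = ne ≡.refl
  word-retag b χ ((l , (c , x)) ∷ ls) ne eq with dot χ l
  word-retag b χ ((l , (c , x)) ∷ ls) ne () | true
  ... | false = word-retag b χ ls ne eq

-- Length k + r forces k independent linear relations: word χ runs through the
-- relations they span.
opaque
  relations : ∀ k (h : E → F r) (xs : List E) → length xs ≡ k + r → ∃ λ (ls : List (F k × E)) →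
    map proj₂ ls ↭ xs × (∀ χ → vsum h (word χ ls) ≡ 𝟎) × (∀ χ → χ ≢ 𝟎 → word χ ls ≢ [])
  relations {E = E} zero h xs eq = map unlabelled xs , ↭-reflexive (tags xs) , (λ { [] → cong (vsum h) (empty xs) }) , λ { [] ne → contradiction ≡.refl ne }
    where
    unlabelled : E → F 0 × E
    unlabelled x = [] , x
    tags : (xs : List _) → map proj₂ (map unlabelled xs) ≡ xs
    tags []       = ≡.refl
    tags (x ∷ xs) = cong (x ∷_) (tags xs)
    empty : (xs : List _) → word [] (map unlabelled xs) ≡ []
    empty []       = ≡.refl
    empty (x ∷ xs) = empty xs
  relations {E = E} {r = r} (suc k) h xs eq with dep h xs (subst (r <_) (≡.sym eq) (s≤s (m≤n+m r k)))
  ... | y , ys , zs , π , sum-y with relations k (h ∘ proj₂) (map (mark true) ys ++ map (mark false) zs) len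
    where
    len : length (map (mark true) ys ++ map (mark false) zs) ≡ k + r
    len = begin
      length (map (mark true) ys ++ map (mark false) zs)          ≡⟨ length-++ (map (mark true) ys) ⟩
      length (map (mark true) ys) + length (map (mark false) zs)  ≡⟨ cong₂ _+_ (length-map _ ys) (length-map _ zs) ⟩
      length ys + length zs                                   ≡⟨ length-++ ys ⟨
      length (ys ++ zs)                                       ≡⟨ suc-injective (≡.trans (↭-length π) eq) ⟩
      k + r                                                   ∎
      where open ≡.≡-Reasoning
  -- `y` belongs to the new relation alone, whence its label `true ∷ 𝟎`; this makes the new relation
  -- independent of the other k. The marks record which other terms belong to it and become their
  -- first coordinates.
  ... | ls , ρ , sums , nonempty = (true ∷ 𝟎 , y) ∷ map retag ls , perm , sums′ , nonempty′
    where
    proj-tags : (b : Bool) (xs : List E) → map proj₂ (map (mark b) xs) ≡ xs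
    proj-tags b []       = ≡.refl
    proj-tags b (x ∷ xs) = cong (x ∷_) (proj-tags b xs)
    perm : y ∷ map proj₂ (map retag ls) ↭ xs
    perm = begin
      y ∷ map proj₂ (map retag ls)                                    ≡⟨ cong (y ∷_) (≡.trans (≡.sym (map-∘ ls)) (map-∘ ls)) ⟩
      y ∷ map proj₂ (map proj₂ ls)                                    ↭⟨ prep y (map⁺ proj₂ ρ) ⟩
      y ∷ map proj₂ (map (mark true) ys ++ map (mark false) zs)           ≡⟨ cong (y ∷_) (map-++ proj₂ (map (mark true) ys) _) ⟩
      y ∷ map proj₂ (map (mark true) ys) ++ map proj₂ (map (mark false) zs) ≡⟨ cong₂ (λ us vs → y ∷ us ++ vs) (proj-tags true ys) (proj-tags false zs) ⟩
      y ∷ ys ++ zs                                                    ↭⟨ π ⟩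
      xs                                                              ∎
      where open PermutationReasoning
    member : vsum (λ (b , x) → scale b (h x)) (map (mark true) ys ++ map (mark false) zs) ≡ vsum h ys
    member = begin
      vsum (λ (b , x) → scale b (h x)) (map (mark true) ys ++ map (mark false) zs)  ≡⟨ vsum-++ _ (map (mark true) ys) _ ⟩
      _ ⊞ vsum (λ (b , x) → scale b (h x)) (map (mark false) zs)                  ≡⟨ cong₂ _⊞_ (vsum-map _ (mark true) ys) (vsum-map _ (mark false) zs) ⟩
      vsum h ys ⊞ vsum (λ _ → 𝟎) zs                                             ≡⟨ cong (vsum h ys ⊞_) (vsum-scale false h zs) ⟩
      vsum h ys ⊞ 𝟎                                                             ≡⟨ ⊞-identityʳ _ ⟩
      vsum h ys                                                                 ∎
      where open ≡.≡-Reasoning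
    sums′ : ∀ χ → vsum h (word χ ((true ∷ 𝟎 , y) ∷ map retag ls)) ≡ 𝟎
    sums′ (b ∷ χ) = begin
      vsum h (word (b ∷ χ) ((true ∷ 𝟎 , y) ∷ map retag ls))
        ≡⟨ vsum-word h (b ∷ χ) ((true ∷ 𝟎 , y) ∷ map retag ls) ⟩
      scale ((b ∧ true) xor dot χ 𝟎) (h y) ⊞ vsum (λ (l , x) → scale (dot (b ∷ χ) l) (h x)) (map retag ls)
        ≡⟨ cong₂ _⊞_ (cong (λ c → scale c (h y)) (≡.trans (cong₂ _xor_ (Boolₚ.∧-identityʳ b) (dot-𝟎 χ)) (xor-identityʳ b))) (vsum-map _ retag ls) ⟩
      scale b (h y) ⊞ vsum (λ (l , (c , x)) → scale ((b ∧ c) xor dot χ l) (h x)) ls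
        ≡⟨ cong (scale b (h y) ⊞_) (vsum-cong ls λ (l , (c , x)) → ≡.trans (scale-xor (b ∧ c) _ (h x)) (cong (_⊞ scale (dot χ l) (h x)) (scale-∧ b c (h x)))) ⟩
      scale b (h y) ⊞ vsum (λ (l , (c , x)) → scale b (scale c (h x)) ⊞ scale (dot χ l) (h x)) ls
        ≡⟨ cong (scale b (h y) ⊞_) (vsum-⊞ _ _ ls) ⟩
      scale b (h y) ⊞ (vsum (λ (l , (c , x)) → scale b (scale c (h x))) ls ⊞ vsum (λ (l , (c , x)) → scale (dot χ l) (h x)) ls)
        ≡⟨ cong (scale b (h y) ⊞_) (cong₂ _⊞_ (≡.trans (vsum-scale b _ ls) (cong (scale b) (≡.sym (vsum-map _ proj₂ ls)))) (≡.trans (≡.sym (vsum-word (h ∘ proj₂) χ ls)) (sums χ))) ⟩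
      scale b (h y) ⊞ (scale b (vsum (λ (c , x) → scale c (h x)) (map proj₂ ls)) ⊞ 𝟎)
        ≡⟨ cong (scale b (h y) ⊞_) (≡.trans (⊞-identityʳ _) (cong (scale b) (≡.trans (vsum-↭ _ ρ) member))) ⟩
      scale b (h y) ⊞ scale b (vsum h ys)
        ≡⟨ scale-⊞ b (h y) _ ⟨
      scale b (h y ⊞ vsum h ys)
        ≡⟨ cong (scale b) sum-y ⟩
      scale b 𝟎
        ≡⟨ scale-zero b ⟩
      𝟎 ∎
      where
      open ≡.≡-Reasoning
      scale-⊞ : ∀ b (u v : F r) → scale b (u ⊞ v) ≡ scale b u ⊞ scale b v
      scale-⊞ true  u v = ≡.refl
      scale-⊞ false u v = ≡.sym (⊞-self 𝟎)
      scale-zero : ∀ b → scale b (𝟎 {r}) ≡ 𝟎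
      scale-zero true  = ≡.refl
      scale-zero false = ≡.refl
    nonempty′ : ∀ χ → χ ≢ 𝟎 → word χ ((true ∷ 𝟎 , y) ∷ map retag ls) ≢ []
    nonempty′ (true ∷ χ) χ≢𝟎 rewrite dot-𝟎 χ = λ ()
    nonempty′ (false ∷ χ) χ≢𝟎 rewrite dot-𝟎 χ = word-retag true χ ls (nonempty χ (χ≢𝟎 ∘ cong (false ∷_)))

-- Weights of subsequences, and division by an involution

module Sum (A : AbelianGroup 0ℓ 0ℓ) where
  open AbelianGroup A
  open import Relation.Binary.Reasoning.Setoid setoid

  σ : List Carrier → Carrier
  σ = foldr _∙_ ε

  -- Unlike the library's multiple n × x, this does not mention _≈_, so that it is
  -- unchanged when the group is replaced by a quotient.
  infixr 8 _·_
  _·_ : ℕ → Carrier → Carrier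
  n · x = σ (replicate n x)

  ·-homo-+ : ∀ x m n → (m + n) · x ≈ m · x ∙ n · x
  ·-homo-+ x zero    n = sym (identityˡ _)
  ·-homo-+ x (suc m) n = trans (∙-congˡ (·-homo-+ x m n)) (sym (assoc _ _ _))

  ·-congˡ : ∀ {x m n} → m ≡ n → m · x ≈ n · x
  ·-congˡ ≡.refl = refl

  σ-++ : ∀ xs ys → σ (xs ++ ys) ≈ σ xs ∙ σ ys
  σ-++ []       ys = sym (identityˡ _)
  σ-++ (x ∷ xs) ys = trans (∙-congˡ (σ-++ xs ys)) (sym (assoc _ _ _))

  σ-↭ : ∀ {xs ys} → xs ↭ ys → σ xs ≈ σ ys
  σ-↭ Perm.refl = refl
  σ-↭ (prep x π) = ∙-congˡ (σ-↭ π)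
  σ-↭ (swap {xs = xs} {ys = ys} x y π) = begin
    x ∙ (y ∙ σ xs)  ≈⟨ assoc x y _ ⟨
    (x ∙ y) ∙ σ xs  ≈⟨ ∙-cong (comm x y) (σ-↭ π) ⟩
    (y ∙ x) ∙ σ ys  ≈⟨ assoc y x _ ⟩
    y ∙ (x ∙ σ ys)  ∎
  σ-↭ (Perm.trans π ρ) = trans (σ-↭ π) (σ-↭ ρ)

-- These properties survive both ways of lowering the rank. `e-even` says that odd multiples of `e`
-- are not doubles. As weights are kept below 71, the range 142 of `e-inj` turns an equation between
-- sums of two weights times `e` into an equation of numbers.
record Context (r : ℕ) : Set₁ where
  field
    abelianGroup : AbelianGroup 0ℓ 0ℓ
  open AbelianGroup abelianGroup public
  open Sum abelianGroup public
  field
    e      : Carrier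
    p      : Carrier → F r
    p-cong : ∀ {x y} → x ≈ y → p x ≡ p y
    p-∙    : ∀ x y → p (x ∙ y) ≡ p x ⊞ p y
    p-e    : p e ≡ 𝟎
    e-even : ∀ v c → v ∙ v ≈ c · e → ∃[ k ] c ≡ k + k
    e-inj  : ∀ c d → c < 142 → d < 142 → c · e ≈ d · e → c ≡ d

  open AbelianGroupProperties abelianGroup public using (⁻¹-∙-comm; ∙-cancelˡ; ∙-cancelʳ)
  module Solver = CommutativeMonoidSolver commutativeMonoid
  module ≈-Reasoning = Relation.Binary.Reasoning.Setoid setoid

  p-ε : p ε ≡ 𝟎
  p-ε = begin
    p ε                ≡⟨ ⊞-cancelˡ (p ε) (p ε) ⟨
    p ε ⊞ (p ε ⊞ p ε)  ≡⟨ cong (p ε ⊞_) (≡.trans (p-cong (sym (identityˡ ε))) (p-∙ ε ε)) ⟨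
    p ε ⊞ p ε          ≡⟨ ⊞-self (p ε) ⟩
    𝟎                  ∎
    where open ≡.≡-Reasoning

  p-⁻¹ : ∀ x → p (x ⁻¹) ≡ p x
  p-⁻¹ x = ⊞-zero⇒≡ _ _ (≡.trans (≡.sym (p-∙ (x ⁻¹) x)) (≡.trans (p-cong (inverseˡ x)) p-ε))

  p-·e : ∀ c → p (c · e) ≡ 𝟎
  p-·e zero    = p-ε
  p-·e (suc c) = ≡.trans (p-∙ e _) (≡.trans (cong₂ _⊞_ p-e (p-·e c)) (⊞-self 𝟎))

  p-σ : ∀ xs → p (σ xs) ≡ vsum p xs
  p-σ []       = p-ε
  p-σ (x ∷ xs) = ≡.trans (p-∙ x _) (cong (p x ⊞_) (p-σ xs))

-- Sub-multisets with p-sum 𝟎 are called blocks, and c is the weight of a block c · e.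
Good : (K : Context r) (Q : ℕ → ℕ → Set) → List (Context.Carrier K) → Set
Good K Q X = ∀ ys zs → ys ++ zs ↭ X → p (σ ys) ≡ 𝟎 →
  ∃[ c ] c < 71 × σ ys ≈ c · e × Q (length ys) c
  where open Context K

module _ (K : Context r) where
  open Context K

  Good-⊆ : ∀ Q {X Y} W → X ++ W ↭ Y → Good K Q Y → Good K Q X
  Good-⊆ Q {X} {Y} W π good ys zs ρ = good ys (zs ++ W) (begin
    ys ++ zs ++ W    ≡⟨ ++-assoc ys zs W ⟨
    (ys ++ zs) ++ W  ↭⟨ ++⁺ʳ W ρ ⟩
    X ++ W           ↭⟨ π ⟩
    Y                ∎)
    where open PermutationReasoning

module _ (K : Context (suc r)) where
  open Context K

  hyperplaneContext : F (suc r) → Context r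
  hyperplaneContext f = record
    { abelianGroup = abelianGroup
    ; e      = e
    ; p      = quot f ∘ p
    ; p-cong = cong (quot f) ∘ p-cong
    ; p-∙    = λ x y → ≡.trans (cong (quot f) (p-∙ x y)) (quot-⊞ f _ _)
    ; p-e    = ≡.trans (cong (quot f) p-e) (quot-𝟎 f)
    ; e-even = e-even
    ; e-inj  = e-inj
    }

  -- `l` vanishes on all sums over X but not at `f`, so no sum has p-value `f` and the quotient by
  -- `f` creates no new block.
  hyperplane-good : ∀ Q {X} f l → dot l f ≡ true → All (λ x → dot l (p x) ≡ false) X →
    Good K Q X → Good (hyperplaneContext f) Q X
  hyperplane-good Q {X} f l lf lX good ys zs π eq = good ys zs π (kernel (quot-kernel f _ f≢𝟎 eq))
    where
    f≢𝟎 : f ≢ 𝟎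
    f≢𝟎 f≡𝟎 with () ← ≡.trans (≡.sym lf) (≡.trans (cong (dot l) f≡𝟎) (dot-𝟎 l))
    kernel : p (σ ys) ≡ 𝟎 ⊎ p (σ ys) ≡ f → p (σ ys) ≡ 𝟎
    kernel (inj₁ eq′) = eq′
    kernel (inj₂ eq′) with () ← ≡.trans (≡.sym lf) (≡.trans (≡.sym (cong (dot l) (≡.trans (≡.sym (p-σ ys)) eq′)))
      (dot-vsum l p ys (Allₚ.++⁻ˡ ys (All-resp-↭ (↭-sym π) lX))))

  module _ (τ : Carrier) (τ∙τ≈ε : τ ∙ τ ≈ ε) (pτ≢𝟎 : p τ ≢ 𝟎) where
    open Solver using (solve; _⊜_) renaming (_⊕_ to _⊙_)

    private
      -- The quotient by τ is a coarser equality on the same carrier, so that lists of terms and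
      -- multiples of `e` need not be transported.
      _≋_ : Carrier → Carrier → Set
      x ≋ y = x ≈ y ⊎ x ≈ y ∙ τ

      flip-τ : ∀ {x y} → x ≈ y ∙ τ → x ∙ τ ≈ y
      flip-τ {x} {y} eq = begin
        x ∙ τ        ≈⟨ ∙-congʳ eq ⟩
        y ∙ τ ∙ τ    ≈⟨ assoc y τ τ ⟩
        y ∙ (τ ∙ τ)  ≈⟨ ∙-congˡ τ∙τ≈ε ⟩
        y ∙ ε        ≈⟨ identityʳ y ⟩
        y            ∎
        where open ≈-Reasoning

      ≋-sym : ∀ {x y} → x ≋ y → y ≋ x
      ≋-sym (inj₁ eq) = inj₁ (sym eq)
      ≋-sym (inj₂ eq) = inj₂ (sym (flip-τ eq))

      ≋-trans : ∀ {x y z} → x ≋ y → y ≋ z → x ≋ z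
      ≋-trans (inj₁ eq) (inj₁ eq′) = inj₁ (trans eq eq′)
      ≋-trans (inj₁ eq) (inj₂ eq′) = inj₂ (trans eq eq′)
      ≋-trans (inj₂ eq) (inj₁ eq′) = inj₂ (trans eq (∙-congʳ eq′))
      ≋-trans (inj₂ eq) (inj₂ eq′) = inj₁ (trans eq (flip-τ eq′))

      ≋-∙-cong : ∀ {x y u v} → x ≋ y → u ≋ v → (x ∙ u) ≋ (y ∙ v)
      ≋-∙-cong (inj₁ eq) (inj₁ eq′) = inj₁ (∙-cong eq eq′)
      ≋-∙-cong {y = y} {v = v} (inj₁ eq) (inj₂ eq′) = inj₂ (trans (∙-cong eq eq′) (sym (assoc y v τ)))
      ≋-∙-cong {y = y} {v = v} (inj₂ eq) (inj₁ eq′) = inj₂ (trans (∙-cong eq eq′)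
        (solve 3 (λ y τ v → (y ⊙ τ) ⊙ v ⊜ (y ⊙ v) ⊙ τ) refl y τ v))
      ≋-∙-cong {y = y} {v = v} (inj₂ eq) (inj₂ eq′) = inj₁ (begin
        _                    ≈⟨ ∙-cong eq eq′ ⟩
        (y ∙ τ) ∙ (v ∙ τ)    ≈⟨ solve 3 (λ y τ v → (y ⊙ τ) ⊙ (v ⊙ τ) ⊜ (y ⊙ v) ⊙ (τ ⊙ τ)) refl y τ v ⟩
        (y ∙ v) ∙ (τ ∙ τ)    ≈⟨ ∙-congˡ τ∙τ≈ε ⟩
        (y ∙ v) ∙ ε          ≈⟨ identityʳ _ ⟩
        y ∙ v                ∎)
        where open ≈-Reasoning

      τ⁻¹≈τ : τ ⁻¹ ≈ τ
      τ⁻¹≈τ = ∙-cancelʳ τ _ _ (trans (inverseˡ τ) (sym τ∙τ≈ε))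

      ≋-⁻¹-cong : ∀ {x y} → x ≋ y → (x ⁻¹) ≋ (y ⁻¹)
      ≋-⁻¹-cong (inj₁ eq) = inj₁ (⁻¹-cong eq)
      ≋-⁻¹-cong {y = y} (inj₂ eq) = inj₂ (trans (⁻¹-cong eq) (trans (sym (⁻¹-∙-comm y τ)) (∙-congˡ τ⁻¹≈τ)))

      -- As `p τ ≢ 𝟎`, elements of p-value 𝟎 cannot differ by τ. Doubles and multiples of `e` are
      -- such elements, so `e-even` and `e-inj` pass to the quotient.
      τ-free : ∀ {x y} → p x ≡ 𝟎 → p y ≡ 𝟎 → x ≋ y → x ≈ y
      τ-free px py (inj₁ eq) = eq
      τ-free {x} {y} px py (inj₂ eq) = contradiction pτ≡𝟎 pτ≢𝟎
        where
        open ≡.≡-Reasoning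
        pτ≡𝟎 : p τ ≡ 𝟎
        pτ≡𝟎 = begin
          p τ        ≡⟨ ⊞-identityˡ (p τ) ⟨
          𝟎 ⊞ p τ    ≡⟨ cong (_⊞ p τ) py ⟨
          p y ⊞ p τ  ≡⟨ p-∙ y τ ⟨
          p (y ∙ τ)  ≡⟨ p-cong eq ⟨
          p x        ≡⟨ px ⟩
          𝟎          ∎

      p-double : ∀ v → p (v ∙ v) ≡ 𝟎
      p-double v = ≡.trans (p-∙ v v) (⊞-self (p v))

      ≋-isAbelianGroup : IsAbelianGroup _≋_ _∙_ ε _⁻¹
      ≋-isAbelianGroup = record
        { isGroup = record
          { isMonoid = record
            { isSemigroup = record
              { isMagma = record
                { isEquivalence = record { refl = inj₁ refl ; sym = ≋-sym ; trans = ≋-trans }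
                ; ∙-cong = ≋-∙-cong
                }
              ; assoc = λ x y z → inj₁ (assoc x y z)
              }
            ; identity = (λ x → inj₁ (identityˡ x)) , λ x → inj₁ (identityʳ x)
            }
          ; inverse = (λ x → inj₁ (inverseˡ x)) , λ x → inj₁ (inverseʳ x)
          ; ⁻¹-cong = ≋-⁻¹-cong
          }
        ; comm = λ x y → inj₁ (comm x y)
        }

    quotientContext : Context r
    quotientContext = record
      { abelianGroup = record { isAbelianGroup = ≋-isAbelianGroup }
      ; e      = e
      ; p      = quot (p τ) ∘ p
      ; p-cong = λ
        { (inj₁ eq) → cong (quot (p τ)) (p-cong eq)
        ; {x} {y} (inj₂ eq) → ≡.trans (cong (quot (p τ)) (≡.trans (p-cong eq) (p-∙ y τ)))
            (≡.trans (quot-⊞ (p τ) _ _) (≡.trans (cong (quot (p τ) (p y) ⊞_) (quot-self (p τ))) (⊞-identityʳ _)))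
        }
      ; p-∙    = λ x y → ≡.trans (cong (quot (p τ)) (p-∙ x y)) (quot-⊞ (p τ) _ _)
      ; p-e    = ≡.trans (cong (quot (p τ)) p-e) (quot-𝟎 (p τ))
      ; e-even = λ v c eq → e-even v c (τ-free (p-double v) (p-·e c) eq)
      ; e-inj  = λ c d c< d< eq → e-inj c d c< d< (τ-free (p-·e c) (p-·e d) eq)
      }

double-cancel : ∀ d c k → d + (c + c) ≡ k + k → ∃[ j ] d ≡ j + j
double-cancel d zero    k       eq = k , ≡.trans (≡.sym (+-identityʳ d)) eq
double-cancel d (suc c) zero    eq with () ← ≡.trans (≡.sym (+-suc d (c + suc c))) eq
double-cancel d (suc c) (suc k) eq = double-cancel d c k (suc-injective (suc-injective (begin
  suc (suc (d + (c + c)))  ≡⟨ cong suc (+-suc d _) ⟨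
  suc (d + suc (c + c))    ≡⟨ +-suc d _ ⟨
  d + suc (suc (c + c))    ≡⟨ cong (λ x → d + suc x) (+-suc c c) ⟨
  d + (suc c + suc c)      ≡⟨ eq ⟩
  suc k + suc k            ≡⟨ cong suc (+-suc k k) ⟩
  suc (suc (k + k))        ∎)))
  where open ≡.≡-Reasoning

halve : ∀ c d k → c + d ≡ k + k → d ≤ c → ∃[ j ] c ∸ d ≡ j + j
halve c d k eq d≤c = double-cancel (c ∸ d) d k (begin
  c ∸ d + (d + d)  ≡⟨ +-assoc (c ∸ d) d d ⟨
  c ∸ d + d + d    ≡⟨ cong (_+ d) (m∸n+n≡m d≤c) ⟩
  c + d            ≡⟨ eq ⟩
  k + k            ∎)
  where open ≡.≡-Reasoning

even≢odd′ : ∀ j k → j + j ≢ suc (k + k)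
even≢odd′ (suc j) k eq = even≢odd′ k j (≡.sym (suc-injective (≡.trans (cong suc (≡.sym (+-suc j j))) eq)))

module _ (K : Context (suc r)) where
  open Context K
  open Solver using (solve; _⊜_) renaming (_⊕_ to _⊙_)

  -- `Q` restricts weights while two parallel terms i and j are present, `Q′` after they are
  -- dropped. An old block of weight c has weight c + 1 together with i and j: `Q-zero`. A set that
  -- is a block only modulo the involution is completed to a block by i and by j; for i = (2m + 1)e
  -- + j its new weight is m + 1 below the one and m above the other: `Q-one`.
  module _ {Q Q′ : ℕ → ℕ → Set}
    (Q-pos : ∀ {l c} → Q (suc l) c → 1 ≤ c)
    (Q-zero : ∀ {l c} → Q l c → Q (2 + l) (suc c) → Q′ l c)
    (Q-one : ∀ {l c d j} → Q (suc l) (c + suc j) → Q (suc l) d → c ≡ d + j → Q′ l c)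
    where

    private
      zero-good : ∀ i j X → i ∙ j ≈ e → Good K Q (i ∷ j ∷ X) → Good K Q′ X
      zero-good i j X ij≈e good ys zs π py
        with good ys (i ∷ j ∷ zs) (↭-trans (shifts ys (i ∷ j ∷ [])) (prep i (prep j π))) py
           | good (i ∷ j ∷ ys) zs (prep i (prep j π))
               (≡.trans (p-cong (trans (sym (assoc i j _)) (∙-congʳ ij≈e)))
                 (≡.trans (p-∙ e _) (≡.trans (cong₂ _⊞_ p-e py) (⊞-self 𝟎))))
      ... | c , c< , σ≈ , q | d , d< , σ≈′ , q′ = c , c< , σ≈ ,
        Q-zero q (subst (Q _) (e-inj d (suc c) (<-≤-trans d< (m≤m+n 71 71)) (<-≤-trans (s≤s c<) (m≤m+n 72 70)) (begin
          d · e            ≈⟨ σ≈′ ⟨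
          i ∙ (j ∙ σ ys)   ≈⟨ assoc i j _ ⟨
          (i ∙ j) ∙ σ ys   ≈⟨ ∙-cong ij≈e σ≈ ⟩
          suc c · e        ∎)) q′)
        where open ≈-Reasoning

      -- With u = p i = p j and i = (2m + 1)e + j the involution is i − (m + 1)e.
      contract′ : ∀ i j X m → p i ≢ 𝟎 → p j ≡ p i → i ∙ j ≈ e → i ≈ suc (m + m) · e ∙ j → suc (m + m) < 71 →
        Good K Q (i ∷ j ∷ X) →
        ∃ λ τ → ∃₂ λ τ² pτ → Good (quotientContext K τ τ² pτ) Q′ X
      contract′ i j X m pi≢𝟎 pj≡pi ij≈e i≈ m< good = τ , τ∙τ≈ε , pτ≢𝟎 , good′
        where
        open ≈-Reasoning
        a τ : Carrier
        a = suc m · e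
        τ = i ∙ a ⁻¹
        i∙i≈ : i ∙ i ≈ a ∙ a
        i∙i≈ = begin
          i ∙ i                      ≈⟨ ∙-congˡ i≈ ⟩
          i ∙ (suc (m + m) · e ∙ j)  ≈⟨ solve 3 (λ i x j → i ⊙ (x ⊙ j) ⊜ (i ⊙ j) ⊙ x) refl i _ j ⟩
          (i ∙ j) ∙ suc (m + m) · e  ≈⟨ ∙-congʳ ij≈e ⟩
          suc (suc (m + m)) · e      ≡⟨ cong (λ x → suc x · e) (≡.sym (+-suc m m)) ⟩
          (suc m + suc m) · e        ≈⟨ ·-homo-+ e (suc m) (suc m) ⟩
          a ∙ a                      ∎
        τ∙τ≈ε : τ ∙ τ ≈ ε
        τ∙τ≈ε = begin
          (i ∙ a ⁻¹) ∙ (i ∙ a ⁻¹)  ≈⟨ solve 2 (λ i b → (i ⊙ b) ⊙ (i ⊙ b) ⊜ (i ⊙ i) ⊙ (b ⊙ b)) refl i (a ⁻¹) ⟩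
          (i ∙ i) ∙ (a ⁻¹ ∙ a ⁻¹)  ≈⟨ ∙-cong i∙i≈ (⁻¹-∙-comm a a) ⟩
          (a ∙ a) ∙ (a ∙ a) ⁻¹     ≈⟨ inverseʳ _ ⟩
          ε                        ∎
        pτ≡ : p τ ≡ p i
        pτ≡ = ≡.trans (p-∙ i _) (≡.trans (cong (p i ⊞_) (≡.trans (p-⁻¹ a) (p-·e (suc m)))) (⊞-identityʳ _))
        pτ≢𝟎 : p τ ≢ 𝟎
        pτ≢𝟎 = pi≢𝟎 ∘ ≡.trans (≡.sym pτ≡)
        good′ : Good (quotientContext K τ τ∙τ≈ε pτ≢𝟎) Q′ X
        good′ ys zs π eq = case quot-kernel (p τ) _ pτ≢𝟎 eq of λ
          { (inj₁ py≡𝟎) → let c , c< , σ≈ , q = zero-good i j X ij≈e good ys zs π py≡𝟎 in c , c< , inj₁ σ≈ , q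
          ; (inj₂ py≡pτ) → one-case (≡.trans py≡pτ pτ≡)
          }
          where
          one-case : p (σ ys) ≡ p i → _
          one-case py with good (i ∷ ys) (j ∷ zs) (prep i (↭-trans (shift j ys zs) (prep j π)))
                             (≡.trans (p-∙ i _) (≡.trans (cong (p i ⊞_) py) (⊞-self _)))
                         | good (j ∷ ys) (i ∷ zs) (↭-trans (prep j (shift i ys zs)) (swap j i π))
                             (≡.trans (p-∙ j _) (≡.trans (cong₂ _⊞_ pj≡pi py) (⊞-self _)))
          ... | c , c< , σ≈ , q | d , d< , σ≈′ , q′ = d + m
            , <-≤-trans (s≤s (m≤n+m (d + m) m)) (≤-trans (≤-reflexive (≡.trans (arith m d) (≡.sym c≡))) (<⇒≤ c<))
            , inj₂ σys≈ , Q-one (subst (Q _) (≡.trans c≡ (arith′ m d)) q) q′ ≡.refl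
            where
            arith : ∀ m d → suc (m + (d + m)) ≡ suc (m + m) + d
            arith = solve-∀
            arith′ : ∀ m d → suc (m + m) + d ≡ d + m + suc m
            arith′ = solve-∀
            ce≈ : c · e ≈ (suc (m + m) + d) · e
            ce≈ = begin
              c · e                            ≈⟨ σ≈ ⟨
              i ∙ σ ys                         ≈⟨ ∙-congʳ i≈ ⟩
              (suc (m + m) · e ∙ j) ∙ σ ys     ≈⟨ assoc _ j _ ⟩
              suc (m + m) · e ∙ (j ∙ σ ys)     ≈⟨ ∙-congˡ σ≈′ ⟩
              suc (m + m) · e ∙ d · e          ≈⟨ ·-homo-+ e (suc (m + m)) d ⟨
              (suc (m + m) + d) · e            ∎
            c≡ : c ≡ suc (m + m) + d
            c≡ = e-inj c (suc (m + m) + d) (<-≤-trans c< (m≤m+n 71 71)) (+-mono-≤ m< (<⇒≤ d<)) ce≈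
            s∙τ≈ : σ ys ∙ τ ≈ (d + m) · e
            s∙τ≈ = begin
              σ ys ∙ (i ∙ a ⁻¹)                 ≈⟨ solve 3 (λ s i b → s ⊙ (i ⊙ b) ⊜ (i ⊙ s) ⊙ b) refl (σ ys) i (a ⁻¹) ⟩
              (i ∙ σ ys) ∙ a ⁻¹                 ≈⟨ ∙-congʳ (trans σ≈ (·-congˡ (≡.trans c≡ (arith′ m d)))) ⟩
              (d + m + suc m) · e ∙ a ⁻¹        ≈⟨ ∙-congʳ (·-homo-+ e (d + m) (suc m)) ⟩
              ((d + m) · e ∙ a) ∙ a ⁻¹          ≈⟨ assoc _ a _ ⟩
              (d + m) · e ∙ (a ∙ a ⁻¹)          ≈⟨ ∙-congˡ (inverseʳ a) ⟩
              (d + m) · e ∙ ε                   ≈⟨ identityʳ _ ⟩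
              (d + m) · e                       ∎
            σys≈ : σ ys ≈ (d + m) · e ∙ τ
            σys≈ = begin
              σ ys              ≈⟨ identityʳ _ ⟨
              σ ys ∙ ε          ≈⟨ ∙-congˡ τ∙τ≈ε ⟨
              σ ys ∙ (τ ∙ τ)    ≈⟨ assoc _ τ τ ⟨
              σ ys ∙ τ ∙ τ      ≈⟨ ∙-congʳ s∙τ≈ ⟩
              (d + m) · e ∙ τ   ∎

      Contracted : Carrier → Carrier → List Carrier → Set
      Contracted i j X = ∃ λ τ → ∃₂ λ τ² pτ → Good (quotientContext K τ τ² pτ) Q′ X

      unequal-weights : ∀ i j X m s c d → p i ≢ 𝟎 → p j ≡ p i → i ∙ j ≈ e →
        i ∙ s ≈ c · e → j ∙ s ≈ d · e → c ≡ suc m + d → c < 71 → ∃[ k ] m ≡ k + k →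
        Good K Q (i ∷ j ∷ X) → Contracted i j X
      unequal-weights i j X .(k + k) s c d pi pj ij≈e is≈ js≈ c≡ c< (k , ≡.refl) =
        contract′ i j X k pi pj ij≈e i≈ (<-≤-trans (s≤s (m≤m+n (suc (k + k)) d)) (≤-trans (s≤s (≤-reflexive (≡.sym c≡))) c<))
        where
        open ≈-Reasoning
        i≈ : i ≈ suc (k + k) · e ∙ j
        i≈ = ∙-cancelʳ s _ _ (begin
          i ∙ s                        ≈⟨ is≈ ⟩
          c · e                        ≡⟨ cong (_· e) c≡ ⟩
          (suc (k + k) + d) · e        ≈⟨ ·-homo-+ e (suc (k + k)) d ⟩
          suc (k + k) · e ∙ d · e      ≈⟨ ∙-congˡ js≈ ⟨
          suc (k + k) · e ∙ (j ∙ s)    ≈⟨ assoc _ j s ⟨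
          suc (k + k) · e ∙ j ∙ s      ∎)

    opaque
      -- If `p i` is not a sum over X, the hyperplane case applies. Otherwise some s completes both
      -- terms to blocks, i + s = c e and j + s = d e, and then 2s = (c + d - 1)e. By `e-even` the
      -- sum c + d is odd, so c and d differ by an odd number, and `contract′` applies with the term
      -- of larger weight in the role of i.
      contract : ∀ i j X → p i ≢ 𝟎 → p j ≡ p i → i ∙ j ≈ e → Good K Q (i ∷ j ∷ X) →
        (∃ λ τ → ∃₂ λ τ² pτ → Good (quotientContext K τ τ² pτ) Q′ X) ⊎ Good (hyperplaneContext K (p i)) Q′ X
      contract i j X pi≢𝟎 pj≡pi ij≈e good with sep p X (p i)
      ... | inj₂ (l , lf , lX) = inj₂ (hyperplane-good K Q′ (p i) l lf lX (zero-good i j X ij≈e good))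
      ... | inj₁ (ys , zs , π , eq)
        with good (i ∷ ys) (j ∷ zs) (prep i (↭-trans (shift j ys zs) (prep j π))) (p-close ≡.refl)
           | good (j ∷ ys) (i ∷ zs) (↭-trans (prep j (shift i ys zs)) (swap j i π)) (p-close pj≡pi)
        where
        p-close : ∀ {k} → p k ≡ p i → p (k ∙ σ ys) ≡ 𝟎
        p-close {k} pk = ≡.trans (p-∙ k _) (≡.trans (cong₂ _⊞_ pk (≡.trans (p-σ ys) eq)) (⊞-self _))
      ... | zero , _ , _ , q | _ with () ← Q-pos q
      ... | c@(suc c′) , c< , is≈ , q | d , d< , js≈ , q′ with e-even (σ ys) (c′ + d) s∙s≈
        where
        open ≈-Reasoning
        s : Carrier
        s = σ ys
        s∙s≈ : s ∙ s ≈ (c′ + d) · e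
        s∙s≈ = ∙-cancelˡ e _ _ (begin
          e ∙ (s ∙ s)        ≈⟨ ∙-congʳ ij≈e ⟨
          (i ∙ j) ∙ (s ∙ s)  ≈⟨ solve 3 (λ i j s → (i ⊙ j) ⊙ (s ⊙ s) ⊜ (i ⊙ s) ⊙ (j ⊙ s)) refl i j s ⟩
          (i ∙ s) ∙ (j ∙ s)  ≈⟨ ∙-cong is≈ js≈ ⟩
          c · e ∙ d · e      ≈⟨ ·-homo-+ e c d ⟨
          (c + d) · e        ∎)
      ... | k , eq′ with <-cmp c d
      ...   | tri≈ _ c≡d _ = ⊥-elim (even≢odd′ c k (≡.trans (cong (c +_) c≡d) (cong suc eq′)))
      ...   | tri> _ _ d<c = inj₁ (unequal-weights i j X (c′ ∸ d) (σ ys) c d pi≢𝟎 pj≡pi ij≈e is≈ js≈ c≡ c< (halve c′ d k eq′ (s≤s⁻¹ d<c)) good)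
        where
        c≡ : c ≡ suc (c′ ∸ d) + d
        c≡ = cong suc (≡.sym (m∸n+n≡m (s≤s⁻¹ d<c)))
      ...   | tri< c<d _ _ = inj₁ (unequal-weights j i X (d ∸ suc c) (σ ys) d c (pi≢𝟎 ∘ ≡.trans (≡.sym pj≡pi)) (≡.sym pj≡pi)
        (trans (comm j i) ij≈e) js≈ is≈ d≡ d< (double-cancel (d ∸ suc c) c k (≡.trans (arith (d ∸ suc c) c′) (≡.trans (cong (c′ +_) (m∸n+n≡m c<d)) eq′)))
        (Good-⊆ K Q [] (↭-trans (↭-reflexive (++-identityʳ _)) (swap j i ↭-refl)) good))
        where
        d≡ : d ≡ suc (d ∸ suc c) + c
        d≡ = ≡.trans (≡.sym (m∸n+n≡m c<d)) (+-suc (d ∸ suc c) c)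
        arith : ∀ m c′ → m + (suc c′ + suc c′) ≡ c′ + (m + suc (suc c′))
        arith = solve-∀

-- Small weights in every rank

∈⇒↭ : ∀ {x : E} {xs} → x ∈ xs → ∃[ xs′ ] x ∷ xs′ ↭ xs
∈⇒↭ (here ≡.refl) = _ , ↭-refl
∈⇒↭ {x = x} {xs = y ∷ _} (there x∈xs) = let xs′ , π = ∈⇒↭ x∈xs in y ∷ xs′ , ↭-trans (swap x y ↭-refl) (prep y π)

All-↭ : ∀ {P : E → Set} xs → (∀ x xs′ → x ∷ xs′ ↭ xs → P x) → All P xs
All-↭ []       f = []
All-↭ (x ∷ xs) f = f x xs ↭-refl ∷ All-↭ xs λ y ys π → f y (x ∷ ys) (↭-trans (swap y x ↭-refl) (prep x π))

All-⊎ : ∀ {P Q : E → Set} {xs} → All (λ x → P x ⊎ Q x) xs → ∃₂ λ ys zs → ys ++ zs ↭ xs × All P ys × All Q zs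
All-⊎ [] = [] , [] , ↭-refl , [] , []
All-⊎ {xs = x ∷ xs} (inj₁ px ∷ pxs) = let ys , zs , π , pys , qzs = All-⊎ pxs in x ∷ ys , zs , prep x π , px ∷ pys , qzs
All-⊎ {xs = x ∷ xs} (inj₂ qx ∷ pxs) = let ys , zs , π , pys , qzs = All-⊎ pxs in
  ys , x ∷ zs , ↭-trans (shift x ys zs) (prep x π) , pys , qx ∷ qzs

⊆⇒↭ : {ys xs : List E} → ys ⊆ xs → ∃[ zs ] ys ++ zs ↭ xs
⊆⇒↭ [] = [] , ↭-refl
⊆⇒↭ {ys = ys} (x ∷ʳ s) = let zs , π = ⊆⇒↭ s in x ∷ zs , ↭-trans (shift x ys zs) (prep x π)
⊆⇒↭ (_∷_ {x = x} ≡.refl s) = let zs , π = ⊆⇒↭ s in zs , prep x π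

⊆-resp-↭ : {ys ws xs : List E} → ys ⊆ ws → ws ↭ xs → ∃[ ys′ ] ys′ ⊆ xs × ys ↭ ys′
⊆-resp-↭ s Perm.refl = _ , s , ↭-refl
⊆-resp-↭ (x ∷ʳ s) (prep x π) = let ys′ , s′ , ρ = ⊆-resp-↭ s π in ys′ , x ∷ʳ s′ , ρ
⊆-resp-↭ (≡.refl ∷ s) (prep x π) = let ys′ , s′ , ρ = ⊆-resp-↭ s π in x ∷ ys′ , ≡.refl ∷ s′ , prep x ρ
⊆-resp-↭ (x ∷ʳ y ∷ʳ s) (swap x y π) = let ys′ , s′ , ρ = ⊆-resp-↭ s π in ys′ , y ∷ʳ x ∷ʳ s′ , ρ
⊆-resp-↭ (x ∷ʳ ≡.refl ∷ s) (swap x y π) = let ys′ , s′ , ρ = ⊆-resp-↭ s π in y ∷ ys′ , ≡.refl ∷ x ∷ʳ s′ , prep y ρ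
⊆-resp-↭ (≡.refl ∷ y ∷ʳ s) (swap x y π) = let ys′ , s′ , ρ = ⊆-resp-↭ s π in x ∷ ys′ , y ∷ʳ ≡.refl ∷ s′ , prep x ρ
⊆-resp-↭ (≡.refl ∷ ≡.refl ∷ s) (swap x y π) = let ys′ , s′ , ρ = ⊆-resp-↭ s π in y ∷ x ∷ ys′ , ≡.refl ∷ ≡.refl ∷ s′ , swap x y ρ
⊆-resp-↭ s (Perm.trans π ρ) =
  let ys′ , s′ , π′ = ⊆-resp-↭ s π
      ys″ , s″ , ρ′ = ⊆-resp-↭ s′ ρ
  in ys″ , s″ , ↭-trans π′ ρ′

↭⇒⊆ : ∀ (ys zs : List E) {xs} → ys ++ zs ↭ xs → ∃[ ys′ ] ys′ ⊆ xs × ys ↭ ys′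
↭⇒⊆ ys zs π = ⊆-resp-↭ (⊆-++ʳ zs ⊆-refl) π

search-⊆ : (xs : List E) (P R : List E → Set) → (∀ ys → ys ⊆ xs → P ys ⊎ R ys) →
  (∀ ys → ys ⊆ xs → P ys) ⊎ (∃[ ys ] ys ⊆ xs × R ys)
search-⊆ [] P R f with f [] []
... | inj₁ q = inj₁ λ { _ [] → q }
... | inj₂ q = inj₂ ([] , [] , q)
search-⊆ (x ∷ xs) P R f with search-⊆ xs P R (λ ys s → f ys (x ∷ʳ s)) | search-⊆ xs (P ∘ (x ∷_)) (R ∘ (x ∷_)) (λ ys s → f (x ∷ ys) (≡.refl ∷ s))
... | inj₁ p | inj₁ q = inj₁ λ { ys (_ ∷ʳ s) → p ys s ; _ (≡.refl ∷ s) → q _ s }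
... | inj₂ (ys , s , q) | _ = inj₂ (ys , x ∷ʳ s , q)
... | inj₁ _ | inj₂ (ys , s , q) = inj₂ (x ∷ ys , ≡.refl ∷ s , q)

opaque
  search-↭ : (xs : List E) (P R : List E → Set) → (∀ {ys ys′} → ys ↭ ys′ → P ys → P ys′) →
    (∀ ys zs → ys ++ zs ↭ xs → P ys ⊎ R ys) →
    (∀ ys zs → ys ++ zs ↭ xs → P ys) ⊎ (∃₂ λ ys zs → ys ++ zs ↭ xs × R ys)
  search-↭ xs P R resp f with search-⊆ xs P R (λ ys s → let zs , π = ⊆⇒↭ s in f ys zs π)
  ... | inj₁ p = inj₁ λ ys zs π → let ys′ , s , ρ = ↭⇒⊆ ys zs π in resp (↭-sym ρ) (p ys′ s)
  ... | inj₂ (ys , s , q) = let zs , π = ⊆⇒↭ s in inj₂ (ys , zs , π , q)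

⊞-outside : (u v : F r) → u ⊞ v ≡ u → v ≡ 𝟎
⊞-outside u v eq = ≡.trans (≡.sym (⊞-cancelˡ u v)) (≡.trans (cong (u ⊞_) eq) (⊞-self u))

double-injective : ∀ m n → m + m ≡ n + n → m ≡ n
double-injective m n eq with <-cmp m n
... | tri≈ _ m≡n _ = m≡n
... | tri< m<n _ _ = contradiction eq (<⇒≢ (+-mono-< m<n m<n))
... | tri> _ _ n<m = contradiction eq (>⇒≢ (+-mono-< n<m n<m))

half-≤ : ∀ {m n} → m + m ≤ n + n → m ≤ n
half-≤ {m} {n} m+m≤n+n with m ≤? n
... | yes m≤n = m≤n
... | no  m≰n = contradiction (+-mono-< (≰⇒> m≰n) (≰⇒> m≰n)) (≤⇒≯ m+m≤n+n)

module _ (K : Context r) where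
  open Context K
  open Solver using (solve; _⊜_) renaming (_⊕_ to _⊙_)
  open ≈-Reasoning

  -- Doubles are compared because x itself need not be a multiple of `e`; 2x = 0 counts as negative.
  -- With at most nine terms the bound 4 keeps the doubles of sums within the range of `e-inj`.
  Positive Negative : Carrier → Set
  Positive x = ∃[ a ] 1 ≤ a × a ≤ 4 × x ∙ x ≈ (a + a) · e
  Negative x = ∃[ a ] a ≤ 4 × x ∙ x ∙ (a + a) · e ≈ ε

  -- Two blocks that meet only in x determine 2x.
  twice : ∀ {x s t a b c} → x ∙ s ≈ a · e → x ∙ t ≈ b · e → s ∙ t ≈ c · e →
    x ∙ x ∙ c · e ≈ (a + b) · e
  twice {x} {s} {t} {a} {b} {c} xs≈ xt≈ st≈ = begin
    x ∙ x ∙ c · e      ≈⟨ ∙-congˡ st≈ ⟨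
    x ∙ x ∙ (s ∙ t)    ≈⟨ solve 3 (λ x s t → (x ⊙ x) ⊙ (s ⊙ t) ⊜ (x ⊙ s) ⊙ (x ⊙ t)) refl x s t ⟩
    (x ∙ s) ∙ (x ∙ t)  ≈⟨ ∙-cong xs≈ xt≈ ⟩
    a · e ∙ b · e      ≈⟨ ·-homo-+ e a b ⟨
    (a + b) · e        ∎

  -- `e-even` makes the difference of the two coefficients even; in the second alternative it is
  -- applied to `x ⁻¹`.
  twice-sign : ∀ {x} b c → x ∙ x ∙ c · e ≈ b · e →
    (∃[ a ] 1 ≤ a × a + a + c ≡ b × x ∙ x ≈ (a + a) · e) ⊎
    (∃[ a ] a + a + b ≡ c × x ∙ x ∙ (a + a) · e ≈ ε)
  twice-sign {x} b c eq with <-cmp c b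
  ... | tri< c<b _ _ = inj₁ (let a , a≡ = e-even x (b ∸ c) x²≈ in
    a , positive a a≡ , ≡.trans (cong (_+ c) (≡.sym a≡)) (m∸n+n≡m (<⇒≤ c<b)) , trans x²≈ (·-congˡ a≡))
    where
    x²≈ : x ∙ x ≈ (b ∸ c) · e
    x²≈ = ∙-cancelʳ (c · e) _ _ (begin
      x ∙ x ∙ c · e          ≈⟨ eq ⟩
      b · e                  ≡⟨ cong (_· e) (m∸n+n≡m (<⇒≤ c<b)) ⟨
      (b ∸ c + c) · e        ≈⟨ ·-homo-+ e (b ∸ c) c ⟩
      (b ∸ c) · e ∙ c · e    ∎)
    positive : ∀ a → b ∸ c ≡ a + a → 1 ≤ a
    positive zero    a≡ = contradiction (m∸n≡0⇒m≤n a≡) (<⇒≱ c<b)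
    positive (suc a) _  = s≤s z≤n
  ... | tri≈ _ ≡.refl _ = inj₂ (0 , ≡.refl , trans (identityʳ _) (∙-cancelʳ (c · e) _ _ (trans eq (sym (identityˡ _)))))
  ... | tri> _ _ b<c = inj₂ (let a , a≡ = e-even (x ⁻¹) (c ∸ b) x⁻²≈ in
    a , ≡.trans (cong (_+ b) (≡.sym a≡)) (m∸n+n≡m (<⇒≤ b<c)) , trans (∙-congˡ (·-congˡ (≡.sym a≡))) x²≈)
    where
    x²≈ : x ∙ x ∙ (c ∸ b) · e ≈ ε
    x²≈ = ∙-cancelʳ (b · e) _ _ (begin
      x ∙ x ∙ (c ∸ b) · e ∙ b · e    ≈⟨ assoc _ _ _ ⟩
      x ∙ x ∙ ((c ∸ b) · e ∙ b · e)  ≈⟨ ∙-congˡ (·-homo-+ e (c ∸ b) b) ⟨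
      x ∙ x ∙ (c ∸ b + b) · e        ≡⟨ cong (λ n → x ∙ x ∙ n · e) (m∸n+n≡m (<⇒≤ b<c)) ⟩
      x ∙ x ∙ c · e                  ≈⟨ eq ⟩
      b · e                          ≈⟨ identityˡ _ ⟨
      ε ∙ b · e                      ∎)
    x⁻²≈ : x ⁻¹ ∙ x ⁻¹ ≈ (c ∸ b) · e
    x⁻²≈ = ∙-cancelˡ (x ∙ x) _ _ (begin
      (x ∙ x) ∙ (x ⁻¹ ∙ x ⁻¹)  ≈⟨ ∙-congˡ (⁻¹-∙-comm x x) ⟩
      (x ∙ x) ∙ (x ∙ x) ⁻¹     ≈⟨ inverseʳ _ ⟩
      ε                        ≈⟨ x²≈ ⟨
      x ∙ x ∙ (c ∸ b) · e      ∎)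

  σ-Positive : ∀ {ys} → All Positive ys → ∃[ a ] length ys ≤ a × a ≤ length ys * 4 × σ ys ∙ σ ys ≈ (a + a) · e
  σ-Positive [] = 0 , z≤n , z≤n , identityˡ ε
  σ-Positive {x ∷ ys} ((b , 1≤b , b≤4 , x²≈) ∷ pys) = let a , len≤a , a≤ , σ²≈ = σ-Positive pys in
    b + a , +-mono-≤ 1≤b len≤a , +-mono-≤ b≤4 a≤ , (begin
      (x ∙ σ ys) ∙ (x ∙ σ ys)        ≈⟨ solve 2 (λ x s → (x ⊙ s) ⊙ (x ⊙ s) ⊜ (x ⊙ x) ⊙ (s ⊙ s)) refl x (σ ys) ⟩
      (x ∙ x) ∙ (σ ys ∙ σ ys)        ≈⟨ ∙-cong x²≈ σ²≈ ⟩
      (b + b) · e ∙ (a + a) · e      ≈⟨ ·-homo-+ e (b + b) (a + a) ⟨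
      (b + b + (a + a)) · e          ≡⟨ cong (_· e) (arith b a) ⟩
      (b + a + (b + a)) · e          ∎)
    where
    arith : ∀ b a → b + b + (a + a) ≡ b + a + (b + a)
    arith = solve-∀

  σ-Negative : ∀ {ys} → All Negative ys → ∃[ a ] a ≤ length ys * 4 × σ ys ∙ σ ys ∙ (a + a) · e ≈ ε
  σ-Negative [] = 0 , z≤n , trans (identityʳ _) (identityˡ ε)
  σ-Negative {x ∷ ys} ((b , b≤4 , x²≈) ∷ pys) = let a , a≤ , σ²≈ = σ-Negative pys in
    b + a , +-mono-≤ b≤4 a≤ , (begin
      (x ∙ σ ys) ∙ (x ∙ σ ys) ∙ (b + a + (b + a)) · e           ≡⟨ cong (λ n → (x ∙ σ ys) ∙ (x ∙ σ ys) ∙ n · e) (arith b a) ⟨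
      (x ∙ σ ys) ∙ (x ∙ σ ys) ∙ (b + b + (a + a)) · e           ≈⟨ ∙-congˡ (·-homo-+ e (b + b) (a + a)) ⟩
      (x ∙ σ ys) ∙ (x ∙ σ ys) ∙ ((b + b) · e ∙ (a + a) · e)     ≈⟨ solve 4 (λ x s u v → ((x ⊙ s) ⊙ (x ⊙ s)) ⊙ (u ⊙ v) ⊜ ((x ⊙ x) ⊙ u) ⊙ ((s ⊙ s) ⊙ v)) refl x (σ ys) _ _ ⟩
      (x ∙ x ∙ (b + b) · e) ∙ (σ ys ∙ σ ys ∙ (a + a) · e)       ≈⟨ ∙-cong x²≈ σ²≈ ⟩
      ε ∙ ε                                                     ≈⟨ identityˡ ε ⟩
      ε                                                         ∎)
    where
    arith : ∀ b a → b + b + (a + a) ≡ b + a + (b + a)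
    arith = solve-∀

  double-· : ∀ {x c} → x ≈ c · e → x ∙ x ≈ (c + c) · e
  double-· {x} {c} x≈ = trans (∙-cong x≈ x≈) (sym (·-homo-+ e c c))

Qn : ℕ → ℕ → Set
Qn l c = 1 ≤ l → 1 ≤ c × c < l

-- The inequality fails for r = 4, whence the restriction of `no-2r+1` to rank at most 4.
2^r<2r+3 : ∀ r → r ≤ 3 → 2 ^ r < suc (suc r + suc r)
2^r<2r+3 0 _ = s≤s (s≤s z≤n)
2^r<2r+3 1 _ = m≤m+n 3 2
2^r<2r+3 2 _ = m≤m+n 5 2
2^r<2r+3 3 _ = ≤-refl
2^r<2r+3 (suc (suc (suc (suc r)))) (s≤s (s≤s (s≤s ())))

opaque
  -- A parallel pair has sum e, its weight being below 2, and contracting it leaves 2r - 1 terms in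
  -- rank r - 1. Otherwise the p-values are distinct and so dense that every term lies on a line.
  -- This gives a sign to the double of each term; some r + 1 terms of equal sign contain a block,
  -- whose weight is then at least its length or not positive.
  no-2r+1 : ∀ r → r ≤ 4 → (K : Context r) → ∀ X → length X ≡ suc (r + r) → Good K Qn X → ⊥
  no-2r+1 zero _ K (x ∷ []) _ good with good (x ∷ []) [] ↭-refl (trivial _)
    where
    trivial : (u : F 0) → u ≡ 𝟎
    trivial [] = ≡.refl
  ... | c , _ , _ , q with s≤s () ← ≤-trans (s≤s (q ≤-refl .proj₁)) (q ≤-refl .proj₂)
  no-2r+1 zero _ K (x ∷ y ∷ X) () good
  no-2r+1 (suc r) (s≤s r≤3) K X len good = two-colours (All-⊎ (All-↭ X sign))
    where
    open Context K
    length-X′ : ∀ {X′} → X′ ↭ X → length X′ ≡ suc (suc r + suc r)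
    length-X′ π = ≡.trans (↭-length π) len

    length-X≤9 : length X ≤ 9
    length-X≤9 = ≤-trans (≤-reflexive len) (s≤s (+-mono-≤ (s≤s r≤3) (s≤s r≤3)))

    length-block : ∀ ys zs → ys ++ zs ↭ X → length ys ≤ 9
    length-block ys zs π = ≤-trans (m≤m+n (length ys) (length zs)) (≤-trans (≤-reflexive (≡.trans (≡.sym (length-++ ys)) (↭-length π))) length-X≤9)

    length-ys : ∀ {i a b Z} ys zs → i ∷ a ∷ b ∷ Z ↭ X → ys ++ zs ↭ Z → length ys ≤ 6
    length-ys {i} {a} {b} ys zs ρ ρ′ = s≤s⁻¹ (s≤s⁻¹ (s≤s⁻¹ (length-block (i ∷ a ∷ b ∷ ys) zs
      (↭-trans (prep i (prep a (prep b ρ′))) ρ))))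

    nonzero : ∀ i X′ → i ∷ X′ ↭ X → p i ≢ 𝟎
    nonzero i X′ π pi≡𝟎 with good (i ∷ []) X′ π (≡.trans (p-∙ i ε) (≡.trans (cong₂ _⊞_ pi≡𝟎 p-ε) (⊞-self 𝟎)))
    ... | c , _ , _ , q with s≤s () ← ≤-trans (s≤s (q ≤-refl .proj₁)) (q ≤-refl .proj₂)

    p-pair : ∀ {i j} → p i ≡ p j → p (σ (i ∷ j ∷ [])) ≡ 𝟎
    p-pair {i} {j} pi≡pj = ≡.trans (p-σ (i ∷ j ∷ [])) (≡.trans (cong₂ _⊞_ pi≡pj (⊞-identityʳ (p j))) (⊞-self (p j)))

    Q-one : ∀ {l c d j} → Qn (suc l) (c + suc j) → Qn (suc l) d → c ≡ d + j → Qn l c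
    Q-one {l} {c} {d} {j} q q′ ≡.refl _ = ≤-trans (q′ (s≤s z≤n) .proj₁) (m≤m+n d j)
      , <-≤-trans (s≤s (m≤m+n c j)) (≤-trans (≤-reflexive (≡.sym (+-suc c j))) (s≤s⁻¹ (q (s≤s z≤n) .proj₂)))

    no-parallel : ∀ i j X′ → i ∷ j ∷ X′ ↭ X → p i ≢ p j
    no-parallel i j X′ π pi≡pj with good (i ∷ j ∷ []) X′ π (p-pair pi≡pj)
    ... | c , c< , σ≈ , q with q (s≤s z≤n)
    ... | s≤s {n = zero} z≤n , _ with contract K {Q = Qn} {Q′ = Qn} (λ q → q (s≤s z≤n) .proj₁) (λ q _ → q) Q-one
                   i j X′ (nonzero i _ π) (≡.sym pi≡pj) ij≈e (Good-⊆ K Qn [] (↭-trans (↭-reflexive (++-identityʳ _)) π) good)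
      where
      ij≈e : i ∙ j ≈ e
      ij≈e = trans (∙-congˡ (sym (identityʳ j))) (trans σ≈ (identityʳ e))
    ...   | inj₁ (τ , τ² , pτ , good′) = no-2r+1 r (m≤n⇒m≤1+n r≤3) (quotientContext K τ τ² pτ) X′ (length-X″ (length-X′ π)) good′
      where
      length-X″ : ∀ {m} → suc (suc m) ≡ suc (suc r + suc r) → m ≡ suc (r + r)
      length-X″ eq = suc-injective (suc-injective (≡.trans eq (cong (suc ∘ suc) (+-suc r r))))
    ...   | inj₂ good′ = no-2r+1 r (m≤n⇒m≤1+n r≤3) (hyperplaneContext K (p i)) X′ (length-X″ (length-X′ π)) good′
      where
      length-X″ : ∀ {m} → suc (suc m) ≡ suc (suc r + suc r) → m ≡ suc (r + r)
      length-X″ eq = suc-injective (suc-injective (≡.trans eq (cong (suc ∘ suc) (+-suc r r))))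
    no-parallel i j X′ π pi≡pj | c , c< , σ≈ , q | s≤s {n = suc _} z≤n , s≤s (s≤s ())

    -- The 2r + 3 terms fall into 2^r classes modulo `p i`, and two terms of one class form a line
    -- with i. Neither of them is i, since the third point would be 𝟎.
    line-through : ∀ i X′ → i ∷ X′ ↭ X → ∃₂ λ a b → ∃[ Z ] i ∷ a ∷ b ∷ Z ↭ X × p a ⊞ p b ≡ p i
    line-through i X′ π with pigeonhole (quot (p i) ∘ p) X (subst (2 ^ r <_) (≡.sym len) (2^r<2r+3 r r≤3))
    ... | a , b , zs , ρ , eq
      with quot-kernel (p i) (p a ⊞ p b) (nonzero i X′ π) (≡.trans (quot-⊞ (p i) _ _) (≡.trans (cong (_⊞ _) eq) (⊞-self _)))
    ... | inj₁ eq′ = contradiction (⊞-zero⇒≡ _ _ eq′) (no-parallel a b zs ρ)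
    ... | inj₂ eq′ with ∈-resp-↭ (↭-trans π (↭-sym ρ)) (here ≡.refl)
    ...   | here ≡.refl         = contradiction (⊞-outside _ _ eq′) (nonzero b (a ∷ zs) (↭-trans (swap b a ↭-refl) ρ))
    ...   | there (here ≡.refl) = contradiction (⊞-outside _ _ (≡.trans (⊞-comm _ _) eq′)) (nonzero a (b ∷ zs) ρ)
    ...   | there (there i∈zs)  = let Z , π′ = ∈⇒↭ i∈zs in a , b , Z
      , ↭-trans (↭-trans (swap i a ↭-refl) (prep a (swap i b ↭-refl))) (↭-trans (prep a (prep b π′)) ρ) , eq′

    hyperplane-absurd : ∀ f l a Z W → (a ∷ Z) ++ W ↭ X → length Z ≡ r + r → dot l f ≡ true →
      All (λ x → dot l (p x) ≡ false) (a ∷ Z) → ⊥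
    hyperplane-absurd f l a Z W π lenZ lf lZ = no-2r+1 r (m≤n⇒m≤1+n r≤3) (hyperplaneContext K f) (a ∷ Z) (cong suc lenZ)
      (hyperplane-good K Qn f l lf lZ (Good-⊆ K Qn W π good))

    sign : ∀ i X′ → i ∷ X′ ↭ X → Positive K i ⊎ Negative K i
    sign i X′ π with line-through i X′ π
    ... | a , b , Z , ρ , pab with sep p Z (p i)
    ... | inj₂ (l , li , lZ) = ⊥-elim (one-inside (dot l (p a)) (dot l (p b)) ≡.refl ≡.refl
            (≡.trans (≡.sym (dot-⊞ʳ l (p a) (p b))) (≡.trans (cong (dot l) pab) li)))
      where
      lenZ : length Z ≡ r + r
      lenZ = suc-injective (suc-injective (suc-injective (≡.trans (length-X′ ρ) (cong (suc ∘ suc) (+-suc r r)))))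
      -- `l` is 1 at `p i`, the sum of `p a` and `p b`. So exactly one of a and b joins Z in the
      -- kernel of `l`, which makes 2r + 1 terms of rank r.
      one-inside : ∀ u v → dot l (p a) ≡ u → dot l (p b) ≡ v → u xor v ≡ true → ⊥
      one-inside false v la lb _ = hyperplane-absurd (p i) l a Z (i ∷ b ∷ []) (↭-trans (prep a (↭-trans (++-comm Z _) ↭-refl)) (↭-trans (swap a i ↭-refl) ρ)) lenZ li (la ∷ lZ)
      one-inside true false la lb _ = hyperplane-absurd (p i) l b Z (i ∷ a ∷ [])
        (↭-trans (prep b (++-comm Z _)) (↭-trans (swap b i ↭-refl) (↭-trans (prep i (swap b a ↭-refl)) ρ))) lenZ li (lb ∷ lZ)
      one-inside true true _ _ ()
    ... | inj₁ (ys , zs , ρ′ , pys)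
      with good (i ∷ a ∷ b ∷ []) Z ρ (≡.trans (p-σ (i ∷ a ∷ b ∷ [])) (≡.trans (cong (p i ⊞_) (≡.trans (cong (p a ⊞_) (⊞-identityʳ _)) pab)) (⊞-self (p i))))
         | good (i ∷ ys) (a ∷ b ∷ zs) (↭-trans (prep i (↭-trans (shifts ys (a ∷ b ∷ [])) (prep a (prep b ρ′)))) ρ)
             (≡.trans (p-σ (i ∷ ys)) (≡.trans (cong (p i ⊞_) pys) (⊞-self (p i))))
         | good (a ∷ b ∷ ys) (i ∷ zs) (↭-trans (shift i (a ∷ b ∷ ys) zs) (↭-trans (prep i (prep a (prep b ρ′))) ρ))
             (≡.trans (p-σ (a ∷ b ∷ ys)) (≡.trans (≡.sym (⊞-assoc (p a) (p b) _)) (≡.trans (cong₂ _⊞_ pab pys) (⊞-self (p i)))))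
    ... | c , _ , σ≈ , q | d , _ , σ≈′ , q′ | g , _ , σ≈″ , q″
      with twice-sign K (c + d) g (twice K {a = c} {d} {g} (trans (∙-congˡ (∙-congˡ (sym (identityʳ b)))) σ≈) σ≈′ (trans (assoc a b _) σ≈″))
    ... | inj₁ (m , 1≤m , m≡ , i²≈) = inj₁ (m , 1≤m , m≤4 , i²≈)
      where
      m≤4 : m ≤ 4
      m≤4 = half-≤ (begin
        m + m      ≤⟨ m≤m+n (m + m) g ⟩
        m + m + g  ≡⟨ m≡ ⟩
        c + d      ≤⟨ +-mono-≤ (s≤s⁻¹ (q (s≤s z≤n) .proj₂)) (≤-trans (s≤s⁻¹ (q′ (s≤s z≤n) .proj₂)) (length-ys ys zs ρ ρ′)) ⟩
        8          ∎)
        where open ≤-Reasoning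
    ... | inj₂ (m , m≡ , i²≈) = inj₂ (m , m≤4 , i²≈)
      where
      m≤4 : m ≤ 4
      m≤4 = half-≤ (begin
        m + m            ≤⟨ m≤m+n (m + m) (c + d) ⟩
        m + m + (c + d)  ≡⟨ m≡ ⟩
        g                ≤⟨ <⇒≤ (q″ (s≤s z≤n) .proj₂) ⟩
        2 + length ys    ≤⟨ s≤s (s≤s (length-ys ys zs ρ ρ′)) ⟩
        8                ∎)
        where open ≤-Reasoning

    two-colours : (∃₂ λ ys zs → ys ++ zs ↭ X × All (Positive K) ys × All (Negative K) zs) → ⊥
    two-colours (ys , zs , π , pys , nzs)
      with +-split-< {suc r} (length ys) (length zs) (≤-reflexive (≡.trans (≡.sym (length-X′ π)) (length-++ ys)))
    ... | inj₁ r<ys with dep p ys r<ys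
    ...   | y , ws , us , ρ , eq
      with good (y ∷ ws) (us ++ zs) (↭-trans (↭-reflexive (≡.sym (++-assoc (y ∷ ws) us zs))) (↭-trans (++⁺ʳ zs ρ) π)) (≡.trans (p-σ (y ∷ ws)) eq)
         | σ-Positive K (Allₚ.++⁻ˡ (y ∷ ws) (All-resp-↭ (↭-sym ρ) pys))
    ... | c , c< , σ≈ , q | a , len≤a , a≤ , σ²≈ = <-irrefl ≡.refl (<-≤-trans (q (s≤s z≤n) .proj₂) (≤-trans len≤a (≤-reflexive (≡.sym c≡a))))
      where
      len≤9 : length (y ∷ ws) ≤ 9
      len≤9 = length-block (y ∷ ws) (us ++ zs) (↭-trans (↭-reflexive (≡.sym (++-assoc (y ∷ ws) us zs))) (↭-trans (++⁺ʳ zs ρ) π))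
      a≤36 : a ≤ 36
      a≤36 = ≤-trans a≤ (*-monoˡ-≤ 4 len≤9)
      c≡a : c ≡ a
      c≡a = double-injective c a (e-inj (c + c) (a + a) (<-≤-trans (+-mono-< c< c<) ≤-refl)
        (s≤s (≤-trans (+-mono-≤ a≤36 a≤36) (m≤m+n 72 69))) (trans (sym (double-· K {c = c} σ≈)) σ²≈))
    two-colours (ys , zs , π , pys , nzs) | inj₂ r<zs with dep p zs r<zs
    ...   | y , ws , us , ρ , eq
      with good (y ∷ ws) (us ++ ys) (↭-trans (↭-reflexive (≡.sym (++-assoc (y ∷ ws) us ys))) (↭-trans (++⁺ʳ ys ρ) (↭-trans (++-comm zs ys) π))) (≡.trans (p-σ (y ∷ ws)) eq)
         | σ-Negative K (Allₚ.++⁻ˡ (y ∷ ws) (All-resp-↭ (↭-sym ρ) nzs))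
    ... | c , c< , σ≈ , q | a , a≤ , σ²≈ = contradiction (≤-trans (q (s≤s z≤n) .proj₁) (≤-reflexive (m+n≡0⇒m≡0 c (m+n≡0⇒m≡0 (c + c) sum≡0)))) λ ()
      where
      len≤9 : length (y ∷ ws) ≤ 9
      len≤9 = length-block (y ∷ ws) (us ++ ys) (↭-trans (↭-reflexive (≡.sym (++-assoc (y ∷ ws) us ys))) (↭-trans (++⁺ʳ ys ρ) (↭-trans (++-comm zs ys) π)))
      a≤36 : a ≤ 36
      a≤36 = ≤-trans a≤ (*-monoˡ-≤ 4 len≤9)
      c≤9 : c ≤ 9
      c≤9 = ≤-trans (<⇒≤ (q (s≤s z≤n) .proj₂)) len≤9
      sum≡0 : c + c + (a + a) ≡ 0
      sum≡0 = e-inj (c + c + (a + a)) 0 (s≤s (≤-trans (+-mono-≤ (+-mono-≤ c≤9 c≤9) (+-mono-≤ a≤36 a≤36)) (m≤m+n 90 51))) (s≤s z≤n)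
        (begin
          (c + c + (a + a)) · e           ≈⟨ ·-homo-+ e (c + c) (a + a) ⟩
          (c + c) · e ∙ (a + a) · e       ≈⟨ ∙-congʳ (double-· K {c = c} σ≈) ⟨
          σ (y ∷ ws) ∙ σ (y ∷ ws) ∙ (a + a) · e  ≈⟨ σ²≈ ⟩
          ε                               ∎)
        where open ≈-Reasoning

-- Seven terms labelled by F₂³

∀F? : ∀ k {P : F k → Set} → (∀ v → Dec (P v)) → Dec (∀ v → P v)
∀F? zero    P? = map′ (λ p → λ { [] → p }) (λ f → f []) (P? [])
∀F? (suc k) P? = map′ (λ { (f , g) (true ∷ v) → f v ; (f , g) (false ∷ v) → g v })
  (λ f → f ∘ (true ∷_) , f ∘ (false ∷_))
  (∀F? k (P? ∘ (true ∷_)) ×-dec ∀F? k (P? ∘ (false ∷_)))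

points : List (F 3)
points = (true ∷ false ∷ false ∷ []) ∷ (false ∷ true ∷ false ∷ []) ∷ (true ∷ true ∷ false ∷ [])
  ∷ (false ∷ false ∷ true ∷ []) ∷ (true ∷ false ∷ true ∷ []) ∷ (false ∷ true ∷ true ∷ []) ∷ (true ∷ true ∷ true ∷ []) ∷ []

count : List (F k) → F k → ℕ
count []       l = 0
count (χ ∷ χs) l = (if dot χ l then 1 else 0) + count χs l

indicator : F k → F k → ℕ
indicator l m with l ≟ᶠ m
... | yes _ = 1
... | no  _ = 0

-- The Boolean is the weight modulo 2, so that `parity` becomes linearity over F₂.
weight : Bool → ℕ
weight true  = 1
weight false = 2

total : F 3 → List (F 3) → ℕ
total m []       = 0
total m (χ ∷ χs) = weight (dot m χ) + total m χs

opaque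
  on off : F 3 → List (F 3)
  on  l = filterᵇ (λ χ → dot χ l) points
  off l = filterᵇ (λ χ → not (dot χ l)) points

  -- A point of the Fano plane lies on 4 of the complements of lines, and two points on 2 of them.
  count-on-off : ∀ l m → l ≢ 𝟎 → count (on l) m ≡ count (off l) m + 4 * indicator l m
  count-on-off = toWitness {a? = ∀F? 3 λ l → ∀F? 3 λ m → ¬? (l ≟ᶠ 𝟎) →-dec (_ ≟ _)} tt

  -- For m = 𝟎 the two totals are 8 and 6, for m = l they are 4 and 6, and otherwise 6 and 4.
  total-on-off : ∀ m l → l ≢ 𝟎 → total m (on l) ≡ total m (off l) + 2 ⊎ total m (on l) + 2 ≡ total m (off l)
  total-on-off = toWitness {a? = ∀F? 3 λ m → ∀F? 3 λ l → ¬? (l ≟ᶠ 𝟎) →-dec ((_ ≟ _) ⊎-dec (_ ≟ _))} tt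

  on-nonzero : ∀ l → All (_≢ 𝟎) (on l) × All (_≢ 𝟎) (off l)
  on-nonzero = toWitness {a? = ∀F? 3 λ l → All.all? (λ χ → ¬? (χ ≟ᶠ 𝟎)) (on l) ×-dec All.all? (λ χ → ¬? (χ ≟ᶠ 𝟎)) (off l)} tt

word-↭ : ∀ (χ : F k) {ls ms : List (F k × E)} → ls ↭ ms → word χ ls ↭ word χ ms
word-↭ χ Perm.refl = ↭-refl
word-↭ χ (prep (l , x) π) with dot χ l
... | true  = prep x (word-↭ χ π)
... | false = word-↭ χ π
word-↭ χ (swap (l , x) (m , y) π) with dot χ l | dot χ m
... | true  | true  = swap x y (word-↭ χ π)
... | true  | false = prep x (word-↭ χ π)
... | false | true  = prep y (word-↭ χ π)
... | false | false = word-↭ χ π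
word-↭ χ (Perm.trans π ρ) = ↭-trans (word-↭ χ π) (word-↭ χ ρ)

zipWithKeys : {B : Set} (ks : List B) → Vec E (length ks) → List (B × E)
zipWithKeys []       []       = []
zipWithKeys (k ∷ ks) (x ∷ xs) = (k , x) ∷ zipWithKeys ks xs

opaque
  collect : {B : Set} (ks : List B) → AllPairs _≢_ ks → (ls : List (B × E)) →
    All (λ k → ∃[ x ] (k , x) ∈ ls) ks → ∃₂ λ xs rest → zipWithKeys ks xs ++ rest ↭ ls
  collect []       []          ls []                 = [] , ls , ↭-refl
  collect (k ∷ ks) (k∉ks ∷ u) ls ((x , kx∈) ∷ occ) =
    let ls′ , π = ∈⇒↭ kx∈
        xs , rest , ρ = collect ks u ls′ (All.zipWith (λ { (k≢k′ , y , k′y∈) → y , remaining k≢k′ (∈-resp-↭ (↭-sym π) k′y∈) }) (k∉ks , occ))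
    in x ∷ xs , rest , ↭-trans (prep (k , x) ρ) π
    where
    remaining : ∀ {k′ y ls′} → k ≢ k′ → (k′ , y) ∈ (k , x) ∷ ls′ → (k′ , y) ∈ ls′
    remaining k≢k′ (here eq)  = contradiction (≡.sym (cong proj₁ eq)) k≢k′
    remaining k≢k′ (there ∈′) = ∈′

points-distinct : AllPairs _≢_ points
points-distinct = toWitness {a? = allPairs? (λ k l → ¬? (k ≟ᶠ l)) points} tt

points-nonzero : All (_≢ 𝟎) points
points-nonzero = toWitness {a? = All.all? (λ l → ¬? (l ≟ᶠ 𝟎)) points} tt

private
  weight-xor : ∀ a b c → ∃[ k ] weight a + weight b + weight c ≡ k + k → c ≡ a xor b
  weight-xor true  true  false _ = ≡.refl
  weight-xor true  false true  _ = ≡.refl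
  weight-xor false true  true  _ = ≡.refl
  weight-xor false false false _ = ≡.refl
  weight-xor true  true  true  (k , eq) = ⊥-elim (even≢odd′ k 1 (≡.sym eq))
  weight-xor true  false false (k , eq) = ⊥-elim (even≢odd′ k 2 (≡.sym eq))
  weight-xor false true  false (k , eq) = ⊥-elim (even≢odd′ k 2 (≡.sym eq))
  weight-xor false false true  (k , eq) = ⊥-elim (even≢odd′ k 2 (≡.sym eq))

linear-on-nonzero : (β : F 3 → Bool) → (∀ χ ψ → χ ≢ 𝟎 → ψ ≢ 𝟎 → χ ⊞ ψ ≢ 𝟎 → β (χ ⊞ ψ) ≡ β χ xor β ψ) →
  ∃[ m ] ∀ χ → χ ≢ 𝟎 → β χ ≡ dot m χ
linear-on-nonzero β additive = m , λ
  { (false ∷ false ∷ false ∷ []) ne → contradiction ≡.refl ne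
  ; (true  ∷ false ∷ false ∷ []) _ → β₁
  ; (false ∷ true  ∷ false ∷ []) _ → β₂
  ; (false ∷ false ∷ true  ∷ []) _ → β₃
  ; (true  ∷ true  ∷ false ∷ []) _ → β₁₂
  ; (true  ∷ false ∷ true  ∷ []) _ → step e₁ e₃ (λ ()) (λ ()) (λ ()) β₁ β₃
  ; (false ∷ true  ∷ true  ∷ []) _ → step e₂ e₃ (λ ()) (λ ()) (λ ()) β₂ β₃
  ; (true  ∷ true  ∷ true  ∷ []) _ → step (e₁ ⊞ e₂) e₃ (λ ()) (λ ()) (λ ()) β₁₂ β₃
  }
  where
  e₁ e₂ e₃ m : F 3
  e₁ = true ∷ false ∷ false ∷ []
  e₂ = false ∷ true ∷ false ∷ []
  e₃ = false ∷ false ∷ true ∷ []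
  m = β e₁ ∷ β e₂ ∷ β e₃ ∷ []
  coordinates : ∀ m → Vec.head m ≡ dot m e₁ × Vec.head (Vec.tail m) ≡ dot m e₂ × Vec.head (Vec.tail (Vec.tail m)) ≡ dot m e₃
  coordinates = toWitness {a? = ∀F? 3 λ m → (_ Boolₚ.≟ _) ×-dec ((_ Boolₚ.≟ _) ×-dec (_ Boolₚ.≟ _))} tt
  step : ∀ χ ψ → χ ≢ 𝟎 → ψ ≢ 𝟎 → χ ⊞ ψ ≢ 𝟎 → β χ ≡ dot m χ → β ψ ≡ dot m ψ → β (χ ⊞ ψ) ≡ dot m (χ ⊞ ψ)
  step χ ψ χ≢ ψ≢ χψ≢ eq eq′ = ≡.trans (additive χ ψ χ≢ ψ≢ χψ≢) (≡.trans (cong₂ _xor_ eq eq′) (≡.sym (dot-⊞ʳ m χ ψ)))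
  β₁ = coordinates m .proj₁
  β₂ = coordinates m .proj₂ .proj₁
  β₃ = coordinates m .proj₂ .proj₂
  β₁₂ = step e₁ e₂ (λ ()) (λ ()) (λ ()) β₁ β₂

module _ (K : Context r) where
  open Context K
  open Solver using (solve; _⊜_; id) renaming (_⊕_ to _⊙_)
  open ≈-Reasoning

  weighted : (F k → ℕ) → List (F k × Carrier) → Carrier
  weighted f []             = ε
  weighted f ((l , x) ∷ ls) = f l · x ∙ weighted f ls

  weighted-+ : (f g : F k → ℕ) (ls : List (F k × Carrier)) → weighted (λ l → f l + g l) ls ≈ weighted f ls ∙ weighted g ls
  weighted-+ f g [] = sym (identityˡ ε)
  weighted-+ f g ((l , x) ∷ ls) = begin
    (f l + g l) · x ∙ weighted (λ l → f l + g l) ls              ≈⟨ ∙-cong (·-homo-+ x (f l) (g l)) (weighted-+ f g ls) ⟩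
    (f l · x ∙ g l · x) ∙ (weighted f ls ∙ weighted g ls)        ≈⟨ solve 4 (λ a b c d → (a ⊙ b) ⊙ (c ⊙ d) ⊜ (a ⊙ c) ⊙ (b ⊙ d)) refl _ _ _ _ ⟩
    (f l · x ∙ weighted f ls) ∙ (g l · x ∙ weighted g ls)        ∎

  weighted-cong : (f g : F k → ℕ) → (∀ l → f l ≡ g l) → (ls : List (F k × Carrier)) → weighted f ls ≈ weighted g ls
  weighted-cong f g f≗g []             = refl
  weighted-cong f g f≗g ((l , x) ∷ ls) = ∙-cong (·-congˡ (f≗g l)) (weighted-cong f g f≗g ls)

  words : List (F k) → List (F k × Carrier) → Carrier
  words χs ls = σ (map (λ χ → σ (word χ ls)) χs)

  words-weighted : (χs : List (F k)) (ls : List (F k × Carrier)) → words χs ls ≈ weighted (count χs) ls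
  words-weighted [] ls = zeros ls
    where
    zeros : ∀ ls → ε ≈ weighted (λ _ → 0) ls
    zeros []             = refl
    zeros ((l , x) ∷ ls) = trans (zeros ls) (sym (identityˡ _))
  words-weighted (χ ∷ χs) ls = trans (∙-cong (single ls) (words-weighted χs ls)) (sym (weighted-+ (λ l → if dot χ l then 1 else 0) (count χs) ls))
    where
    single : ∀ ls → σ (word χ ls) ≈ weighted (λ l → if dot χ l then 1 else 0) ls
    single [] = refl
    single ((l , x) ∷ ls) with dot χ l
    ... | true  = ∙-cong (sym (identityʳ x)) (single ls)
    ... | false = trans (single ls) (sym (identityˡ _))

  word-⊞ : ∀ χ ψ (ls : List (F k × Carrier)) → ∃[ v ] σ (word χ ls) ∙ σ (word ψ ls) ≈ σ (word (χ ⊞ ψ) ls) ∙ (v ∙ v)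
  word-⊞ χ ψ [] = ε , trans (identityˡ ε) (sym (trans (identityˡ _) (identityˡ ε)))
  word-⊞ χ ψ ((l , x) ∷ ls) rewrite dot-⊞ˡ χ ψ l with word-⊞ χ ψ ls | dot χ l | dot ψ l
  ... | v , eq | false | false = v , eq
  ... | v , eq | true  | false = v , trans (assoc x _ _) (trans (∙-congˡ eq) (sym (assoc x _ _)))
  ... | v , eq | false | true  = v , (begin
    s ∙ (x ∙ t)      ≈⟨ solve 3 (λ s x t → s ⊙ (x ⊙ t) ⊜ x ⊙ (s ⊙ t)) refl s x t ⟩
    x ∙ (s ∙ t)      ≈⟨ ∙-congˡ eq ⟩
    x ∙ (u ∙ (v ∙ v))  ≈⟨ assoc x u _ ⟨
    (x ∙ u) ∙ (v ∙ v)  ∎)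
    where
    s t u : Carrier
    s = σ (word χ ls)
    t = σ (word ψ ls)
    u = σ (word (χ ⊞ ψ) ls)
  ... | v , eq | true  | true  = x ∙ v , (begin
    (x ∙ s) ∙ (x ∙ t)        ≈⟨ solve 3 (λ s x t → (x ⊙ s) ⊙ (x ⊙ t) ⊜ (x ⊙ x) ⊙ (s ⊙ t)) refl s x t ⟩
    (x ∙ x) ∙ (s ∙ t)        ≈⟨ ∙-congˡ eq ⟩
    (x ∙ x) ∙ (u ∙ (v ∙ v))  ≈⟨ solve 3 (λ u x v → (x ⊙ x) ⊙ (u ⊙ (v ⊙ v)) ⊜ u ⊙ ((x ⊙ v) ⊙ (x ⊙ v))) refl u x v ⟩
    u ∙ ((x ∙ v) ∙ (x ∙ v))  ∎)
    where
    s t u : Carrier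
    s = σ (word χ ls)
    t = σ (word ψ ls)
    u = σ (word (χ ⊞ ψ) ls)

  -- A sum of three word weights is even, as 2(common part) = wχ + wψ − w(χ ⊞ ψ).
  opaque
    parity : ∀ {χ ψ} {ls : List (F k × Carrier)} a b c → σ (word χ ls) ≈ a · e → σ (word ψ ls) ≈ b · e →
      σ (word (χ ⊞ ψ) ls) ≈ c · e → ∃[ n ] a + b + c ≡ n + n
    parity {χ = χ} {ψ} {ls} a b c χ≈ ψ≈ χψ≈ = let v , eq = word-⊞ χ ψ ls in e-even (u ∙ v) (a + b + c) (begin
      (u ∙ v) ∙ (u ∙ v)            ≈⟨ solve 2 (λ u v → (u ⊙ v) ⊙ (u ⊙ v) ⊜ (u ⊙ (v ⊙ v)) ⊙ u) refl u v ⟩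
      (u ∙ (v ∙ v)) ∙ u            ≈⟨ ∙-congʳ eq ⟨
      (s ∙ t) ∙ u                  ≈⟨ ∙-cong (∙-cong χ≈ ψ≈) χψ≈ ⟩
      (a · e ∙ b · e) ∙ c · e      ≈⟨ ∙-congʳ (·-homo-+ e a b) ⟨
      (a + b) · e ∙ c · e          ≈⟨ ·-homo-+ e (a + b) c ⟨
      (a + b + c) · e              ∎)
      where
      s t u : Carrier
      s = σ (word χ ls)
      t = σ (word ψ ls)
      u = σ (word (χ ⊞ ψ) ls)

  -- That is, x = ± 2e. It will hold for four times the sum of the terms with a given label.
  FourfoldUnit : Carrier → Set
  FourfoldUnit x = x ≈ 2 · e ⊎ x ∙ 2 · e ≈ ε

  module _ (ls : List (F 3 × Carrier)) (bounded : ∀ χ → χ ≢ 𝟎 → σ (word χ ls) ≈ 1 · e ⊎ σ (word χ ls) ≈ 2 · e) where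

    private
      β : F 3 → Bool
      β χ with χ ≟ᶠ 𝟎
      ... | yes _ = false
      ... | no χ≢𝟎 with bounded χ χ≢𝟎
      ...   | inj₁ _ = true
      ...   | inj₂ _ = false

      β-weight : ∀ χ → χ ≢ 𝟎 → σ (word χ ls) ≈ weight (β χ) · e
      β-weight χ χ≢𝟎 with χ ≟ᶠ 𝟎
      ... | yes χ≡𝟎 = contradiction χ≡𝟎 χ≢𝟎
      ... | no χ≢𝟎 with bounded χ χ≢𝟎
      ...   | inj₁ w = w
      ...   | inj₂ w = w

    opaque
      -- By `parity`, having weight 1 is additive in χ, hence given by a linear functional.
      type-exists : ∃[ m ] ∀ χ → χ ≢ 𝟎 → σ (word χ ls) ≈ weight (dot m χ) · e
      type-exists = let m , lin = linear-on-nonzero β additive in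
        m , λ χ χ≢𝟎 → trans (β-weight χ χ≢𝟎) (·-congˡ (cong weight (lin χ χ≢𝟎)))
        where
        additive : ∀ χ ψ → χ ≢ 𝟎 → ψ ≢ 𝟎 → χ ⊞ ψ ≢ 𝟎 → β (χ ⊞ ψ) ≡ β χ xor β ψ
        additive χ ψ χ≢ ψ≢ χψ≢ = weight-xor (β χ) (β ψ) (β (χ ⊞ ψ)) (parity {χ = χ} {ψ} {ls} (weight (β χ)) (weight (β ψ)) (weight (β (χ ⊞ ψ)))
          (β-weight χ χ≢) (β-weight ψ ψ≢) (β-weight (χ ⊞ ψ) χψ≢))

  module _ (ls : List (F 3 × Carrier)) (m : F 3) (typed : ∀ χ → χ ≢ 𝟎 → σ (word χ ls) ≈ weight (dot m χ) · e) where

    words-total : ∀ χs → All (_≢ 𝟎) χs → words χs ls ≈ total m χs · e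
    words-total []       []         = refl
    words-total (χ ∷ χs) (χ≢ ∷ χs≢) = trans (∙-cong (typed χ χ≢) (words-total χs χs≢)) (sym (·-homo-+ e (weight (dot m χ)) (total m χs)))

    opaque
      -- In the sum over the words through l minus the sum over the words off l, all other labels
      -- cancel by `count-on-off` and l survives four times. In terms of weights the same difference
      -- is ± 2e by `total-on-off`.
      fourfold : ∀ l → l ≢ 𝟎 → FourfoldUnit (weighted (λ l′ → 4 * indicator l l′) ls)
      fourfold l l≢𝟎 = case total-on-off m l l≢𝟎 of λ
        { (inj₁ eq) → inj₁ (∙-cancelˡ (total m (off l) · e) _ _ (begin
            total m (off l) · e ∙ A                      ≈⟨ relation ⟨
            total m (on l) · e                           ≡⟨ cong (_· e) eq ⟩
            (total m (off l) + 2) · e                    ≈⟨ ·-homo-+ e (total m (off l)) 2 ⟩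
            total m (off l) · e ∙ 2 · e                  ∎))
        ; (inj₂ eq) → inj₂ (∙-cancelˡ (total m (on l) · e) _ _ (begin
            total m (on l) · e ∙ (A ∙ 2 · e)             ≈⟨ solve 3 (λ a b c → a ⊙ (b ⊙ c) ⊜ (a ⊙ c) ⊙ b) refl _ A _ ⟩
            total m (on l) · e ∙ 2 · e ∙ A               ≈⟨ ∙-congʳ (·-homo-+ e (total m (on l)) 2) ⟨
            (total m (on l) + 2) · e ∙ A                 ≡⟨ cong (λ n → n · e ∙ A) eq ⟩
            total m (off l) · e ∙ A                      ≈⟨ relation ⟨
            total m (on l) · e                           ≈⟨ identityʳ _ ⟨
            total m (on l) · e ∙ ε                       ∎))
        }
        where
        A : Carrier
        A = weighted (λ l′ → 4 * indicator l l′) ls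
        relation : total m (on l) · e ≈ total m (off l) · e ∙ A
        relation = begin
          total m (on l) · e                                                 ≈⟨ words-total (on l) (on-nonzero l .proj₁) ⟨
          words (on l) ls                                                    ≈⟨ words-weighted (on l) ls ⟩
          weighted (count (on l)) ls                                         ≈⟨ weighted-cong _ _ (λ l′ → count-on-off l l′ l≢𝟎) ls ⟩
          weighted (λ l′ → count (off l) l′ + 4 * indicator l l′) ls         ≈⟨ weighted-+ _ _ ls ⟩
          weighted (count (off l)) ls ∙ A                                    ≈⟨ ∙-congʳ (words-weighted (off l) ls) ⟨
          words (off l) ls ∙ A                                               ≈⟨ ∙-congʳ (words-total (off l) (on-nonzero l .proj₂)) ⟩
          total m (off l) · e ∙ A                                            ∎

    unit≉ε : ∀ {A : Carrier} → FourfoldUnit A → A ≈ ε → 2 · e ≈ ε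
    unit≉ε (inj₁ A≈2e)  A≈ε = trans (sym A≈2e) A≈ε
    unit≉ε (inj₂ A2e≈ε) A≈ε = trans (sym (identityˡ _)) (trans (∙-congʳ (sym A≈ε)) A2e≈ε)

    2e≉ε : ¬ (2 · e ≈ ε)
    2e≉ε eq with () ← e-inj 2 0 (s≤s (s≤s (s≤s z≤n))) (s≤s z≤n) eq

    find-label : ∀ l (ls : List (F 3 × Carrier)) → (∃[ x ] (l , x) ∈ ls) ⊎ weighted (λ l′ → 4 * indicator l l′) ls ≈ ε
    find-label l [] = inj₂ refl
    find-label l ((l′ , x) ∷ ls) with l ≟ᶠ l′ | find-label l ls
    ... | yes ≡.refl | _                = inj₁ (x , here ≡.refl)
    ... | no _       | inj₁ (y , ly∈)   = inj₁ (y , there ly∈)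
    ... | no _       | inj₂ eq          = inj₂ (trans (identityˡ _) eq)

    -- Without a term labelled l the fourfold sum would be empty, and ε = ± 2e.
    label-occurs : ∀ l → l ≢ 𝟎 → ∃[ x ] (l , x) ∈ ls
    label-occurs l l≢𝟎 = case find-label l ls of λ
      { (inj₁ found) → found
      ; (inj₂ A≈ε)   → ⊥-elim (2e≉ε (unit≉ε (fourfold l l≢𝟎) A≈ε))
      }

    opaque
      seven-atoms : ∃₂ λ xs rest → zipWithKeys points xs ++ rest ↭ ls
      seven-atoms = collect points points-distinct ls (All.map (λ {l} → label-occurs l) points-nonzero)

-- Deficiency of weights, and lists with few terms

prefix : ∀ k (xs : List E) → k ≤ length xs → ∃₂ λ ys zs → ys ++ zs ≡ xs × length ys ≡ k
prefix zero    xs       _        = [] , xs , ≡.refl , ≡.refl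
prefix (suc k) (x ∷ xs) (s≤s k≤) = let ys , zs , eq , len = prefix k xs k≤ in x ∷ ys , zs , cong (x ∷_) eq , cong suc len

-- With N the length of the list, d is the deficiency: weights are at most N - d, written without
-- truncated subtraction.
Qb : ℕ → ℕ → ℕ → ℕ → Set
Qb d N l c = (1 ≤ l → 1 ≤ c) × c + d ≤ N

module _ (K : Context r) where
  open Context K
  open ≈-Reasoning

  opaque
    -- A block disjoint from `ys` can be joined with `ys`, so its weight stays c below the old
    -- bound. Removing a block whose weight is at least its length therefore costs no deficiency.
    remove : ∀ {d d′ N M X} ys zs c → ys ++ zs ↭ X → p (σ ys) ≡ 𝟎 → σ ys ≈ c · e → c < 71 → N + d′ ≤ M + d + c →
      Good K (Qb d N) X → Good K (Qb d′ M) zs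
    remove {d} {d′} {N} {M} {X} ys zs c π pys ys≈ c< N≤ good us vs ρ pus
      with good us (vs ++ ys) (↭-trans (↭-reflexive (≡.sym (++-assoc us vs ys))) (↭-trans (++-comm (us ++ vs) ys) (↭-trans (++⁺ˡ ys ρ) π))) pus
         | good (ys ++ us) vs (↭-trans (↭-reflexive (++-assoc ys us vs)) (↭-trans (++⁺ˡ ys ρ) π))
             (≡.trans (p-cong (σ-++ ys us)) (≡.trans (p-∙ _ _) (≡.trans (cong₂ _⊞_ pys pus) (⊞-self 𝟎))))
    ... | a , a< , us≈ , pos , _ | b , b< , ys-us≈ , _ , b+d≤N = a , a< , us≈ , pos , a+d′≤M
      where
      b≡c+a : b ≡ c + a
      b≡c+a = e-inj b (c + a) (<-≤-trans b< (m≤m+n 71 71)) (+-mono-< c< a<) (begin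
        b · e             ≈⟨ ys-us≈ ⟨
        σ (ys ++ us)      ≈⟨ σ-++ ys us ⟩
        σ ys ∙ σ us       ≈⟨ ∙-cong ys≈ us≈ ⟩
        c · e ∙ a · e     ≈⟨ ·-homo-+ e c a ⟨
        (c + a) · e       ∎)
      a+d′≤M : a + d′ ≤ M
      a+d′≤M = +-cancelʳ-≤ (d + c) _ _ (≤-trans (≤-reflexive arith)
        (≤-trans (+-monoˡ-≤ d′ b+d≤N) (≤-trans N≤ (≤-reflexive (+-assoc M d c)))))
        where
        arith : a + d′ + (d + c) ≡ b + d + d′
        arith = ≡.trans (arith₁ a d′ d c) (cong (λ x → x + d + d′) (≡.sym b≡c+a))
          where
          arith₁ : ∀ a d′ d c → a + d′ + (d + c) ≡ c + a + d + d′
          arith₁ = solve-∀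

  opaque
    -- By `no-2r+1`, a search through the blocks of 2r + 1 terms must meet one whose weight is at
    -- least its length, and `remove` applies to it.
    prune : ∀ {d N X} → r ≤ 4 → length X ≡ N → suc (r + r) ≤ N → Good K (Qb d N) X →
      ∃₂ λ ys zs → ys ++ zs ↭ X × 1 ≤ length ys × Good K (Qb d (length zs)) zs
    prune {d} {N} {X} r≤4 len 2r<N good with prefix (suc (r + r)) X (≤-trans 2r<N (≤-reflexive (≡.sym len)))
    ... | Y , Z , eq , lenY with search-↭ Y P R P-resp decide
      where
      P R : List Carrier → Set
      P ys = p (σ ys) ≡ 𝟎 → ∃[ c ] c < 71 × σ ys ≈ c · e × Qn (length ys) c
      R ys = p (σ ys) ≡ 𝟎 × ∃[ c ] c < 71 × σ ys ≈ c · e × 1 ≤ length ys × length ys ≤ c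
      P-resp : ∀ {ys ys′} → ys ↭ ys′ → P ys → P ys′
      P-resp π f pys = let c , c< , ys≈ , q = f (≡.trans (p-cong (σ-↭ π)) pys) in
        c , c< , trans (sym (σ-↭ π)) ys≈ , subst (λ l → Qn l c) (↭-length π) q
      decide : ∀ ys zs → ys ++ zs ↭ Y → P ys ⊎ R ys
      decide ys zs π with p (σ ys) ≟ᶠ 𝟎
      ... | no  pys≢𝟎 = inj₁ λ pys → contradiction pys pys≢𝟎
      ... | yes pys with good ys (zs ++ Z) (↭-trans (↭-reflexive (≡.sym (++-assoc ys zs Z))) (↭-trans (++⁺ʳ Z π) (↭-reflexive eq))) pys
      ...   | c , c< , ys≈ , pos , _ with c <? length ys | 1 ≤? length ys
      ...     | yes c<l | _       = inj₁ λ _ → c , c< , ys≈ , λ 1≤l → pos 1≤l , c<l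
      ...     | no  c≮l | yes 1≤l = inj₂ (pys , c , c< , ys≈ , 1≤l , ≮⇒≥ c≮l)
      ...     | no  c≮l | no 1≰l  = inj₁ λ _ → c , c< , ys≈ , λ 1≤l → contradiction 1≤l 1≰l
    ... | inj₁ all-small = ⊥-elim (no-2r+1 r r≤4 K Y lenY all-small)
    ... | inj₂ (ys , zs , π , pys , c , c< , ys≈ , 1≤l , l≤c) = ys , zs ++ Z , π′ , 1≤l ,
      remove {d} {d} {N} {length (zs ++ Z)} ys (zs ++ Z) c π′ pys ys≈ c< N≤ good
      where
      π′ : ys ++ zs ++ Z ↭ X
      π′ = ↭-trans (↭-reflexive (≡.sym (++-assoc ys zs Z))) (↭-trans (++⁺ʳ Z π) (↭-reflexive eq))
      N≤ : N + d ≤ length (zs ++ Z) + d + c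
      N≤ = ≤-trans (≤-reflexive (cong (_+ d) (≡.trans (≡.sym len) (≡.trans (≡.sym (↭-length π′)) (length-++ ys)))))
        (≤-trans (≤-reflexive (arith (length ys) _ d)) (+-monoʳ-≤ (length (zs ++ Z) + d) l≤c))
        where
        arith : ∀ a b d → a + b + d ≡ b + d + a
        arith = solve-∀

  opaque
    relation-blocks : ∀ Q {X} → length X ≡ k + r → Good K Q X → ∃ λ (ls : List (F k × Carrier)) → map proj₂ ls ↭ X ×
      (∀ χ → ∃[ c ] c < 71 × σ (word χ ls) ≈ c · e × Q (length (word χ ls)) c × (χ ≢ 𝟎 → 1 ≤ length (word χ ls)))
    relation-blocks {k} Q {X} len good = let ls , π , sums , nonempty = relations k p X len in
      ls , π , λ χ → let c , c< , w≈ , q = good (word χ ls) (coword χ ls) (↭-trans (word-coword χ ls) π) (≡.trans (p-σ (word χ ls)) (sums χ)) in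
        c , c< , w≈ , q , λ χ≢𝟎 → nonzero-length (word χ ls) (nonempty χ χ≢𝟎)
      where
      nonzero-length : (xs : List Carrier) → xs ≢ [] → 1 ≤ length xs
      nonzero-length []      ne = contradiction ≡.refl ne
      nonzero-length (_ ∷ _) _  = s≤s z≤n

  length-labelled : ∀ {X} (ls : List (F k × Carrier)) → map proj₂ ls ↭ X → length ls ≡ length X
  length-labelled ls π = ≡.trans (≡.sym (length-map proj₂ ls)) (↭-length π)

  Blocks : ∀ {k} → ℕ → ℕ → List (F k × Carrier) → Set
  Blocks d N ls = ∀ χ → ∃[ c ] c < 71 × σ (word χ ls) ≈ c · e × Qb d N (length (word χ ls)) c × (χ ≢ 𝟎 → 1 ≤ length (word χ ls))

  -- Already the empty block violates the bound.
  few₀ : ∀ {d N X} → N ≤ r → suc r ≤ d → Good K (Qb d N) X → ⊥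
  few₀ {d} {N} {X} N≤r r<d good = let c , _ , _ , _ , c+d≤ = good [] X ↭-refl p-ε in
    <-irrefl ≡.refl (≤-trans (≤-trans r<d (m≤n+m d c)) (≤-trans c+d≤ N≤r))

  word-weight : ∀ {k d n} → suc r ≤ d → (ls : List (F k × Carrier)) → Blocks d (suc n + r) ls → ∀ χ → χ ≢ 𝟎 →
    ∃[ c ] σ (word χ ls) ≈ c · e × 1 ≤ c × c ≤ n
  word-weight {k} {d} {n} r<d ls blocks χ χ≢𝟎 = let c , _ , w≈ , (pos , c+d≤) , nonempty = blocks χ in
    c , w≈ , pos (nonempty χ≢𝟎) , +-cancelʳ-≤ (suc r) c n (≤-trans (+-monoʳ-≤ c r<d) (≤-trans c+d≤ (≤-reflexive (≡.sym (+-suc n r)))))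

  few₁ : ∀ {d X} → suc r ≤ d → length X ≡ 1 + r → Good K (Qb d (1 + r)) X → ⊥
  few₁ {d} r<d len good =
    let ls , _ , blocks = relation-blocks {k = 1} (Qb d (1 + r)) len good
        c , _ , 1≤c , c≤0 = word-weight r<d ls blocks (true ∷ []) λ ()
    in <-irrefl ≡.refl (≤-trans 1≤c c≤0)

  few₂ : ∀ {d X} → suc r ≤ d → length X ≡ 2 + r → Good K (Qb d (2 + r)) X → ⊥
  few₂ {d} r<d len good =
    let ls , _ , blocks = relation-blocks {k = 2} (Qb d (2 + r)) len good in odd (parity-3 ls blocks)
    where
    module _ (ls : List (F 2 × Carrier)) (blocks : Blocks d (2 + r) ls) where
      unit : ∀ χ → χ ≢ 𝟎 → σ (word χ ls) ≈ 1 · e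
      unit χ χ≢𝟎 = let c , w≈ , 1≤c , c≤1 = word-weight r<d ls blocks χ χ≢𝟎 in trans w≈ (·-congˡ (≤-antisym c≤1 1≤c))
      parity-3 : ∃[ n ] 3 ≡ n + n
      parity-3 = parity K {χ = true ∷ false ∷ []} {false ∷ true ∷ []} {ls} 1 1 1 (unit _ λ ()) (unit _ λ ()) (unit _ λ ())
    odd : ¬ (∃[ n ] 3 ≡ n + n)
    odd (n , eq) = even≢odd′ n 1 (≡.sym eq)

  opaque
    -- With k + r terms and d > r, the words of k independent relations have weights from 1 to k -
    -- 1. For k = 1 no weight is left; for k = 2 all three weights are 1, and their sum is odd
    -- against `parity`.
    few : ∀ {d X} → suc r ≤ d → length X ≤ 2 + r → Good K (Qb d (length X)) X → ⊥
    few {d} {X} r<d len≤ good with <-cmp (length X) (1 + r)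
    ... | tri< len< _ _ = few₀ (s≤s⁻¹ len<) r<d good
    ... | tri≈ _ len≡ _ = few₁ r<d len≡ (subst (λ n → Good K (Qb d n) X) len≡ good)
    ... | tri> _ _ len> = few₂ r<d len≡ (subst (λ n → Good K (Qb d n) X) len≡ good)
      where
      len≡ : length X ≡ 2 + r
      len≡ = ≤-antisym len≤ len>

  opaque
    three : ∀ {d X} → suc r ≤ d → length X ≡ 3 + r → Good K (Qb d (3 + r)) X →
      ∃ λ (ls : List (F 3 × Carrier)) → map proj₂ ls ↭ X × (∀ χ → p (σ (word χ ls)) ≡ 𝟎) × ∃[ m ] (∀ χ → χ ≢ 𝟎 → σ (word χ ls) ≈ weight (dot m χ) · e)
    three {d} {X} r<d len good =
      let ls , π , blocks = relation-blocks {k = 3} (Qb d (3 + r)) len good in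
      ls , π , p-zero ls blocks , type-exists K ls (bounded ls blocks)
      where
      module _ (ls : List (F 3 × Carrier)) (blocks : Blocks d (3 + r) ls) where
        p-zero : ∀ χ → p (σ (word χ ls)) ≡ 𝟎
        p-zero χ = let c , _ , w≈ , _ = blocks χ in ≡.trans (p-cong w≈) (p-·e c)
        bounded : ∀ χ → χ ≢ 𝟎 → σ (word χ ls) ≈ 1 · e ⊎ σ (word χ ls) ≈ 2 · e
        bounded χ χ≢𝟎 = let c , w≈ , 1≤c , c≤2 = word-weight r<d ls blocks χ χ≢𝟎 in one-or-two c w≈ 1≤c c≤2
          where
          one-or-two : ∀ c → σ (word χ ls) ≈ c · e → 1 ≤ c → c ≤ 2 → σ (word χ ls) ≈ 1 · e ⊎ σ (word χ ls) ≈ 2 · e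
          one-or-two 1 w≈ _ _ = inj₁ w≈
          one-or-two 2 w≈ _ _ = inj₂ w≈
          one-or-two (suc (suc (suc _))) _ _ (s≤s (s≤s ()))

length-zip : ∀ {B E : Set} (ks : List B) (xs : Vec E (length ks)) → length (zipWithKeys ks xs) ≡ length ks
length-zip []       []       = ≡.refl
length-zip (k ∷ ks) (x ∷ xs) = cong suc (length-zip ks xs)

opaque
  -- The three relations among six terms would require all seven labels.
  six : (K : Context 3) → ∀ X → length X ≡ 6 → Good K (Qb 4 6) X → ⊥
  six K X len good = let ls , π , _ , m , typed = three K ≤-refl len good in absurd ls π m typed
    where
    open Context K
    absurd : ∀ (ls : List (F 3 × Carrier)) → map proj₂ ls ↭ X → ∀ (m : F 3) → (∀ (χ : F 3) → χ ≢ 𝟎 → σ (word χ ls) ≈ weight (dot m χ) · e) → ⊥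
    absurd ls π m typed with seven-atoms K ls m typed
    ... | xs , rest , ρ = <-irrefl ≡.refl (≤-trans (m≤m+n 7 (length rest)) (≤-reflexive (begin
      7 + length rest                                  ≡⟨ cong (_+ length rest) (length-zip points xs) ⟨
      length (zipWithKeys points xs) + length rest     ≡⟨ length-++ (zipWithKeys points xs) ⟨
      length (zipWithKeys points xs ++ rest)           ≡⟨ ↭-length ρ ⟩
      length ls                                        ≡⟨ length-labelled K ls π ⟩
      length X                                         ≡⟨ len ⟩
      6                                                ∎)))
      where open ≡.≡-Reasoning

opaque
  -- Seven or more terms can be pruned with deficiency 4 preserved, which ends in `few` or `six`.
  rank-three : ∀ n (K : Context 3) X → length X ≤ n → Good K (Qb 4 (length X)) X → ⊥
  rank-three n K X len≤ good with <-cmp (length X) 6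
  ... | tri< <6 _ _ = few K ≤-refl (s≤s⁻¹ <6) good
  ... | tri≈ _ ≡6 _ = six K X ≡6 (subst (λ n → Good K (Qb 4 n) X) ≡6 good)
  rank-three zero K X len≤ good | tri> _ _ >6 = contradiction (≤-trans >6 len≤) λ ()
  rank-three (suc n) K X len≤ good | tri> _ _ >6 =
    let ys , zs , π , 1≤ , good′ = prune K {4} {length X} {X} (n≤1+n 3) ≡.refl >6 good in
    rank-three n K zs (s≤s⁻¹ (≤-trans (+-monoˡ-≤ (length zs) 1≤)
      (≤-trans (≤-reflexive (≡.trans (≡.sym (length-++ ys)) (↭-length π))) len≤))) good′

-- Weights in rank four

AllPairs-↭ : ∀ {R : E → E → Set} xs → (∀ x y zs → x ∷ y ∷ zs ↭ xs → R x y) → AllPairs R xs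
AllPairs-↭ []       f = []
AllPairs-↭ (x ∷ xs) f = All-↭ xs (λ y ys π → f x y ys (prep x π))
  ∷ AllPairs-↭ xs λ y z zs π → f y z (x ∷ zs) (↭-trans (prep y (swap z x ↭-refl)) (↭-trans (swap y x ↭-refl) (prep x π)))

distinct-resp-↭ : ∀ {xs ys : List E} → xs ↭ ys → AllPairs _≢_ xs → AllPairs _≢_ ys
distinct-resp-↭ {E = E} π = PermSetoidₚ.Unique-resp-↭ (≡.setoid E) (↭⇒↭ₛ π)

module _ {E : Set} (h : E → F 3) where

  private
    label : E → F 3 × E
    label x = h x , x

    lift : ∀ {l} ys → l ∈ map h ys → ∃[ x ] (l , x) ∈ map label ys
    lift (y ∷ ys) (here ≡.refl) = y , here ≡.refl
    lift (y ∷ ys) (there l∈)    = let x , lx∈ = lift ys l∈ in x , there lx∈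

    vsum-label : ∀ xs → vsum proj₁ (map label xs) ≡ vsum h xs
    vsum-label []       = ≡.refl
    vsum-label (x ∷ xs) = cong (h x ⊞_) (vsum-label xs)

    all-points : (ys : Vec E 7) → vsum proj₁ (zipWithKeys points ys ++ []) ≡ 𝟎
    all-points (_ ∷ _ ∷ _ ∷ _ ∷ _ ∷ _ ∷ _ ∷ []) = ≡.refl

    fresh : ∀ {l : F 3} {us} → ¬ (l ∈ us) → All (l ≢_) us
    fresh {us = []}     l∉ = []
    fresh {us = u ∷ us} l∉ = (λ l≡u → l∉ (here l≡u)) ∷ fresh (l∉ ∘ there)

    occurs : ∀ us → length us ≡ 7 → All (_≢ 𝟎) us → AllPairs _≢_ us → ∀ l → l ≢ 𝟎 → l ∈ us
    occurs us len≡7 nonzero distinct l l≢𝟎 with DecMembership._∈?_ _≟ᶠ_ l us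
    ... | yes l∈ = l∈
    ... | no  l∉ with pigeonhole (λ u → u) (𝟎 ∷ l ∷ us) (s≤s (≤-reflexive (cong suc (≡.sym len≡7))))
    ...   | x , y , zs , π , x≡y with distinct-resp-↭ (↭-sym π)
              (((λ 𝟎≡l → l≢𝟎 (≡.sym 𝟎≡l)) ∷ All.map (λ ne eq → ne (≡.sym eq)) nonzero) ∷ fresh l∉ ∷ distinct)
    ...     | (x≢y ∷ _) ∷ _ = contradiction x≡y x≢y

    empty : (zs : List (F 3 × E)) → length zs ≡ 0 → zs ≡ []
    empty [] _ = ≡.refl

  -- Seven distinct nonzero vectors of F 3 are all of them, and these add up to 𝟎.
  opaque
    sum-of-seven : (xs : List E) → length xs ≡ 7 → All (λ x → h x ≢ 𝟎) xs →
      AllPairs (λ x y → h x ≢ h y) xs → vsum h xs ≡ 𝟎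
    sum-of-seven xs len≡7 nonzero distinct = conclude (collect points points-distinct (map label xs)
      (All.map (λ {l} l≢𝟎 → lift xs (occurs (map h xs) (≡.trans (length-map h xs) len≡7) (Allₚ.map⁺ nonzero) (AllPairsₚ.map⁺ distinct) l l≢𝟎)) points-nonzero))
      where
      open ≡.≡-Reasoning
      conclude : (∃₂ λ ys rest → zipWithKeys points ys ++ rest ↭ map label xs) → vsum h xs ≡ 𝟎
      conclude (ys , rest , π) = begin
        vsum h xs                                          ≡⟨ vsum-label xs ⟨
        vsum proj₁ (map label xs)                          ≡⟨ vsum-↭ proj₁ π ⟨
        vsum proj₁ (zipWithKeys points ys ++ rest)         ≡⟨ cong (λ zs → vsum proj₁ (zipWithKeys points ys ++ zs)) (empty rest length-rest) ⟩
        vsum proj₁ (zipWithKeys points ys ++ [])           ≡⟨ all-points ys ⟩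
        𝟎                                                  ∎
        where
        length-rest : length rest ≡ 0
        length-rest = +-cancelˡ-≡ 7 _ _ (begin
          7 + length rest                                  ≡⟨ cong (_+ length rest) (length-zip points ys) ⟨
          length (zipWithKeys points ys) + length rest     ≡⟨ length-++ (zipWithKeys points ys) ⟨
          length (zipWithKeys points ys ++ rest)           ≡⟨ ↭-length π ⟩
          length (map label xs)                            ≡⟨ length-map label xs ⟩
          length xs                                        ≡⟨ len≡7 ⟩
          7                                                ∎)

module _ (K : Context r) where
  open Context K
  open ≈-Reasoning

  p-single : ∀ {i} → p i ≡ 𝟎 → p (σ (i ∷ [])) ≡ 𝟎
  p-single {i} pi = ≡.trans (p-cong (identityʳ i)) pi

  p-pair : ∀ {i j} → p i ≡ p j → p (σ (i ∷ j ∷ [])) ≡ 𝟎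
  p-pair {i} {j} pi≡pj = ≡.trans (p-σ (i ∷ j ∷ [])) (≡.trans (cong₂ _⊞_ pi≡pj (⊞-identityʳ (p j))) (⊞-self (p j)))

  opaque
    merge-good : ∀ {d N} {x y : Carrier} {W} → Good K (Qb d N) (x ∷ y ∷ W) → Good K (Qb d N) (x ∙ y ∷ W)
    merge-good {d} {N} {x} {y} {W} good ys zs π pys with Anyₚ.++⁻ ys (∈-resp-↭ (↭-sym π) (here ≡.refl))
    ... | inj₁ ∈ys = let ys′ , ρ = ∈⇒↭ ∈ys
                         rest : ys′ ++ zs ↭ W
                         rest = drop-∷ (↭-trans (++⁺ʳ zs ρ) π)
                         σ≈ : σ ys ≈ σ (x ∷ y ∷ ys′)
                         σ≈ = trans (σ-↭ (↭-sym ρ)) (assoc x y (σ ys′))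
                         c , c< , ≈c , pos , c≤ = good (x ∷ y ∷ ys′) zs (prep x (prep y rest)) (≡.trans (p-cong (sym σ≈)) pys)
                     in c , c< , trans σ≈ ≈c , (λ _ → pos (s≤s z≤n)) , c≤
    ... | inj₂ ∈zs = let zs′ , ρ = ∈⇒↭ ∈zs
                         rest : ys ++ zs′ ↭ W
                         rest = drop-∷ (↭-trans (↭-sym (shift _ ys zs′)) (↭-trans (++⁺ˡ ys ρ) π))
                     in good ys (x ∷ y ∷ zs′) (↭-trans (shifts ys (x ∷ y ∷ [])) (prep x (prep y rest))) pys

  Good-Qb-mono : ∀ d N d′ N′ {X} → (∀ c → c + d ≤ N → c + d′ ≤ N′) → Good K (Qb d N) X → Good K (Qb d′ N′) X
  Good-Qb-mono d N d′ N′ f good ys zs π eq = let c , c< , σ≈ , pos , c≤ = good ys zs π eq in c , c< , σ≈ , pos , f c c≤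

module Rank4 (K : Context 4) where
  open Context K

  opaque
    -- The pair accounts for two terms but also for a weight of at least one, so dropping it leaves
    -- deficiency 4 in rank 3.
    parallel-weight : ∀ {N i j X} → N ≤ 2 + length X → p i ≢ 𝟎 → p j ≡ p i → i ∙ j ≈ e → Good K (Qb 5 N) (i ∷ j ∷ X) → ⊥
    parallel-weight {N} {i} {j} {X} N≤ pi pj≡pi ij≈e good
      with contract K {Q = Qb 5 N} {Q′ = Qb 4 (length X)} (λ q → q .proj₁ (s≤s z≤n)) Q-zero Q-one i j X pi pj≡pi ij≈e good
      where
      Q-zero : ∀ {l c} → Qb 5 N l c → Qb 5 N (2 + l) (suc c) → Qb 4 (length X) l c
      Q-zero {c = c} (pos , _) (_ , c≤) = pos , s≤s⁻¹ (s≤s⁻¹ (≤-trans (≤-trans (≤-reflexive (cong suc (≡.sym (+-suc c 4)))) c≤) N≤))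
      Q-one : ∀ {l c d j} → Qb 5 N (suc l) (c + suc j) → Qb 5 N (suc l) d → c ≡ d + j → Qb 4 (length X) l c
      Q-one {l} {c} {d} {j} (_ , c≤) (pos , _) c≡ = (λ _ → ≤-trans (pos (s≤s z≤n)) (≤-trans (m≤m+n d j) (≤-reflexive (≡.sym c≡)))) ,
        s≤s⁻¹ (s≤s⁻¹ (≤-trans (≤-trans (s≤s (s≤s (+-monoˡ-≤ 4 (m≤m+n c j)))) (≤-trans (≤-reflexive (arith c j)) c≤)) N≤))
        where
        arith : ∀ c j → suc (suc (c + j + 4)) ≡ c + suc j + 5
        arith = solve-∀
    ... | inj₁ (τ , τ² , pτ , good′) = rank-three _ (quotientContext K τ τ² pτ) X ≤-refl good′
    ... | inj₂ good′ = rank-three _ (hyperplaneContext K (p i)) X ≤-refl good′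

  hyperplane-absurd : ∀ {X} f l → dot l f ≡ true → All (λ x → dot l (p x) ≡ false) X → Good K (Qb 4 (length X)) X → ⊥
  hyperplane-absurd {X} f l lf lX good = rank-three _ (hyperplaneContext K f) X ≤-refl (hyperplane-good K (Qb 4 (length X)) f l lf lX good)

  module _ {d X} (5≤d : 5 ≤ d) (len : length X ≡ 8) (good : Good K (Qb d 8) X) (nonzero : ∀ i X′ → i ∷ X′ ↭ X → p i ≢ 𝟎) where

    private
      good₅ : Good K (Qb 5 8) X
      good₅ = Good-Qb-mono K d 8 5 8 (λ c c≤ → ≤-trans (+-monoʳ-≤ c 5≤d) c≤) good

      length-rest : ∀ ys zs {m} → ys ++ zs ↭ X → length ys + m ≡ 8 → length zs ≡ m
      length-rest ys zs {m} π eq = +-cancelˡ-≡ (length ys) _ _ (≡.trans (≡.sym (length-++ ys)) (≡.trans (↭-length π) (≡.trans len (≡.sym eq))))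

    opaque
      -- A pair of weight 1 is excluded by `parallel-weight`; removing a heavier one leaves six
      -- terms of the same deficiency, too few in rank 4.
      no-parallel : ∀ i j X′ → i ∷ j ∷ X′ ↭ X → p i ≢ p j
      no-parallel i j X′ π pi≡pj with good (i ∷ j ∷ []) X′ π (p-pair K pi≡pj)
      ... | c , c< , ij≈ , pos , c≤ with c ≟ 1
      ...   | yes ≡.refl = parallel-weight (≤-reflexive (cong (suc ∘ suc) (≡.sym len-X′))) (nonzero i _ π) (≡.sym pi≡pj)
                (trans (∙-congˡ (sym (identityʳ j))) (trans ij≈ (identityʳ e))) (Good-⊆ K (Qb 5 8) [] (↭-trans (↭-reflexive (++-identityʳ _)) π) good₅)
        where
        len-X′ : length X′ ≡ 6
        len-X′ = length-rest (i ∷ j ∷ []) X′ π ≡.refl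
      ...   | no c≢1 = few K 5≤d (≤-reflexive len-X′) (remove K {d′ = d} (i ∷ j ∷ []) X′ c π (p-pair K pi≡pj) ij≈ c< bound good)
        where
        len-X′ : length X′ ≡ 6
        len-X′ = length-rest (i ∷ j ∷ []) X′ π ≡.refl
        2≤c : 2 ≤ c
        2≤c = ≤∧≢⇒< (pos (s≤s z≤n)) (c≢1 ∘ ≡.sym)
        bound : 8 + d ≤ length X′ + d + c
        bound = ≤-trans (≤-reflexive (arith d)) (≤-trans (+-monoʳ-≤ (6 + d) 2≤c) (≤-reflexive (cong (λ n → n + d + c) (≡.sym len-X′))))
          where
          arith : ∀ d → 8 + d ≡ 6 + d + 2
          arith = solve-∀

    opaque
      -- Here the term i is itself the involution. Dividing by it costs one term, one rank and one
      -- unit of deficiency.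
      involution-absurd : ∀ i X′ → i ∷ X′ ↭ X → i ∙ i ≈ ε → ⊥
      involution-absurd i X′ π i²≈ε = rank-three _ (quotientContext K i i²≈ε (nonzero i X′ π)) X′ ≤-refl good′
        where
        len-X′ : length X′ ≡ 7
        len-X′ = length-rest (i ∷ []) X′ π ≡.refl
        shrink : ∀ {c} → c + 5 ≤ 8 → c + 4 ≤ length X′
        shrink {c} c≤ = s≤s⁻¹ (≤-trans (≤-reflexive (≡.sym (+-suc c 4))) (≤-trans c≤ (≤-reflexive (cong suc (≡.sym len-X′)))))
        open ≈-Reasoning
        good′ : Good (quotientContext K i i²≈ε (nonzero i X′ π)) (Qb 4 (length X′)) X′
        good′ ys zs ρ eq with quot-kernel (p i) _ (nonzero i X′ π) eq
        ... | inj₁ pys = let c , c< , ≈c , pos , c≤ = good₅ ys (i ∷ zs) (↭-trans (shift i ys zs) (↭-trans (prep i ρ) π)) pys in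
          c , c< , inj₁ ≈c , pos , shrink c≤
        ... | inj₂ pys = let c , c< , ≈c , pos , c≤ = good₅ (i ∷ ys) zs (↭-trans (prep i ρ) π) (≡.trans (p-∙ i _) (≡.trans (cong (p i ⊞_) pys) (⊞-self (p i)))) in
          c , c< , inj₂ (begin
            σ ys              ≈⟨ identityˡ _ ⟨
            ε ∙ σ ys          ≈⟨ ∙-congʳ i²≈ε ⟨
            (i ∙ i) ∙ σ ys    ≈⟨ assoc i i _ ⟩
            i ∙ (i ∙ σ ys)    ≈⟨ comm i _ ⟩
            (i ∙ σ ys) ∙ i    ≈⟨ ∙-congʳ ≈c ⟩
            c · e ∙ i         ∎) , (λ _ → pos (s≤s z≤n)) , shrink c≤

    opaque
      line-positive : ∀ i a b Z → i ∷ a ∷ b ∷ Z ↭ X → p a ⊞ p b ≡ p i → Positive K i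
      line-positive i a b Z π pab with sep p Z (p i)
      ... | inj₂ (l , li , lZ) = ⊥-elim (one-inside (dot l (p a)) (dot l (p b)) ≡.refl ≡.refl
              (≡.trans (≡.sym (dot-⊞ʳ l (p a) (p b))) (≡.trans (cong (dot l) pab) li)))
        where
        lenZ : length Z ≡ 5
        lenZ = length-rest (i ∷ a ∷ b ∷ []) Z π ≡.refl
        -- One of a and b lies off the kernel of `l`, as i does. Merging it with i puts seven terms
        -- into the kernel, and the unchanged bound 3 on the weights means deficiency 4.
        merged : ∀ a b → i ∷ b ∷ a ∷ Z ↭ X → dot l (p a) ≡ false → dot l (p b) ≡ true → ⊥
        merged a b ρ la lb = hyperplane-absurd (p i) l li (≡.trans (cong (dot l) (p-∙ i b)) (≡.trans (dot-⊞ʳ l _ _) (cong₂ _xor_ li lb)) ∷ la ∷ lZ)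
          (Good-Qb-mono K 5 8 4 (2 + length Z) shrink (merge-good K (Good-⊆ K (Qb 5 8) [] (↭-trans (↭-reflexive (++-identityʳ _)) ρ) good₅)))
          where
          shrink : ∀ c → c + 5 ≤ 8 → c + 4 ≤ suc (suc (length Z))
          shrink c c≤ = s≤s⁻¹ (≤-trans (≤-reflexive (≡.sym (+-suc c 4))) (≤-trans c≤ (≤-reflexive (cong (3 +_) (≡.sym lenZ)))))
        one-inside : ∀ u v → dot l (p a) ≡ u → dot l (p b) ≡ v → u xor v ≡ true → ⊥
        one-inside false true la lb _ = merged a b (↭-trans (prep i (swap b a ↭-refl)) π) la lb
        one-inside true false la lb _ = merged b a π lb la
        one-inside false false _ _ ()
        one-inside true true _ _ ()
      ... | inj₁ (ys , zs , ρ , pys)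
        with good₅ (i ∷ a ∷ b ∷ []) Z π (≡.trans (p-σ (i ∷ a ∷ b ∷ [])) (≡.trans (cong (p i ⊞_) (≡.trans (cong (p a ⊞_) (⊞-identityʳ _)) pab)) (⊞-self (p i))))
           | good₅ (i ∷ ys) (a ∷ b ∷ zs) (↭-trans (prep i (↭-trans (shifts ys (a ∷ b ∷ [])) (prep a (prep b ρ)))) π)
               (≡.trans (p-σ (i ∷ ys)) (≡.trans (cong (p i ⊞_) pys) (⊞-self (p i))))
           | good₅ (a ∷ b ∷ ys) (i ∷ zs) (↭-trans (shift i (a ∷ b ∷ ys) zs) (↭-trans (prep i (prep a (prep b ρ))) π))
               (≡.trans (p-σ (a ∷ b ∷ ys)) (≡.trans (≡.sym (⊞-assoc (p a) (p b) _)) (≡.trans (cong₂ _⊞_ pab pys) (⊞-self (p i)))))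
      ... | c , _ , σ≈ , pos , c≤ | d , _ , σ≈′ , pos′ , d≤ | g , _ , σ≈″ , _ , g≤
        with twice-sign K (c + d) g (twice K {a = c} {d} {g} (trans (∙-congˡ (∙-congˡ (sym (identityʳ b)))) σ≈) σ≈′ (trans (assoc a b _) σ≈″))
      ... | inj₁ (m , 1≤m , m≡ , i²≈) = m , 1≤m , half-≤ m+m≤8 , i²≈
        where
        m+m≤8 : m + m ≤ 8
        m+m≤8 = ≤-trans (m≤m+n (m + m) g) (≤-trans (≤-reflexive m≡) (≤-trans (+-mono-≤ (+-cancelʳ-≤ 5 c 3 c≤) (+-cancelʳ-≤ 5 d 3 d≤)) (m≤m+n 6 2)))
      ... | inj₂ (zero , m≡ , i²≈) = ⊥-elim (involution-absurd i _ π (trans (sym (identityʳ _)) i²≈))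
      -- g would be at least 2 + 1 + 1, while all weights are at most 3.
      ... | inj₂ (suc m , m≡ , i²≈) = ⊥-elim (<-irrefl ≡.refl (begin-strict
          3                                    <⟨ +-mono-≤ (+-mono-≤ (s≤s (z≤n {m})) (s≤s (z≤n {m}))) (+-mono-≤ (pos (s≤s z≤n)) (pos′ (s≤s z≤n))) ⟩
          suc m + suc m + (c + d)              ≡⟨ m≡ ⟩
          g                                    ≤⟨ +-cancelʳ-≤ 5 g 3 g≤ ⟩
          3                                    ∎))
        where open ≤-Reasoning

    opaque
      -- Each of the three doubles is at least 2e, so the line would be a block of weight at least
      -- 3. Its removal leaves five terms without loss of deficiency, too few.
      no-line : ∀ i a b Z → i ∷ a ∷ b ∷ Z ↭ X → p a ⊞ p b ≢ p i
      no-line i a b Z π pab =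
        let c , c< , σ≈ , _ = good (i ∷ a ∷ b ∷ []) Z π p-line
            m , 3≤m , m≤12 , σ²≈ = σ-Positive K (line-positive i a b Z π pab ∷ line-positive a b i Z π₂ pbi ∷ line-positive b i a Z π₃ pia ∷ [])
        in few K 5≤d (≤-trans (≤-reflexive lenZ) (n≤1+n 5)) (remove K {d′ = d} (i ∷ a ∷ b ∷ []) Z c π p-line σ≈ c<
             (bound (≤-trans 3≤m (≤-reflexive (≡.sym (c≡m c m c< m≤12 σ≈ σ²≈))))) good)
        where
        p-line : p (σ (i ∷ a ∷ b ∷ [])) ≡ 𝟎
        p-line = ≡.trans (p-σ (i ∷ a ∷ b ∷ [])) (≡.trans (cong (p i ⊞_) (≡.trans (cong (p a ⊞_) (⊞-identityʳ _)) pab)) (⊞-self (p i)))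
        π₂ : a ∷ b ∷ i ∷ Z ↭ X
        π₂ = ↭-trans (prep a (swap b i ↭-refl)) (↭-trans (swap a i ↭-refl) π)
        π₃ : b ∷ i ∷ a ∷ Z ↭ X
        π₃ = ↭-trans (swap b i ↭-refl) (↭-trans (prep i (swap b a ↭-refl)) π)
        pbi : p b ⊞ p i ≡ p a
        pbi = ≡.trans (cong (p b ⊞_) (≡.trans (≡.sym pab) (⊞-comm (p a) (p b)))) (⊞-cancelˡ (p b) (p a))
        pia : p i ⊞ p a ≡ p b
        pia = ≡.trans (⊞-comm (p i) (p a)) (≡.trans (cong (p a ⊞_) (≡.sym pab)) (⊞-cancelˡ (p a) (p b)))
        lenZ : length Z ≡ 5
        lenZ = length-rest (i ∷ a ∷ b ∷ []) Z π ≡.refl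
        c≡m : ∀ c m → c < 71 → m ≤ 12 → σ (i ∷ a ∷ b ∷ []) ≈ c · e → σ (i ∷ a ∷ b ∷ []) ∙ σ (i ∷ a ∷ b ∷ []) ≈ (m + m) · e → c ≡ m
        c≡m c m c< m≤12 σ≈ σ²≈ = double-injective c m (e-inj (c + c) (m + m) (+-mono-< c< c<) (s≤s (≤-trans (+-mono-≤ m≤12 m≤12) (m≤m+n 24 117)))
          (trans (sym (double-· K {c = c} σ≈)) σ²≈))
        bound : ∀ {c} → 3 ≤ c → 8 + d ≤ length Z + d + c
        bound {c} 3≤c = ≤-trans (≤-reflexive (arith d)) (≤-trans (+-monoʳ-≤ (5 + d) 3≤c) (≤-reflexive (cong (λ n → n + d + c) (≡.sym lenZ))))
          where
          arith : ∀ d → 8 + d ≡ 5 + d + 3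
          arith = solve-∀

    opaque
      -- In the absence of parallel pairs and lines, the other seven terms become the seven nonzero
      -- vectors modulo `p i`, which add up to 𝟎.
      sum-modulo : ∀ i X′ → i ∷ X′ ↭ X → p (σ X) ≡ 𝟎 ⊎ p (σ X) ≡ p i
      sum-modulo i X′ π = flip-sum (quot-kernel (p i) (p (σ X′)) pi≢𝟎 (≡.trans (cong (quot (p i)) (p-σ X′))
        (≡.trans (≡.sym (vsum-quot (p i) p X′)) (sum-of-seven (quot (p i) ∘ p) X′ (length-rest (i ∷ []) X′ π ≡.refl) (All-↭ X′ off-i) (AllPairs-↭ X′ off-line)))))
        where
        pi≢𝟎 : p i ≢ 𝟎
        pi≢𝟎 = nonzero i X′ π
        off-i : ∀ x xs → x ∷ xs ↭ X′ → quot (p i) (p x) ≢ 𝟎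
        off-i x xs ρ eq with quot-kernel (p i) (p x) pi≢𝟎 eq
        ... | inj₁ px≡𝟎  = nonzero x (i ∷ xs) (↭-trans (swap x i ↭-refl) (↭-trans (prep i ρ) π)) px≡𝟎
        ... | inj₂ px≡pi = no-parallel i x xs (↭-trans (prep i ρ) π) (≡.sym px≡pi)
        off-line : ∀ x y xs → x ∷ y ∷ xs ↭ X′ → quot (p i) (p x) ≢ quot (p i) (p y)
        off-line x y xs ρ eq with quot-kernel (p i) (p x ⊞ p y) pi≢𝟎 (≡.trans (quot-⊞ (p i) _ _) (≡.trans (cong (_⊞ _) eq) (⊞-self _)))
        ... | inj₁ eq′ = no-parallel x y (i ∷ xs) (↭-trans (prep x (swap y i ↭-refl)) (↭-trans (swap x i ↭-refl) (↭-trans (prep i ρ) π))) (⊞-zero⇒≡ _ _ eq′)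
        ... | inj₂ eq′ = no-line i x y xs (↭-trans (prep i ρ) π) eq′
        pσX : p (σ X) ≡ p i ⊞ p (σ X′)
        pσX = ≡.trans (p-cong (σ-↭ (↭-sym π))) (p-∙ i _)
        flip-sum : p (σ X′) ≡ 𝟎 ⊎ p (σ X′) ≡ p i → p (σ X) ≡ 𝟎 ⊎ p (σ X) ≡ p i
        flip-sum (inj₁ eq) = inj₂ (≡.trans pσX (≡.trans (cong (p i ⊞_) eq) (⊞-identityʳ _)))
        flip-sum (inj₂ eq) = inj₁ (≡.trans pσX (≡.trans (cong (p i ⊞_) eq) (⊞-self _)))

    opaque
      -- The p-value of the sum is 𝟎 modulo `p i` and modulo `p j`, and these two are different.
      total-block : ∀ i j X′ → i ∷ j ∷ X′ ↭ X → p (σ X) ≡ 𝟎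
      total-block i j X′ π = combine (sum-modulo i (j ∷ X′) π) (sum-modulo j (i ∷ X′) (↭-trans (swap j i ↭-refl) π))
        where
        combine : p (σ X) ≡ 𝟎 ⊎ p (σ X) ≡ p i → p (σ X) ≡ 𝟎 ⊎ p (σ X) ≡ p j → p (σ X) ≡ 𝟎
        combine (inj₁ eq) _          = eq
        combine (inj₂ _)  (inj₁ eq)  = eq
        combine (inj₂ eq) (inj₂ eq′) = contradiction (≡.trans (≡.sym eq) eq′) (no-parallel i j X′ π)

    -- The complement of a block is a block of positive weight, so dropping any element
    -- lowers the maximal weight.
    opaque
      drop-one : ∀ i j X′ → i ∷ j ∷ X′ ↭ X → Good K (Qb d 7) (j ∷ X′)
      drop-one i j X′ π ys zs ρ pys =
        let a , a< , ys≈ , pos , _  = good ys (i ∷ zs) (↭-trans (shift i ys zs) (↭-trans (prep i ρ) π)) pys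
            b , b< , zs≈ , pos′ , _ = good (i ∷ zs) ys prep-π p-rest
            c , c< , X≈ , _ , c≤    = good X [] (↭-reflexive (++-identityʳ X)) pX
        in a , a< , ys≈ , pos , s≤s⁻¹ (≤-trans (≤-trans (+-monoˡ-≤ (a + d) (pos′ (s≤s z≤n)))
             (≤-reflexive (≡.trans (≡.sym (+-assoc b a d)) (cong (_+ d) (≡.sym (additive a b c a< b< c< ys≈ zs≈ X≈)))))) c≤)
        where
        pX : p (σ X) ≡ 𝟎
        pX = total-block i j X′ π
        prep-π : (i ∷ zs) ++ ys ↭ X
        prep-π = ↭-trans (prep i (↭-trans (++-comm zs ys) ρ)) π
        p-rest : p (σ (i ∷ zs)) ≡ 𝟎
        p-rest = ≡.trans (≡.sym (⊞-identityʳ _)) (≡.trans (cong (p (σ (i ∷ zs)) ⊞_) (≡.sym pys))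
          (≡.trans (≡.sym (p-∙ _ _)) (≡.trans (p-cong (trans (sym (σ-++ (i ∷ zs) ys)) (σ-↭ prep-π))) pX)))
        open ≈-Reasoning
        additive : ∀ a b c → a < 71 → b < 71 → c < 71 → σ ys ≈ a · e → σ (i ∷ zs) ≈ b · e → σ X ≈ c · e → c ≡ b + a
        additive a b c a< b< c< ys≈ zs≈ X≈ = e-inj c (b + a) (<-≤-trans c< (m≤m+n 71 71)) (+-mono-< b< a<) (begin
          c · e                   ≈⟨ X≈ ⟨
          σ X                     ≈⟨ σ-↭ prep-π ⟨
          σ ((i ∷ zs) ++ ys)      ≈⟨ σ-++ (i ∷ zs) ys ⟩
          σ (i ∷ zs) ∙ σ ys       ≈⟨ ∙-cong zs≈ ys≈ ⟩
          b · e ∙ a · e           ≈⟨ ·-homo-+ e b a ⟨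
          (b + a) · e             ∎)

  opaque
    eight : ∀ {d X} → 5 ≤ d → length X ≡ 8 → Good K (Qb d 8) X →
      ∃₂ λ ys zs → ys ++ zs ↭ X × length ys ≡ 7 × Good K (Qb d (length ys)) ys
    eight {d} {X} 5≤d len good with find X
      where
      find : ∀ xs → All (λ x → p x ≢ 𝟎) xs ⊎ (∃₂ λ x xs′ → x ∷ xs′ ↭ xs × p x ≡ 𝟎)
      find [] = inj₁ []
      find (x ∷ xs) with p x ≟ᶠ 𝟎 | find xs
      ... | yes eq | _ = inj₂ (x , xs , ↭-refl , eq)
      ... | no  ne | inj₁ nes = inj₁ (ne ∷ nes)
      ... | no  _  | inj₂ (y , ys , π , eq) = inj₂ (y , x ∷ ys , ↭-trans (swap y x ↭-refl) (prep x π) , eq)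
    ... | inj₂ (x , xs , π , px) with good (x ∷ []) xs π (p-single K px)
    ...   | c , c< , ≈c , pos , _ = xs , x ∷ [] , ↭-trans (++-comm xs _) π , len-xs ,
              remove K {d′ = d} (x ∷ []) xs c π (p-single K px) ≈c c< bound good
      where
      len-xs : length xs ≡ 7
      len-xs = suc-injective (≡.trans (↭-length π) len)
      bound : 8 + d ≤ length xs + d + c
      bound = ≤-trans (≤-reflexive (+-comm 1 (7 + d))) (≤-trans (+-monoʳ-≤ (7 + d) (pos (s≤s z≤n))) (≤-reflexive (cong (λ n → n + d + c) (≡.sym len-xs))))
    eight {d} {i ∷ j ∷ X′} 5≤d len good | inj₁ nes = j ∷ X′ , i ∷ [] , ↭-trans (++-comm (j ∷ X′) _) ↭-refl , suc-injective len ,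
      subst (λ n → Good K (Qb d n) (j ∷ X′)) (≡.sym (suc-injective len)) (drop-one 5≤d len good (λ x xs π → nonzero (All-resp-↭ (↭-sym π) nes)) i j X′ ↭-refl)
      where
      nonzero : ∀ {x xs} → All (λ x → p x ≢ 𝟎) (x ∷ xs) → p x ≢ 𝟎
      nonzero (px ∷ _) = px
    eight {d} {_ ∷ []} 5≤d () good | inj₁ nes
    eight {d} {[]} 5≤d () good | inj₁ nes

  opaque
    -- Nine or more terms can be pruned, eight are reduced by `eight`, and six or fewer are excluded
    -- by `few`.
    seven-core : ∀ n {d X} → length X ≤ n → 5 ≤ d → Good K (Qb d (length X)) X →
      ∃₂ λ ys zs → ys ++ zs ↭ X × length ys ≡ 7 × Good K (Qb d (length ys)) ys
    seven-core n {d} {X} len≤ 5≤d good with length X ≤? 6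
    ... | yes ≤6 = ⊥-elim (few K 5≤d ≤6 good)
    ... | no ≰6 with <-cmp (length X) 8
    ...   | tri< <8 _ _ = X , [] , ↭-reflexive (++-identityʳ X) , ≤-antisym (s≤s⁻¹ <8) (≰⇒> ≰6) , good
    ...   | tri≈ _ ≡8 _ = eight 5≤d ≡8 (subst (λ n → Good K (Qb d n) X) ≡8 good)
    seven-core zero len≤ 5≤d good | no ≰6 | tri> _ _ >8 = contradiction (≤-trans >8 len≤) λ ()
    seven-core (suc n) {d} {X} len≤ 5≤d good | no ≰6 | tri> _ _ >8 with prune K ≤-refl ≡.refl >8 good
    ... | ws , X′ , π , 1≤ , good′ with seven-core n {d} {X′} (s≤s⁻¹ (≤-trans (+-monoˡ-≤ (length X′) 1≤)
        (≤-trans (≤-reflexive (≡.trans (≡.sym (length-++ ws)) (↭-length π))) len≤))) 5≤d good′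
    ...   | ys , zs , ρ , len-ys , good″ = ys , zs ++ ws , ↭-trans (↭-reflexive (≡.sym (++-assoc ys zs ws)))
              (↭-trans (++⁺ʳ ws ρ) (↭-trans (++-comm X′ ws) π)) , len-ys , good″

  opaque
    -- Dropping any term of a core with d = 6 leaves six terms of deficiency 5, against `few`.
    overweight : ∀ {X} → Good K (Qb 6 (length X)) X → ⊥
    overweight {X} good with seven-core (length X) {6} ≤-refl (n≤1+n 5) good
    ... | y ∷ ys , _ , _ , len , good′ = few K {5} {ys} ≤-refl (≤-reflexive (suc-injective len))
      (Good-Qb-mono K 6 (suc (length ys)) 5 (length ys) (λ c c≤ → s≤s⁻¹ (≤-trans (≤-reflexive (≡.sym (+-suc c 5))) c≤)) (Good-⊆ K (Qb 6 (suc (length ys))) (y ∷ []) (++-comm ys _) good′))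

-- Masks and the simplex code

sel : F n → Vec E n → List E
sel []      []       = []
sel (b ∷ B) (x ∷ xs) = if b then x ∷ sel B xs else sel B xs

cosel : F n → Vec E n → List E
cosel []      []       = []
cosel (b ∷ B) (x ∷ xs) = if b then cosel B xs else x ∷ cosel B xs

sel-cosel : (B : F n) (xs : Vec E n) → sel B xs ++ cosel B xs ↭ toList xs
sel-cosel []          []       = ↭-refl
sel-cosel (true ∷ B)  (x ∷ xs) = prep x (sel-cosel B xs)
sel-cosel (false ∷ B) (x ∷ xs) = ↭-trans (shift x (sel B xs) _) (prep x (sel-cosel B xs))

sel-⊆ : (xs : Vec E n) {ys : List E} → ys ⊆ toList xs → ∃[ B ] sel B xs ≡ ys
sel-⊆ [] [] = [] , ≡.refl
sel-⊆ (x ∷ xs) (.x ∷ʳ s) = let B , eq = sel-⊆ xs s in false ∷ B , eq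
sel-⊆ (x ∷ xs) (≡.refl ∷ s) = let B , eq = sel-⊆ xs s in true ∷ B , cong (x ∷_) eq

_⊓_ : F n → F n → F n
_⊓_ = Vec.zipWith _∧_

𝟏 : F n
𝟏 = Vec.replicate _ true

sel-𝟏 : (xs : Vec E n) → sel 𝟏 xs ≡ toList xs
sel-𝟏 []       = ≡.refl
sel-𝟏 (x ∷ xs) = cong (x ∷_) (sel-𝟏 xs)

mask : (l : F k) (ks : List (F k)) → F (length ks)
mask l []       = []
mask l (k ∷ ks) with l ≟ᶠ k
... | yes _ = true ∷ mask l ks
... | no  _ = false ∷ mask l ks

units : List (F 7)
units = map (λ l → mask l points) points

-- The codewords of the simplex code.
code : F 3 → F 7
code χ = Vec.map (dot χ) (fromList points)

∃F? : ∀ k {P : F k → Set} → (∀ v → Dec (P v)) → Dec (∃[ v ] P v)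
∃F? zero    P? = map′ (λ p → [] , p) (λ { ([] , p) → p }) (P? [])
∃F? (suc k) P? = map′ (λ { (inj₁ (v , p)) → true ∷ v , p ; (inj₂ (v , p)) → false ∷ v , p })
  (λ { (true ∷ v , p) → inj₁ (v , p) ; (false ∷ v , p) → inj₂ (v , p) })
  (∃F? k (P? ∘ (true ∷_)) ⊎-dec ∃F? k (P? ∘ (false ∷_)))

open DecMembership (_≟ᶠ_ {7}) using () renaming (_∈?_ to _∈?ᶠ_)

falses : F n → ℕ
falses []      = 0
falses (b ∷ B) = (if b then 0 else 1) + falses B

opaque
  -- A translate of any other class of masks meets some codeword in a single point.
  mask-trichotomy : ∀ O → (∃[ χ ] O ≡ code χ) ⊎ (∃[ χ ] O ≡ 𝟏 ⊞ code χ) ⊎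
    (∃[ χ ] ∃[ ψ ] ψ ≢ 𝟎 × ((O ⊞ code χ) ⊓ code ψ) ∈ units)
  mask-trichotomy = toWitness {a? = ∀F? 7 λ O → ∃F? 3 (λ χ → O ≟ᶠ code χ) ⊎-dec (∃F? 3 (λ χ → O ≟ᶠ (𝟏 ⊞ code χ)) ⊎-dec
    ∃F? 3 λ χ → ∃F? 3 λ ψ → ¬? (ψ ≟ᶠ 𝟎) ×-dec (((O ⊞ code χ) ⊓ code ψ) ∈?ᶠ units))} tt

  code-even : ∀ χ → dot 𝟏 (code χ) ≡ false
  code-even = toWitness {a? = ∀F? 3 λ χ → _ Boolₚ.≟ _} tt

  -- Complements of nonzero codewords are the lines of the Fano plane, and two lines meet in one
  -- point.
  two-lines : ((𝟏 ⊞ code (true ∷ false ∷ false ∷ [])) ⊓ (𝟏 ⊞ code (false ∷ true ∷ false ∷ []))) ∈ units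
  two-lines = toWitness {a? = _ ∈?ᶠ _} tt

  heavy-word : ∀ (m : F 3) → ∃ λ (χ : F 3) → χ ≢ 𝟎 × dot m χ ≡ false
  heavy-word = toWitness {a? = ∀F? 3 λ m → ∃F? 3 λ χ → ¬? (χ ≟ᶠ 𝟎) ×-dec (dot m χ Boolₚ.≟ false)} tt

  -- `b` is 𝟏 plus a single point; all codewords are even, and some codeword contains the point.
  code-separates : ∀ b → falses b ≡ 1 → ∃[ χ ] dot (code χ) b ≡ true
  code-separates = toWitness {a? = ∀F? 7 λ b → (_ ≟ _) →-dec ∃F? 3 λ χ → _ Boolₚ.≟ _} tt

word-code : ∀ χ (xs : Vec E 7) → word χ (zipWithKeys points xs) ≡ sel (code χ) xs
word-code χ (_ ∷ _ ∷ _ ∷ _ ∷ _ ∷ _ ∷ _ ∷ []) = ≡.refl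

values-zip : (ks : List E) {D : Set} (xs : Vec D (length ks)) → map proj₂ (zipWithKeys ks xs) ≡ toList xs
values-zip []       []       = ≡.refl
values-zip (k ∷ ks) (x ∷ xs) = cong (x ∷_) (values-zip ks xs)

module _ (K : Context r) where
  open Context K
  open Solver using (solve; _⊜_) renaming (_⊕_ to _⊙_)
  open ≈-Reasoning

  sel-⊞ : ∀ B C (xs : Vec Carrier n) → σ (sel B xs) ∙ σ (sel C xs) ≈
    σ (sel (B ⊞ C) xs) ∙ (σ (sel (B ⊓ C) xs) ∙ σ (sel (B ⊓ C) xs))
  sel-⊞ [] [] [] = sym (∙-congˡ (identityˡ ε))
  sel-⊞ (false ∷ B) (false ∷ C) (x ∷ xs) = sel-⊞ B C xs
  sel-⊞ (true ∷ B) (false ∷ C) (x ∷ xs) = trans (assoc x _ _) (trans (∙-congˡ (sel-⊞ B C xs)) (sym (assoc x _ _)))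
  sel-⊞ (false ∷ B) (true ∷ C) (x ∷ xs) = begin
    s ∙ (x ∙ t)        ≈⟨ solve 3 (λ s x t → s ⊙ (x ⊙ t) ⊜ x ⊙ (s ⊙ t)) refl s x t ⟩
    x ∙ (s ∙ t)        ≈⟨ ∙-congˡ (sel-⊞ B C xs) ⟩
    x ∙ (u ∙ (v ∙ v))  ≈⟨ assoc x u _ ⟨
    (x ∙ u) ∙ (v ∙ v)  ∎
    where
    s t u v : Carrier
    s = σ (sel B xs)
    t = σ (sel C xs)
    u = σ (sel (B ⊞ C) xs)
    v = σ (sel (B ⊓ C) xs)
  sel-⊞ (true ∷ B) (true ∷ C) (x ∷ xs) = begin
    (x ∙ s) ∙ (x ∙ t)          ≈⟨ solve 3 (λ s x t → (x ⊙ s) ⊙ (x ⊙ t) ⊜ (x ⊙ x) ⊙ (s ⊙ t)) refl s x t ⟩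
    (x ∙ x) ∙ (s ∙ t)          ≈⟨ ∙-congˡ (sel-⊞ B C xs) ⟩
    (x ∙ x) ∙ (u ∙ (v ∙ v))    ≈⟨ solve 3 (λ u x v → (x ⊙ x) ⊙ (u ⊙ (v ⊙ v)) ⊜ u ⊙ ((x ⊙ v) ⊙ (x ⊙ v))) refl u x v ⟩
    u ∙ ((x ∙ v) ∙ (x ∙ v))    ∎
    where
    s t u v : Carrier
    s = σ (sel B xs)
    t = σ (sel C xs)
    u = σ (sel (B ⊞ C) xs)
    v = σ (sel (B ⊓ C) xs)

  p-sel-⊞ : ∀ B C (xs : Vec Carrier n) → p (σ (sel (B ⊞ C) xs)) ≡ p (σ (sel B xs)) ⊞ p (σ (sel C xs))
  p-sel-⊞ B C xs = ≡.trans (≡.sym (⊞-identityʳ (p u))) (≡.trans (cong (p u ⊞_) (≡.sym (≡.trans (p-∙ v v) (⊞-self (p v)))))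
    (≡.trans (≡.sym (p-∙ u (v ∙ v))) (≡.trans (p-cong (sym (sel-⊞ B C xs))) (p-∙ _ _))))
    where
    u v : Carrier
    u = σ (sel (B ⊞ C) xs)
    v = σ (sel (B ⊓ C) xs)

  quadruple : Carrier → Carrier
  quadruple v = (v ∙ v) ∙ (v ∙ v)

  weighted-mask : (l : F k) (ks : List (F k)) (xs : Vec Carrier (length ks)) →
    weighted K (λ l′ → 4 * indicator l l′) (zipWithKeys ks xs) ≈ quadruple (σ (sel (mask l ks) xs))
  weighted-mask l []       []       = sym (trans (∙-cong (identityˡ ε) (identityˡ ε)) (identityˡ ε))
  weighted-mask l (k ∷ ks) (x ∷ xs) with l ≟ᶠ k
  ... | no _  = trans (identityˡ _) (weighted-mask l ks xs)
  ... | yes _ = trans (∙-congˡ (weighted-mask l ks xs)) (trans (∙-congʳ (∙-congˡ (∙-congˡ (∙-congˡ (identityʳ x)))))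
        (solve 2 (λ x s → (x ⊙ (x ⊙ (x ⊙ x))) ⊙ ((s ⊙ s) ⊙ (s ⊙ s)) ⊜ ((x ⊙ s) ⊙ (x ⊙ s)) ⊙ ((x ⊙ s) ⊙ (x ⊙ s))) refl x (σ (sel (mask l ks) xs))))

  record Simplex (xs : Vec Carrier 7) : Set where
    field
      good     : Good K (Qb 5 7) (toList xs)
      m        : F 3
      p-code   : ∀ χ → p (σ (sel (code χ) xs)) ≡ 𝟎
      weights  : ∀ χ → χ ≢ 𝟎 → σ (sel (code χ) xs) ≈ weight (dot m χ) · e
      fourfold-unit : ∀ B → B ∈ units → FourfoldUnit K (quadruple (σ (sel B xs)))

  opaque
    simplex : ∀ (xs : Vec Carrier 7) → Good K (Qb 5 7) (toList xs) → (∀ χ → p (σ (word χ (zipWithKeys points xs))) ≡ 𝟎) →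
      ∀ m → (∀ χ → χ ≢ 𝟎 → σ (word χ (zipWithKeys points xs)) ≈ weight (dot m χ) · e) → Simplex xs
    simplex xs good p-word m typed = record
      { good    = good
      ; m       = m
      ; p-code  = λ χ → subst (λ ys → p (σ ys) ≡ 𝟎) (word-code χ xs) (p-word χ)
      ; weights = λ χ χ≢𝟎 → subst (λ ys → σ ys ≈ weight (dot m χ) · e) (word-code χ xs) (typed χ χ≢𝟎)
      ; fourfold-unit = λ B B∈ → All.lookup all-units B∈
      }
      where
      resp : ∀ {x y} → x ≈ y → FourfoldUnit K x → FourfoldUnit K y
      resp eq (inj₁ x≈) = inj₁ (trans (sym eq) x≈)
      resp eq (inj₂ x≈) = inj₂ (trans (∙-congʳ (sym eq)) x≈)
      all-units : All (λ B → FourfoldUnit K (quadruple (σ (sel B xs)))) units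
      all-units = Allₚ.map⁺ {f = λ l → mask l points} (All.map (λ {l} l≢𝟎 → resp (weighted-mask l points xs) (fourfold K (zipWithKeys points xs) m typed l l≢𝟎)) points-nonzero)

-- The terms outside the seven

module Classify (K : Context 4) where
  open Context K
  open Rank4 K
  open Solver using (solve; _⊜_) renaming (_⊕_ to _⊙_)
  open ≈-Reasoning

  opaque
    simplex-core : ∀ {X} → Good K (Qb 5 (length X)) X → ∃₂ λ xs zs → toList xs ++ zs ↭ X × Simplex K xs
    simplex-core {X} good =
      let ys , zs , π , len , good₇ = seven-core (length X) {5} ≤-refl ≤-refl good
          good₇′ = subst (λ n → Good K (Qb 5 n) ys) len good₇
          ls , ρ , p-word , m , typed = three K ≤-refl len good₇′
          xs , rest , ρ′ = seven-atoms K ls m typed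
          xs↭ys , S = conclude ls ys xs rest m len good₇′ ρ p-word typed ρ′
      in xs , zs , ↭-trans (++⁺ʳ zs xs↭ys) π , S
      where
      empty : (zs : List (F 3 × Carrier)) → length zs ≡ 0 → zs ≡ []
      empty [] _ = ≡.refl
      conclude : ∀ (ls : List (F 3 × Carrier)) ys xs rest (m : F 3) → length ys ≡ 7 → Good K (Qb 5 7) ys → map proj₂ ls ↭ ys →
        (∀ χ → p (σ (word χ ls)) ≡ 𝟎) → (∀ χ → χ ≢ 𝟎 → σ (word χ ls) ≈ weight (dot m χ) · e) →
        zipWithKeys points xs ++ rest ↭ ls → toList xs ↭ ys × Simplex K xs
      conclude ls ys xs rest m len good ρ p-word typed ρ′ = xs↭ys , simplex K xs
        (Good-⊆ K (Qb 5 7) [] (↭-trans (↭-reflexive (++-identityʳ _)) xs↭ys) good)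
        (λ χ → ≡.trans (p-cong (σ-↭ (word-↭ χ zip↭ls))) (p-word χ)) m
        (λ χ χ≢𝟎 → trans (σ-↭ (word-↭ χ zip↭ls)) (typed χ χ≢𝟎))
        where
        length-rest : length rest ≡ 0
        length-rest = +-cancelˡ-≡ 7 _ _ (≡.trans (cong (_+ length rest) (≡.sym (length-zip points xs)))
          (≡.trans (≡.sym (length-++ (zipWithKeys points xs))) (≡.trans (↭-length ρ′) (≡.trans (length-labelled K ls ρ) len))))
        zip↭ls : zipWithKeys points xs ↭ ls
        zip↭ls = subst (_↭ ls) (≡.trans (cong (zipWithKeys points xs ++_) (empty rest length-rest)) (++-identityʳ _)) ρ′
        xs↭ys : toList xs ↭ ys
        xs↭ys = subst (_↭ ys) (values-zip points xs) (↭-trans (map⁺ proj₂ zip↭ls) ρ)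

  module _ (xs : Vec Carrier 7) (S : Simplex K xs) where
    open Simplex S

    -- Otherwise 2v would be an even multiple 2a·e, while 4v = ±2e.
    opaque
      single-meet-absurd : ∀ {s t} O P {a b c} → (O ⊓ P) ∈ units → s ∙ σ (sel O xs) ≈ a · e → t ∙ σ (sel P xs) ≈ b · e →
        s ∙ t ∙ σ (sel (O ⊞ P) xs) ≈ c · e → a + b ≤ 69 → c ≤ 69 → ⊥
      single-meet-absurd {s} {t} O P {a} {b} {c} O⊓P∈ sO≈ tP≈ st≈ a+b≤ c≤ = conclude (twice-sign K (a + b) c v²≈) (fourfold-unit _ O⊓P∈)
        where
        v : Carrier
        v = σ (sel (O ⊓ P) xs)
        v²≈ : v ∙ v ∙ c · e ≈ (a + b) · e
        v²≈ = begin
          v ∙ v ∙ c · e                                        ≈⟨ ∙-congˡ st≈ ⟨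
          v ∙ v ∙ (s ∙ t ∙ σ (sel (O ⊞ P) xs))                 ≈⟨ solve 4 (λ v s t u → (v ⊙ v) ⊙ ((s ⊙ t) ⊙ u) ⊜ (s ⊙ t) ⊙ (u ⊙ (v ⊙ v))) refl v s t _ ⟩
          s ∙ t ∙ (σ (sel (O ⊞ P) xs) ∙ (v ∙ v))               ≈⟨ ∙-congˡ (sel-⊞ K O P xs) ⟨
          s ∙ t ∙ (σ (sel O xs) ∙ σ (sel P xs))                ≈⟨ solve 4 (λ s t o q → (s ⊙ t) ⊙ (o ⊙ q) ⊜ (s ⊙ o) ⊙ (t ⊙ q)) refl s t _ _ ⟩
          (s ∙ σ (sel O xs)) ∙ (t ∙ σ (sel P xs))              ≈⟨ ∙-cong sO≈ tP≈ ⟩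
          a · e ∙ b · e                                        ≈⟨ ·-homo-+ e a b ⟨
          (a + b) · e                                          ∎
        four≢two : ∀ k → k + k + (k + k) ≢ 2
        four≢two k eq = even≢odd′ k 0 (double-injective (k + k) 1 eq)
        small : ∀ k → k + k ≤ 69 → k + k + (k + k) < 142
        small k k+k≤ = s≤s (≤-trans (+-mono-≤ k+k≤ k+k≤) (m≤m+n 138 3))
        small₂ : ∀ k → k + k ≤ 69 → k + k + (k + k) + 2 < 142
        small₂ k k+k≤ = s≤s (≤-trans (+-monoˡ-≤ 2 (+-mono-≤ k+k≤ k+k≤)) (m≤m+n 140 1))
        four+2≢0 : ∀ k → k + k + (k + k) + 2 ≢ 0
        four+2≢0 k eq with () ← m+n≡0⇒n≡0 (k + k + (k + k)) eq
        below₁ : ∀ k → k + k + c ≡ a + b → k + k ≤ 69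
        below₁ k k≡ = ≤-trans (m≤m+n (k + k) c) (≤-trans (≤-reflexive k≡) a+b≤)
        below₂ : ∀ k → k + k + (a + b) ≡ c → k + k ≤ 69
        below₂ k k≡ = ≤-trans (m≤m+n (k + k) (a + b)) (≤-trans (≤-reflexive k≡) c≤)
        quad₁ : ∀ k → v ∙ v ≈ (k + k) · e → (k + k + (k + k)) · e ≈ quadruple K v
        quad₁ k v²≈k = trans (·-homo-+ e (k + k) (k + k)) (sym (∙-cong v²≈k v²≈k))
        quad₂ : ∀ k → v ∙ v ∙ (k + k) · e ≈ ε → quadruple K v ∙ (k + k + (k + k)) · e ≈ ε
        quad₂ k v²k≈ = begin
          (v ∙ v) ∙ (v ∙ v) ∙ (k + k + (k + k)) · e                  ≈⟨ ∙-congˡ (·-homo-+ e (k + k) (k + k)) ⟩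
          (v ∙ v) ∙ (v ∙ v) ∙ ((k + k) · e ∙ (k + k) · e)            ≈⟨ solve 2 (λ w u → (w ⊙ w) ⊙ (u ⊙ u) ⊜ (w ⊙ u) ⊙ (w ⊙ u)) refl (v ∙ v) _ ⟩
          (v ∙ v ∙ (k + k) · e) ∙ (v ∙ v ∙ (k + k) · e)              ≈⟨ ∙-cong v²k≈ v²k≈ ⟩
          ε ∙ ε                                                      ≈⟨ identityˡ ε ⟩
          ε                                                          ∎
        2<142 : 2 < 142
        2<142 = s≤s (s≤s (s≤s z≤n))
        conclude : (∃[ k ] 1 ≤ k × k + k + c ≡ a + b × v ∙ v ≈ (k + k) · e) ⊎ (∃[ k ] k + k + (a + b) ≡ c × v ∙ v ∙ (k + k) · e ≈ ε) →
          FourfoldUnit K (quadruple K v) → ⊥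
        conclude (inj₁ (k , _ , k≡ , v²≈k)) (inj₁ q≈) =
          four≢two k (e-inj _ 2 (small k (below₁ k k≡)) 2<142 (trans (quad₁ k v²≈k) q≈))
        conclude (inj₁ (k , _ , k≡ , v²≈k)) (inj₂ q≈) =
          four+2≢0 k (e-inj _ 0 (small₂ k (below₁ k k≡)) (s≤s z≤n) (trans (·-homo-+ e (k + k + (k + k)) 2) (trans (∙-congʳ (quad₁ k v²≈k)) q≈)))
        conclude (inj₂ (k , k≡ , v²k≈)) (inj₁ q≈) =
          four+2≢0 k (e-inj _ 0 (small₂ k (below₂ k k≡)) (s≤s z≤n) (trans (·-homo-+ e (k + k + (k + k)) 2) (trans (comm _ _) (trans (∙-congʳ (sym q≈)) (quad₂ k v²k≈)))))
        conclude (inj₂ (k , k≡ , v²k≈)) (inj₂ q≈) =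
          four≢two k (e-inj _ 2 (small k (below₂ k k≡)) 2<142 (∙-cancelˡ (quadruple K v) _ _ (trans (quad₂ k v²k≈) (sym q≈))))

    p-sel-code : ∀ O χ → p (σ (sel (O ⊞ code χ) xs)) ≡ p (σ (sel O xs))
    p-sel-code O χ = ≡.trans (p-sel-⊞ K O (code χ) xs) (≡.trans (cong (p (σ (sel O xs)) ⊞_) (p-code χ)) (⊞-identityʳ _))

    weight≤2 : ∀ χ → weight (dot m χ) ≤ 2
    weight≤2 χ with dot m χ
    ... | true  = s≤s z≤n
    ... | false = ≤-refl

    centre : F 4
    centre = p (σ (toList xs))

    p-colines : ∀ χ → p (σ (sel (𝟏 ⊞ code χ) xs)) ≡ centre
    p-colines χ = ≡.trans (p-sel-code 𝟏 χ) (cong (p ∘ σ) (sel-𝟏 xs))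

    opaque
      -- Otherwise the seven terms would have rank 3 and deficiency at least 4.
      spanning : ∀ f → ∃[ O ] p (σ (sel O xs)) ≡ f
      spanning f = case sep p (toList xs) f of λ
        { (inj₁ (ys , zs , π , eq)) →
            let ys′ , s , ρ = ↭⇒⊆ ys zs π
                O , O≡ = sel-⊆ xs s
            in O , ≡.trans (cong (p ∘ σ) O≡) (≡.trans (p-cong (σ-↭ (↭-sym ρ))) (≡.trans (p-σ ys) eq))
        ; (inj₂ (l , lf , lxs)) → ⊥-elim (hyperplane-absurd f l lf lxs
            (subst (λ n → Good K (Qb 4 n) (toList xs)) (≡.sym (length-toList xs)) good₄))
        }
        where
        length-toList : ∀ {n} (ys : Vec Carrier n) → length (toList ys) ≡ n
        length-toList []       = ≡.refl
        length-toList (_ ∷ ys) = cong suc (length-toList ys)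
        good₄ : Good K (Qb 4 7) (toList xs)
        good₄ = Good-Qb-mono K 5 7 4 7 (λ c c≤ → ≤-trans (+-monoʳ-≤ c (n≤1+n 4)) c≤) good

    opaque
      sel-block : ∀ {X W} V O → V ++ toList xs ++ W ↭ X → ∃[ R ] (V ++ sel O xs) ++ R ↭ X
      sel-block {X} {W} V O π = cosel O xs ++ W , ↭-trans (↭-reflexive (≡.trans (++-assoc V (sel O xs) _) (cong (V ++_) (≡.sym (++-assoc (sel O xs) _ W)))))
        (↭-trans (++⁺ˡ V (++⁺ʳ W (sel-cosel O xs))) π)

    module _ {N X} (N≤72 : N ≤ 72) (goodX : Good K (Qb 5 N) X) where

      -- 67 = 72 - 5. Together with a codeword of weight at most 2 this gives the bound 69 of
      -- `single-meet-absurd`, where 2 · 69 + 2 stays below 142.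
      c≤67 : ∀ {c} → c + 5 ≤ N → c ≤ 67
      c≤67 {c} c≤ = +-cancelʳ-≤ 5 c 67 (≤-trans c≤ N≤72)

      opaque
        -- `z` forms a block with every mask of its own p-value. If such a mask is neither a
        -- codeword nor the complement of one, a translate of it by a codeword meets another
        -- codeword in a single point, and the resulting blocks contradict `single-meet-absurd`.
        class : ∀ z W → z ∷ toList xs ++ W ↭ X → p z ≡ 𝟎 ⊎ p z ≡ centre
        class z W π = let O , pO≡ = spanning (p z) in by-mask O pO≡ (mask-trichotomy O)
          where
          block : ∀ O B → p (σ (sel O xs)) ≡ p z → p (σ (sel B xs)) ≡ p (σ (sel O xs)) →
            ∃[ c ] c < 71 × z ∙ σ (sel B xs) ≈ c · e × Qb 5 N (length (z ∷ sel B xs)) c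
          block O B pO≡ pB = let R , ρ = sel-block (z ∷ []) B π in goodX (z ∷ sel B xs) R ρ
            (≡.trans (p-∙ z _) (≡.trans (cong (p z ⊞_) (≡.trans pB pO≡)) (⊞-self (p z))))
          by-mask : ∀ O → p (σ (sel O xs)) ≡ p z → (∃[ χ ] O ≡ code χ) ⊎ (∃[ χ ] O ≡ 𝟏 ⊞ code χ) ⊎
            (∃[ χ ] ∃[ ψ ] ψ ≢ 𝟎 × ((O ⊞ code χ) ⊓ code ψ) ∈ units) → p z ≡ 𝟎 ⊎ p z ≡ centre
          by-mask O pO≡ (inj₁ (χ , O≡)) = inj₁ (≡.trans (≡.sym pO≡) (≡.trans (cong (λ B → p (σ (sel B xs))) O≡) (p-code χ)))
          by-mask O pO≡ (inj₂ (inj₁ (χ , O≡))) = inj₂ (≡.trans (≡.sym pO≡) (≡.trans (cong (λ B → p (σ (sel B xs))) O≡) (p-colines χ)))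
          by-mask O pO≡ (inj₂ (inj₂ (χ , ψ , ψ≢𝟎 , ∈units))) =
            let c , _ , c≈ , _ , c≤ = block O (O ⊞ code χ) pO≡ (p-sel-code O χ)
                d , _ , d≈ , _ , d≤ = block O (O ⊞ code χ ⊞ code ψ) pO≡ (≡.trans (p-sel-code (O ⊞ code χ) ψ) (p-sel-code O χ))
            in ⊥-elim (single-meet-absurd {t = ε} (O ⊞ code χ) (code ψ) {c} {weight (dot m ψ)} {d} ∈units c≈
                 (trans (identityˡ _) (weights ψ ψ≢𝟎)) (trans (∙-congʳ (identityʳ z)) d≈)
                 (+-mono-≤ (c≤67 c≤) (weight≤2 ψ)) (≤-trans (c≤67 d≤) (m≤m+n 67 2)))

module _ (K : Context 4) where
  open Context K
  open Rank4 K
  open Classify K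
  open ≈-Reasoning

  -- Removing a single term of weight at least 2 would raise the deficiency to 6.
  unit-weight : ∀ {X} z X′ → Good K (Qb 5 (length X)) X → z ∷ X′ ↭ X → p z ≡ 𝟎 → z ≈ e
  unit-weight {X} z X′ good π pz with good (z ∷ []) X′ π (p-single K pz)
  ... | c , c< , z≈ , pos , _ with c ≟ 1
  ...   | yes ≡.refl = trans (sym (identityʳ z)) (trans z≈ (identityʳ e))
  ...   | no c≢1 = ⊥-elim (overweight (remove K {d′ = 6} (z ∷ []) X′ c π (p-single K pz) z≈ c< bound good))
    where
    bound : length X + 6 ≤ length X′ + 5 + c
    bound = ≤-trans (≤-reflexive (≡.trans (cong (_+ 6) (≡.sym (↭-length π))) (arith (length X′))))
      (+-monoʳ-≤ (length X′ + 5) (≤∧≢⇒< (pos (s≤s z≤n)) (c≢1 ∘ ≡.sym)))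
      where
      arith : ∀ n → suc n + 6 ≡ n + 5 + 2
      arith = solve-∀

  remove-parallel : ∀ {X} i j X′ → Good K (Qb 5 (length X)) X → i ∷ j ∷ X′ ↭ X → p i ≢ 𝟎 → p i ≡ p j →
    Good K (Qb 5 (length X′)) X′
  remove-parallel {X} i j X′ good π pi≢𝟎 pi≡pj with good (i ∷ j ∷ []) X′ π (p-pair K pi≡pj)
  ... | c , c< , ij≈ , pos , _ with c ≟ 1
  ...   | yes ≡.refl = ⊥-elim (parallel-weight (≤-reflexive (≡.sym (↭-length π))) pi≢𝟎 (≡.sym pi≡pj)
            (trans (∙-congˡ (sym (identityʳ j))) (trans ij≈ (identityʳ e))) (Good-⊆ K (Qb 5 (length X)) [] (↭-trans (↭-reflexive (++-identityʳ _)) π) good))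
  ...   | no c≢1 = remove K {d′ = 5} (i ∷ j ∷ []) X′ c π (p-pair K pi≡pj) ij≈ c< bound good
    where
    bound : length X + 5 ≤ length X′ + 5 + c
    bound = ≤-trans (≤-reflexive (≡.trans (cong (_+ 5) (≡.sym (↭-length π))) (arith (length X′))))
      (+-monoʳ-≤ (length X′ + 5) (≤∧≢⇒< (pos (s≤s z≤n)) (c≢1 ∘ ≡.sym)))
      where
      arith : ∀ n → suc (suc n) + 5 ≡ n + 5 + 2
      arith = solve-∀

  remove-unit : ∀ {X} z X′ → Good K (Qb 5 (length X)) X → z ∷ X′ ↭ X → p z ≡ 𝟎 → Good K (Qb 5 (length X′)) X′
  remove-unit {X} z X′ good π pz = remove K {d′ = 5} (z ∷ []) X′ 1 π (p-single K pz)
    (trans (identityʳ z) (trans (unit-weight z X′ good π pz) (sym (identityʳ e)))) (s≤s (s≤s z≤n))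
    (≤-reflexive (≡.trans (cong (_+ 5) (≡.sym (↭-length π))) (+-comm 1 (length X′ + 5)))) good

  module _ (xs : Vec Carrier 7) (S : Simplex K xs) where
    open Simplex S

    Central : Carrier → Set
    Central z = p z ≡ 𝟎 ⊎ p z ≡ centre xs S

    private
      χ₁ χ₂ : F 3
      χ₁ = true ∷ false ∷ false ∷ []
      χ₂ = false ∷ true ∷ false ∷ []
      O₁ O₂ : F 7
      O₁ = 𝟏 ⊞ code χ₁
      O₂ = 𝟏 ⊞ code χ₂

      p-O₁₂ : p (σ (sel (O₁ ⊞ O₂) xs)) ≡ 𝟎
      p-O₁₂ = ≡.trans (p-sel-⊞ K O₁ O₂ xs) (≡.trans (cong₂ _⊞_ (p-colines xs S χ₁) (p-colines xs S χ₂)) (⊞-self _))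

    opaque
      -- z completes one line to a block and z′ another, and the symmetric difference of the lines
      -- is a block with both; but the lines meet in one point. N is bounded so that the sum of two
      -- weights stays within 69.
      two-centres-short : ∀ {N X} z z′ W → N ≤ 10 → Good K (Qb 5 N) X → z ∷ z′ ∷ toList xs ++ W ↭ X →
        p z ≡ centre xs S → p z′ ≡ centre xs S → ⊥
      two-centres-short {N} {X} z z′ W N≤10 goodX π pz pz′ =
        let c , _ , c≈ , _ , c≤ = goodX (z ∷ sel O₁ xs) _ (sel-block xs S (z ∷ []) O₁ (↭-trans (prep z (shift z′ (toList xs) W)) π) .proj₂)
              (≡.trans (p-∙ z _) (≡.trans (cong₂ _⊞_ pz (p-colines xs S χ₁)) (⊞-self _)))
            d , _ , d≈ , _ , d≤ = goodX (z′ ∷ sel O₂ xs) _ (sel-block xs S (z′ ∷ []) O₂ (↭-trans (prep z′ (shift z (toList xs) W)) (↭-trans (swap z′ z ↭-refl) π)) .proj₂)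
              (≡.trans (p-∙ z′ _) (≡.trans (cong₂ _⊞_ pz′ (p-colines xs S χ₂)) (⊞-self _)))
            g , _ , g≈ , _ , g≤ = goodX (z ∷ z′ ∷ sel (O₁ ⊞ O₂) xs) _ (sel-block xs S (z ∷ z′ ∷ []) (O₁ ⊞ O₂) π .proj₂)
              (≡.trans (p-∙ z _) (≡.trans (cong (p z ⊞_) (≡.trans (p-∙ z′ _) (≡.trans (cong₂ _⊞_ pz′ p-O₁₂) (⊞-identityʳ _))))
                (≡.trans (cong (_⊞ centre xs S) pz) (⊞-self _))))
        in single-meet-absurd xs S {z} {z′} O₁ O₂ {c} {d} {g} two-lines c≈ d≈ (trans (assoc z z′ _) g≈)
             (≤-trans (+-mono-≤ (≤5 c≤) (≤5 d≤)) (m≤m+n 10 59)) (≤-trans (≤5 g≤) (m≤m+n 5 64))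
        where
        ≤5 : ∀ {c} → c + 5 ≤ N → c ≤ 5
        ≤5 {c} c≤ = +-cancelʳ-≤ 5 c 5 (≤-trans c≤ N≤10)

    length-two-centres : ∀ {X : List Carrier} {z z′ W} → z ∷ z′ ∷ toList xs ++ W ↭ X → length W ≤ 1 → length X ≤ 10
    length-two-centres {X} {z} {z′} {W} π W≤1 = ≤-trans (≤-reflexive (≡.trans (≡.sym (↭-length π))
      (cong (suc ∘ suc) (≡.trans (length-++ (toList xs)) (cong (_+ length W) (Vecₚ.length-toList xs)))))) (+-monoʳ-≤ 9 W≤1)

    -- In a long list the weights could be too large for `single-meet-absurd`. So W is first reduced
    -- to at most one term: units and parallel pairs can be removed without loss of deficiency.
    two-centres : ∀ n {X} z z′ W → length W ≤ n → Good K (Qb 5 (length X)) X → z ∷ z′ ∷ toList xs ++ W ↭ X → All Central W →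
      p z ≢ 𝟎 → p z ≡ centre xs S → p z′ ≡ centre xs S → ⊥
    two-centres n z z′ [] len≤ goodX π cW pz≢𝟎 pz pz′ =
      two-centres-short z z′ [] (length-two-centres π z≤n) goodX π pz pz′
    two-centres n z z′ (w ∷ []) len≤ goodX π cW pz≢𝟎 pz pz′ =
      two-centres-short z z′ (w ∷ []) (length-two-centres π ≤-refl) goodX π pz pz′
    two-centres (suc n) z z′ (w ∷ v ∷ W) len≤ goodX π (inj₁ pw ∷ cW) pz≢𝟎 pz pz′ =
      two-centres n {z ∷ z′ ∷ toList xs ++ v ∷ W} z z′ (v ∷ W) (s≤s⁻¹ len≤) (remove-unit w (z ∷ z′ ∷ toList xs ++ v ∷ W) goodX
        (↭-trans (↭-sym (shift w (z ∷ z′ ∷ toList xs) (v ∷ W))) π) pw) ↭-refl cW pz≢𝟎 pz pz′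
    two-centres (suc n) z z′ (w ∷ v ∷ W) len≤ goodX π (inj₂ pw ∷ inj₁ pv ∷ cW) pz≢𝟎 pz pz′ =
      two-centres n {z ∷ z′ ∷ toList xs ++ w ∷ W} z z′ (w ∷ W) (s≤s⁻¹ len≤) (remove-unit v (z ∷ z′ ∷ toList xs ++ w ∷ W) goodX
        (↭-trans (↭-sym (shift v (z ∷ z′ ∷ toList xs) (w ∷ W))) (↭-trans (++⁺ˡ (z ∷ z′ ∷ toList xs) (swap v w ↭-refl)) π)) pv) ↭-refl (inj₂ pw ∷ cW) pz≢𝟎 pz pz′
    two-centres (suc n) z z′ (w ∷ v ∷ W) len≤ goodX π (inj₂ pw ∷ inj₂ pv ∷ cW) pz≢𝟎 pz pz′ =
      two-centres n {z ∷ z′ ∷ toList xs ++ W} z z′ W (≤-trans (n≤1+n _) (s≤s⁻¹ len≤)) (remove-parallel w v (z ∷ z′ ∷ toList xs ++ W) goodX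
        (↭-trans (↭-sym (shifts (z ∷ z′ ∷ toList xs) (w ∷ v ∷ []))) π)
        (λ pw≡𝟎 → pz≢𝟎 (≡.trans pz (≡.trans (≡.sym pw) pw≡𝟎))) (≡.trans pw (≡.sym pv))) ↭-refl cW pz≢𝟎 pz pz′

    inner-block : ∀ B → p (σ (sel B xs)) ≡ 𝟎 → ∃[ c ] σ (sel B xs) ≈ c · e × c ≤ 2
    inner-block B pB = let c , _ , c≈ , _ , c≤ = good (sel B xs) (cosel B xs) (sel-cosel B xs) pB in
      c , c≈ , +-cancelʳ-≤ 5 c 2 c≤

    inner-meet-absurd : ∀ O P → p (σ (sel O xs)) ≡ 𝟎 → p (σ (sel P xs)) ≡ 𝟎 → (O ⊓ P) ∈ units → ⊥
    inner-meet-absurd O P pO pP ∈units =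
      let c , c≈ , c≤ = inner-block O pO
          d , d≈ , d≤ = inner-block P pP
          g , g≈ , g≤ = inner-block (O ⊞ P) (≡.trans (p-sel-⊞ K O P xs) (≡.trans (cong₂ _⊞_ pO pP) (⊞-self 𝟎)))
      in single-meet-absurd xs S {ε} {ε} O P {c} {d} {g} ∈units (trans (identityˡ _) c≈) (trans (identityˡ _) d≈)
           (trans (∙-congʳ (identityˡ ε)) (trans (identityˡ _) g≈)) (≤-trans (+-mono-≤ c≤ d≤) (m≤m+n 4 65)) (≤-trans g≤ (m≤m+n 2 67))

    -- Codewords are even. A complement of a codeword would turn all lines into blocks, two of which
    -- meet in one point. Any other mask has a translate, again a block, that meets a codeword in
    -- one point.
    odd-block-absurd : ∀ O → dot 𝟏 O ≡ true → p (σ (sel O xs)) ≡ 𝟎 → ⊥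
    odd-block-absurd O odd pO = by-mask (mask-trichotomy O)
      where
      by-mask : (∃[ χ ] O ≡ code χ) ⊎ (∃[ χ ] O ≡ 𝟏 ⊞ code χ) ⊎ (∃[ χ ] ∃[ ψ ] ψ ≢ 𝟎 × ((O ⊞ code χ) ⊓ code ψ) ∈ units) → ⊥
      by-mask (inj₁ (χ , O≡)) with () ← ≡.trans (≡.sym odd) (≡.trans (cong (dot 𝟏) O≡) (code-even χ))
      by-mask (inj₂ (inj₁ (χ , O≡))) = inner-meet-absurd O₁ O₂ (≡.trans (p-colines xs S χ₁) centre≡𝟎) (≡.trans (p-colines xs S χ₂) centre≡𝟎) two-lines
        where
        centre≡𝟎 : centre xs S ≡ 𝟎
        centre≡𝟎 = ≡.trans (≡.sym (p-colines xs S χ)) (≡.trans (cong (λ B → p (σ (sel B xs))) (≡.sym O≡)) pO)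
      by-mask (inj₂ (inj₂ (χ , ψ , _ , ∈units))) = inner-meet-absurd (O ⊞ code χ) (code ψ) (≡.trans (p-sel-code xs S O χ) pO) (p-code ψ) ∈units

    private
      -- The coordinate in front counts terms modulo 2. A functional that vanishes on the lifts but
      -- not at `true ∷ 𝟎` restricts to one that is 1 at every `p x`.
      lift-p : Carrier → F 5
      lift-p x = true ∷ p x

      vsum-lift : ∀ {n} (B : F n) (ys : Vec Carrier n) → vsum lift-p (sel B ys) ≡ dot 𝟏 B ∷ vsum p (sel B ys)
      vsum-lift [] [] = ≡.refl
      vsum-lift (true ∷ B) (y ∷ ys) = cong (lift-p y ⊞_) (vsum-lift B ys)
      vsum-lift (false ∷ B) (y ∷ ys) = vsum-lift B ys

    -- The seven elements lie off a hyperplane: otherwise an odd number of them would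
    -- form a block, although all relations between them have even length.
    opaque
      functional : ∃[ l ] All (λ x → dot l (p x) ≡ true) (toList xs)
      functional = case sep lift-p (toList xs) (true ∷ 𝟎) of λ
        { (inj₁ (ys , zs , π , eq)) →
            let ys′ , s , ρ = ↭⇒⊆ ys zs π
                O , O≡ = sel-⊆ xs s
                O-sum : dot 𝟏 O ∷ vsum p (sel O xs) ≡ true ∷ 𝟎
                O-sum = ≡.trans (≡.sym (vsum-lift O xs)) (≡.trans (cong (vsum lift-p) O≡) (≡.trans (vsum-↭ lift-p (↭-sym ρ)) eq))
            in ⊥-elim (odd-block-absurd O (Vecₚ.∷-injective O-sum .proj₁) (≡.trans (p-σ (sel O xs)) (Vecₚ.∷-injective O-sum .proj₂)))
        ; (inj₂ (a ∷ l , la , lxs)) → l , All.map (λ {x} → flip a (dot l (p x)) (≡.trans (cong ((a ∧ true) xor_) (≡.sym (dot-𝟎 l))) la)) lxs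
        }
        where
        flip : ∀ a b → (a ∧ true) xor false ≡ true → (a ∧ true) xor b ≡ false → b ≡ true
        flip true true _ _ = ≡.refl

    cosel≡sel : ∀ {n} (B : F n) (ys : Vec Carrier n) → cosel B ys ≡ sel (𝟏 ⊞ B) ys
    cosel≡sel []          []       = ≡.refl
    cosel≡sel (true ∷ B)  (y ∷ ys) = cosel≡sel B ys
    cosel≡sel (false ∷ B) (y ∷ ys) = cong (y ∷_) (cosel≡sel B ys)

    σ-complement : ∀ χ → σ (toList xs) ≈ σ (sel (code χ) xs) ∙ σ (sel (𝟏 ⊞ code χ) xs)
    σ-complement χ = trans (σ-↭ (↭-sym (sel-cosel (code χ) xs))) (trans (σ-++ (sel (code χ) xs) _)
      (∙-congˡ (reflexive (cong σ (cosel≡sel (code χ) xs)))))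

    -- The eight terms form a block of weight at most 8 - 5. It splits into a codeword of weight 2
    -- and a line with `z`, whose weight is at least 1.
    central-total : ∀ z → Good K (Qb 5 8) (z ∷ toList xs) → p z ≡ centre xs S → z ∙ σ (toList xs) ≈ 3 · e
    central-total z goodX pz =
      let χ , χ≢𝟎 , heavy = heavy-word m
          c , _ , c≈ , _ , c≤ = goodX (z ∷ toList xs) [] (↭-reflexive (++-identityʳ _)) (≡.trans (p-∙ z _) (≡.trans (cong (_⊞ centre xs S) pz) (⊞-self _)))
          d , d< , d≈ , pos , _ = goodX (z ∷ sel (𝟏 ⊞ code χ) xs) (sel (code χ) xs)
            (prep z (↭-trans (++-comm (sel (𝟏 ⊞ code χ) xs) _) (↭-trans (↭-reflexive (cong (sel (code χ) xs ++_) (≡.sym (cosel≡sel (code χ) xs)))) (sel-cosel (code χ) xs))))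
            (≡.trans (p-∙ z _) (≡.trans (cong₂ _⊞_ pz (p-colines xs S χ)) (⊞-self _)))
      in trans c≈ (·-congˡ (≤-antisym (+-cancelʳ-≤ 5 c 3 c≤)
           (≤-trans (+-monoʳ-≤ 2 (pos (s≤s z≤n))) (≤-reflexive (≡.sym (split c d χ (s≤s (≤-trans (+-cancelʳ-≤ 5 c 3 c≤) (m≤m+n 3 138))) d< c≈ d≈
             (trans (weights χ χ≢𝟎) (·-congˡ (cong weight heavy)))))))))
      where
      split : ∀ c d χ → c < 142 → d < 71 → z ∙ σ (toList xs) ≈ c · e → z ∙ σ (sel (𝟏 ⊞ code χ) xs) ≈ d · e → σ (sel (code χ) xs) ≈ 2 · e → c ≡ 2 + d
      split c d χ c< d< c≈ d≈ w≈ = e-inj c (2 + d) c< (s≤s (s≤s (≤-trans d< (m≤m+n 71 69)))) (begin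
        c · e                                              ≈⟨ c≈ ⟨
        z ∙ σ (toList xs)                                  ≈⟨ ∙-congˡ (trans (σ-complement χ) (comm _ _)) ⟩
        z ∙ (σ (sel (𝟏 ⊞ code χ) xs) ∙ σ (sel (code χ) xs))  ≈⟨ assoc _ _ _ ⟨
        z ∙ σ (sel (𝟏 ⊞ code χ) xs) ∙ σ (sel (code χ) xs)  ≈⟨ ∙-cong d≈ w≈ ⟩
        d · e ∙ 2 · e                                      ≈⟨ comm _ _ ⟩
        2 · e ∙ d · e                                      ≈⟨ ·-homo-+ e 2 d ⟨
        (2 + d) · e                                        ∎)

  record Shape (U : List Carrier) : Set where
    field
      xs         : Vec Carrier 7
      zs es      : List Carrier
      perm       : toList xs ++ zs ++ es ↭ U
      es≈e       : All (_≈ e) es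
      p-code     : ∀ χ → p (σ (sel (code χ) xs)) ≡ 𝟎
      separating : ∃[ l ] All (λ x → dot l (p x) ≡ true) (toList xs)
      extra      : zs ≡ [] ⊎ (∃[ z ] zs ≡ z ∷ [] × p z ≢ 𝟎 × z ∙ σ (toList xs) ≈ 3 · e)

  remove-units : ∀ es {X Y} → Good K (Qb 5 (length X)) X → es ++ Y ↭ X → All (λ z → p z ≡ 𝟎) es → Good K (Qb 5 (length Y)) Y
  remove-units [] {X} {Y} good π [] = subst (λ n → Good K (Qb 5 n) Y) (≡.sym (↭-length π)) (Good-⊆ K (Qb 5 (length X)) [] (↭-trans (↭-reflexive (++-identityʳ Y)) π) good)
  remove-units (z ∷ es) good π (pz ∷ pes) = remove-units es (remove-unit z (es ++ _) good π pz) ↭-refl pes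

  -- R is tested pair by pair: x and a partner of equal p-value are moved to X, which stays good. If
  -- their p-value is not 𝟎, both are central, against `two-centres`; so x has weight 1.
  shape : ∀ X R → Good K (Qb 5 (length X)) X → length X ≤ 70 →
    (∀ x R′ → x ∷ R′ ↭ R → x ≈ e ⊎ (∃[ x′ ] p x′ ≡ p x × Good K (Qb 5 (2 + length X)) (x ∷ x′ ∷ X))) → Shape (X ++ R)
  shape X R good len≤ pairs = let xs , W , π , S = simplex-core good in build xs W π S
    where
    build : ∀ xs W → toList xs ++ W ↭ X → Simplex K xs → Shape (X ++ R)
    build xs W π S = let es , zs , ρ , unit-es , central-zs = All-⊎ (All-↭ W split) in assemble es zs ρ unit-es central-zs
      where
      pc : F 4
      pc = centre xs S
      central : ∀ w W′ → w ∷ W′ ↭ W → Central xs S w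
      central w W′ ρ = class xs S (≤-trans len≤ (m≤m+n 70 2)) good w W′ (↭-trans (↭-sym (shift w (toList xs) W′)) (↭-trans (++⁺ˡ (toList xs) ρ) π))
      split : ∀ w W′ → w ∷ W′ ↭ W → p w ≡ 𝟎 ⊎ (p w ≢ 𝟎 × p w ≡ pc)
      split w W′ ρ with p w ≟ᶠ 𝟎 | central w W′ ρ
      ... | yes pw | _       = inj₁ pw
      ... | no pw  | inj₁ eq = contradiction eq pw
      ... | no pw  | inj₂ eq = inj₂ (pw , eq)
      R≈e : All (_≈ e) R
      R≈e = All-↭ R λ x R′ ρ → case pairs x R′ ρ of λ
        { (inj₁ x≈e) → x≈e
        ; (inj₂ (x′ , px′ , good′)) → by-class x x′ px′ good′ (p x ≟ᶠ 𝟎)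
            (class xs S (s≤s (s≤s len≤)) good′ x (x′ ∷ W) (prep x (↭-trans (shift x′ (toList xs) W) (prep x′ π))))
        }
        where
        by-class : ∀ x x′ → p x′ ≡ p x → Good K (Qb 5 (2 + length X)) (x ∷ x′ ∷ X) → Dec (p x ≡ 𝟎) → Central xs S x → x ≈ e
        by-class x x′ px′ good′ (yes px) _ = unit-weight x (x′ ∷ X) good′ ↭-refl px
        by-class x x′ px′ good′ (no px) (inj₁ px≡) = contradiction px≡ px
        by-class x x′ px′ good′ (no px) (inj₂ px≡) = ⊥-elim (two-centres xs S _ x x′ W ≤-refl good′ (prep x (prep x′ π)) (All-↭ W central) px px≡ (≡.trans px′ px≡))
      assemble : ∀ es zs → es ++ zs ↭ W → All (λ w → p w ≡ 𝟎) es → All (λ w → p w ≢ 𝟎 × p w ≡ pc) zs → Shape (X ++ R)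
      assemble es zs ρ unit-es central-zs = record
        { xs = xs ; zs = zs ; es = es ++ R
        ; perm = ↭-trans (↭-reflexive (≡.trans (cong (toList xs ++_) (≡.sym (++-assoc zs es R))) (≡.sym (++-assoc (toList xs) (zs ++ es) R)))) (++⁺ʳ R perm₀)
        ; es≈e = Allₚ.++⁺ (All-↭ es λ z es′ ρ′ → unit-weight z (es′ ++ zs ++ toList xs) good
            (↭-trans (++⁺ʳ (zs ++ toList xs) ρ′) (↭-trans (↭-reflexive (≡.sym (++-assoc es zs _))) (↭-trans (++⁺ʳ (toList xs) ρ) (↭-trans (++-comm W _) π))))
            (All.head (All-resp-↭ (↭-sym ρ′) unit-es))) R≈e
        ; p-code = Simplex.p-code S
        ; separating = functional xs S
        ; extra = extra zs perm₀ central-zs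
        }
        where
        perm₀ : toList xs ++ zs ++ es ↭ X
        perm₀ = ↭-trans (++⁺ˡ (toList xs) (↭-trans (++-comm zs es) ρ)) π
        extra : ∀ zs → toList xs ++ zs ++ es ↭ X → All (λ w → p w ≢ 𝟎 × p w ≡ pc) zs →
          zs ≡ [] ⊎ (∃[ z ] zs ≡ z ∷ [] × p z ≢ 𝟎 × z ∙ σ (toList xs) ≈ 3 · e)
        extra [] π′ [] = inj₁ ≡.refl
        extra (z ∷ []) π′ ((pz≢𝟎 , pz) ∷ []) = inj₂ (z , ≡.refl , pz≢𝟎 , central-total xs S z
          (subst (λ n → Good K (Qb 5 n) (z ∷ toList xs)) (cong suc (Vecₚ.length-toList xs))
            (remove-units es good (↭-trans (++-comm es (z ∷ toList xs)) (↭-trans (↭-sym (shift z (toList xs) es)) π′)) unit-es)) pz)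
        extra (z ∷ z′ ∷ zs) π′ ((pz≢𝟎 , pz) ∷ (_ , pz′) ∷ cs) = ⊥-elim (two-centres xs S _ z z′ (zs ++ es) ≤-refl good
          (↭-trans (↭-sym (shifts (toList xs) (z ∷ z′ ∷ []))) π′) (Allₚ.++⁺ (All.map (λ (_ , eq) → inj₂ eq) cs) (All.map inj₁ unit-es)) pz≢𝟎 pz pz′)

-- Scherk's theorem

-- β is reduction modulo 2A, whose kernel 2A has at most n elements.
record Ambient (n : ℕ) : Set₁ where
  field
    abelianGroup : AbelianGroup 0ℓ 0ℓ
  open AbelianGroup abelianGroup public
  open Sum abelianGroup public
  field
    ≈⇒≡            : ∀ {x y} → x ≈ y → x ≡ y
    _≟ᴬ_           : DecidableEquality Carrier
    β              : Carrier → F 5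
    β-∙            : ∀ x y → β (x ∙ y) ≡ β x ⊞ β y
    kernel-size    : ∀ xs → AllPairs _≢_ xs → All (λ x → β x ≡ 𝟎) xs → length xs ≤ n
    kernel-torsion : ∀ x → β x ≡ 𝟎 → n · x ≈ ε

  open AbelianGroupProperties abelianGroup public using (⁻¹-∙-comm; ∙-cancelˡ; ∙-cancelʳ)
  module Solver = CommutativeMonoidSolver commutativeMonoid
  module ≈-Reasoning = Relation.Binary.Reasoning.Setoid setoid
  open DecMembership _≟ᴬ_ public using (_∈?_)

  ZeroSumFree′ : List Carrier → Set
  ZeroSumFree′ T = ∀ y ys zs → y ∷ ys ++ zs ↭ T → ¬ (σ (y ∷ ys) ≈ ε)

  SubSum : List Carrier → Carrier → Set
  SubSum T c = ∃₂ λ ys zs → ys ++ zs ↭ T × c ≡ σ ys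

  β-ε : β ε ≡ 𝟎
  β-ε = ≡.trans (≡.sym (⊞-cancelˡ (β ε) (β ε))) (≡.trans (cong (β ε ⊞_) (≡.trans (≡.sym (β-∙ ε ε)) (cong β (≈⇒≡ (identityˡ ε))))) (⊞-self (β ε)))

module _ {n : ℕ} (𝔾 : Ambient n) where
  open Ambient 𝔾
  open Solver using (solve; _⊜_) renaming (_⊕_ to _⊙_)

  private
    Kernel : Carrier → Set
    Kernel x = β x ≡ 𝟎

    Zero-unique : List Carrier → List Carrier → Set
    Zero-unique A B = ∀ {a b} → a ∈ A → b ∈ B → a ∙ b ≡ ε → b ≡ ε

    SumSet : List Carrier → List Carrier → Carrier → Set
    SumSet A B c = ∃₂ λ a b → a ∈ A × b ∈ B × c ≡ a ∙ b

  -- A set closed under adding b contains (n − 1)b = −b.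
  closed⇒trivial : ∀ {A B b} → ε ∈ A → Zero-unique A B → b ∈ B → Kernel b → (∀ {a} → a ∈ A → a ∙ b ∈ A) → b ≡ ε
  closed⇒trivial {A} {B} {b} ε∈A unique b∈B ker-b closed = go n (kernel-size (ε ∷ []) ([] ∷ []) (β-ε ∷ [])) (kernel-torsion b ker-b)
    where
    multiples : ∀ k → k · b ∈ A
    multiples zero    = ε∈A
    multiples (suc k) = subst (_∈ A) (≈⇒≡ (comm _ b)) (closed (multiples k))
    go : ∀ k → 1 ≤ k → k · b ≈ ε → b ≡ ε
    go (suc k) _ eq = unique (multiples k) b∈B (≈⇒≡ (trans (comm _ b) eq))

  private
    length-filter-split : ∀ {P : Carrier → Set} (P? : ∀ x → Dec (P x)) xs →
      length (filter P? xs) + length (filter (¬? ∘ P?) xs) ≡ length xs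
    length-filter-split P? [] = ≡.refl
    length-filter-split P? (x ∷ xs) with P? x
    ... | yes _ = cong suc (length-filter-split P? xs)
    ... | no  _ = ≡.trans (+-suc _ _) (cong suc (length-filter-split P? xs))

    all-equal-singleton : ∀ {B} → AllPairs _≢_ B → ε ∈ B → (∀ {b} → b ∈ B → b ≡ ε) → length B ≡ 1
    all-equal-singleton {b ∷ []} _ _ _ = ≡.refl
    all-equal-singleton {b ∷ c ∷ B} ((b≢c ∷ _) ∷ _) _ eq = contradiction (≡.trans (eq (here ≡.refl)) (≡.sym (eq (there (here ≡.refl))))) b≢c

  -- Scherk's theorem, by the Dyson transform A ∪ (a + B), B ∩ (A − a).
  scherk : ∀ m A B → length B ≤ m → AllPairs _≢_ A → AllPairs _≢_ B → ε ∈ A → ε ∈ B → All Kernel B → Zero-unique A B →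
    ∃[ C ] AllPairs _≢_ C × ε ∈ C × All (SumSet A B) C × suc (length C) ≡ length A + length B
  scherk m A B len≤ distinct-A distinct-B ε∈A ε∈B ker-B unique
    with All.all? (λ a → All.all? (λ b → (a ∙ b) ∈? A) B) A
  ... | yes closed = A , distinct-A , ε∈A , All.tabulate (λ {a} a∈A → a , ε , a∈A , ε∈B , ≡.sym (≈⇒≡ (identityʳ a))) ,
    ≡.trans (+-comm 1 (length A)) (cong (length A +_) (≡.sym (all-equal-singleton distinct-B ε∈B λ b∈B →
      closed⇒trivial ε∈A unique b∈B (All.lookup ker-B b∈B) λ a∈A → All.lookup (All.lookup closed a∈A) b∈B)))
  scherk m A B len≤ distinct-A distinct-B ε∈A ε∈B ker-B unique | no ¬closed
    with Membership.find (Allₚ.¬All⇒Any¬ (λ a → All.all? (λ b → (a ∙ b) ∈? A) B) A ¬closed)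
  scherk zero A [] len≤ distinct-A distinct-B ε∈A () ker-B unique | no ¬closed | a , a∈A , ¬stays
  scherk (suc m) A B len≤ distinct-A distinct-B ε∈A ε∈B ker-B unique | no ¬closed | a , a∈A , ¬stays =
    let C , distinct-C , ε∈C , sums , len = scherk m A′ B′ len-B′ distinct-A′ (AllPairsₚ.filter⁺ stays? distinct-B)
          (∈-++⁺ˡ ε∈A) (∈-filter⁺ stays? ε∈B (subst (_∈ A) (≡.sym (≈⇒≡ (identityʳ a))) a∈A)) (Allₚ.filter⁺ stays? ker-B) unique′
    in C , distinct-C , ε∈C , All.map back sums , ≡.trans len len′
    where
    stays? : ∀ b → Dec ((a ∙ b) ∈ A)
    stays? b = (a ∙ b) ∈? A
    B′ M A′ : List Carrier
    B′ = filter stays? B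
    M  = filter (¬? ∘ stays?) B
    A′ = A ++ map (a ∙_) M
    1≤M : 1 ≤ length M
    1≤M = filter-some (¬? ∘ stays?) (Allₚ.¬All⇒Any¬ stays? B ¬stays)
    len-B′ : length B′ ≤ m
    len-B′ = s≤s⁻¹ (≤-trans (≤-trans (≤-reflexive (+-comm 1 _)) (+-monoʳ-≤ (length B′) 1≤M))
      (≤-trans (≤-reflexive (length-filter-split stays? B)) len≤))
    distinct-A′ : AllPairs _≢_ A′
    distinct-A′ = AllPairsₚ.++⁺ distinct-A
      (AllPairsₚ.map⁺ (AllPairs.map (λ x≢y eq → x≢y (≈⇒≡ (∙-cancelˡ a _ _ (reflexive eq)))) (AllPairsₚ.filter⁺ (¬? ∘ stays?) distinct-B)))
      (All.tabulate λ x∈A → Allₚ.map⁺ (All.map (λ ∉A eq → ∉A (subst (_∈ A) eq x∈A)) (Allₚ.all-filter (¬? ∘ stays?) B)))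
    split : ∀ {x} → x ∈ A′ → x ∈ A ⊎ (∃[ b ] b ∈ B × x ≡ a ∙ b)
    split x∈ with ∈-++⁻ A x∈
    ... | inj₁ x∈A = inj₁ x∈A
    ... | inj₂ x∈  = let b , b∈M , x≡ = ∈-map⁻ (a ∙_) x∈ in inj₂ (b , ∈-filter⁻ (¬? ∘ stays?) b∈M .proj₁ , x≡)
    exchange : ∀ x y z → (x ∙ y) ∙ z ≡ (x ∙ z) ∙ y
    exchange x y z = ≈⇒≡ (solve 3 (λ x y z → (x ⊙ y) ⊙ z ⊜ (x ⊙ z) ⊙ y) refl x y z)
    unique′ : Zero-unique A′ B′
    unique′ {x} {b} x∈ b∈ xb≡ε with split x∈ | ∈-filter⁻ stays? {xs = B} b∈
    ... | inj₁ x∈A | b∈B , _ = unique x∈A b∈B xb≡ε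
    -- As `a ∙ b` lies in A, uniqueness gives first c = ε and then b = ε.
    ... | inj₂ (c , c∈B , ≡.refl) | b∈B , stays =
      unique a∈A b∈B (≡.trans (≡.sym (≈⇒≡ (identityʳ _))) (≡.trans (cong (a ∙ b ∙_) (≡.sym (unique stays c∈B (≡.trans (exchange a b c) xb≡ε)))) (≡.trans (exchange a b c) xb≡ε)))
    back : ∀ {c} → SumSet A′ B′ c → SumSet A B c
    back (x , b , x∈ , b∈ , c≡) with split x∈ | ∈-filter⁻ stays? {xs = B} b∈
    ... | inj₁ x∈A | b∈B , _ = x , b , x∈A , b∈B , c≡
    ... | inj₂ (y , y∈B , ≡.refl) | _ , stays = a ∙ b , y , stays , y∈B , ≡.trans c≡ (exchange a y b)
    len′ : length A′ + length B′ ≡ length A + length B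
    len′ = ≡.trans (cong (_+ length B′) (≡.trans (length-++ A) (cong (length A +_) (length-map (a ∙_) M))))
      (≡.trans (+-assoc (length A) _ _) (cong (length A +_) (≡.trans (+-comm (length M) _) (length-filter-split stays? B))))

  flatten : List (Carrier × Carrier) → List Carrier
  flatten []             = []
  flatten ((x , y) ∷ ps) = x ∷ y ∷ flatten ps

  private
    Growth : List Carrier → ℕ → Set
    Growth L k = ∃[ C ] AllPairs _≢_ C × ε ∈ C × All Kernel C × All (SubSum L) C × length C ≡ suc k

    -- Zero-sum freeness of `D ++ L` is the uniqueness hypothesis of `scherk`. Both sets contain ε,
    -- so each element of `D-sums` adds one to the count.
    grow : ∀ {L k} D D-sums → AllPairs _≢_ (ε ∷ D-sums) → All Kernel D-sums →
      All (λ b → ∃[ d ] ∃₂ λ ds es → d ∷ ds ++ es ↭ D × b ≡ σ (d ∷ ds)) D-sums →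
      ZeroSumFree′ (D ++ L) → Growth L k → Growth (D ++ L) (length D-sums + k)
    grow {L} {k} D D-sums distinct ker sub zsf (A , distinct-A , ε∈A , ker-A , sums-A , len-A) =
      let C , distinct-C , ε∈C , sums-C , len-C = scherk (length (ε ∷ D-sums)) A (ε ∷ D-sums) ≤-refl distinct-A distinct ε∈A (here ≡.refl) (β-ε ∷ ker) unique
      in C , distinct-C , ε∈C ,
        All.map (λ (a , b , a∈A , b∈ , c≡) → ≡.trans (cong β c≡) (≡.trans (β-∙ a b) (≡.trans (cong₂ _⊞_ (All.lookup ker-A a∈A) (All.lookup (β-ε ∷ ker) b∈)) (⊞-self 𝟎)))) sums-C ,
        All.map (λ (a , b , a∈A , b∈ , c≡) → subst (SubSum (D ++ L)) (≡.sym c≡) (join a∈A b∈)) sums-C ,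
        suc-injective (≡.trans len-C (≡.trans (cong (_+ suc (length D-sums)) len-A) (arith k (length D-sums))))
      where
      arith : ∀ k d → suc k + suc d ≡ suc (suc (d + k))
      arith = solve-∀
      sum-of : ∀ {b} → b ∈ ε ∷ D-sums → b ≡ ε ⊎ (∃[ d ] ∃₂ λ ds es → d ∷ ds ++ es ↭ D × b ≡ σ (d ∷ ds))
      sum-of (here b≡ε) = inj₁ b≡ε
      sum-of (there b∈) = inj₂ (All.lookup sub b∈)
      merge : ∀ ys zs → ys ++ zs ↭ L → ∀ d ds es → d ∷ ds ++ es ↭ D → ((d ∷ ds) ++ ys) ++ es ++ zs ↭ D ++ L
      merge ys zs π d ds es ρ = ↭-trans (↭-reflexive (++-assoc (d ∷ ds) ys (es ++ zs)))
        (↭-trans (++⁺ˡ (d ∷ ds) (shifts ys es)) (↭-trans (↭-reflexive (≡.sym (++-assoc (d ∷ ds) es (ys ++ zs)))) (++⁺ ρ π)))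
      join : ∀ {a b} → a ∈ A → b ∈ ε ∷ D-sums → SubSum (D ++ L) (a ∙ b)
      join a∈A b∈ with All.lookup sums-A a∈A | sum-of b∈
      ... | ys , zs , π , a≡ | inj₁ b≡ε = ys , D ++ zs , ↭-trans (shifts ys D) (++⁺ˡ D π) , ≡.trans (cong₂ _∙_ a≡ b≡ε) (≈⇒≡ (identityʳ _))
      ... | ys , zs , π , a≡ | inj₂ (d , ds , es , ρ , b≡) = (d ∷ ds) ++ ys , es ++ zs , merge ys zs π d ds es ρ ,
        ≡.trans (cong₂ _∙_ a≡ b≡) (≈⇒≡ (trans (comm _ _) (sym (σ-++ (d ∷ ds) ys))))
      unique : Zero-unique A (ε ∷ D-sums)
      unique a∈A b∈ ab≡ε with All.lookup sums-A a∈A | sum-of b∈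
      ... | _ | inj₁ b≡ε = b≡ε
      ... | ys , zs , π , a≡ | inj₂ (d , ds , es , ρ , b≡) = ⊥-elim (zsf d (ds ++ ys) (es ++ zs) (merge ys zs π d ds es ρ)
        (trans (σ-++ (d ∷ ds) ys) (trans (comm _ _) (reflexive (≡.trans (cong₂ _∙_ (≡.sym a≡) (≡.sym b≡)) ab≡ε)))))

    zsf-++ʳ : ∀ D {L} → ZeroSumFree′ (D ++ L) → ZeroSumFree′ L
    zsf-++ʳ D {L} zsf y ys zs π = zsf y ys (D ++ zs) (↭-trans (shifts (y ∷ ys) D) (++⁺ˡ D π))

    -- Two different terms contribute the three sums x, y and x + y, one more than two single terms.
    growth : ∀ ds ss → All (λ (x , y) → x ≢ y) ds → All Kernel (flatten ds ++ ss) → ZeroSumFree′ (flatten ds ++ ss) →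
      Growth (flatten ds ++ ss) (length ds * 3 + length ss)
    growth [] [] _ _ _ = ε ∷ [] , [] ∷ [] , here ≡.refl , β-ε ∷ [] , ([] , [] , ↭-refl , ≡.refl) ∷ [] , ≡.refl
    growth [] (s ∷ ss) _ (ks ∷ kss) zsf =
      grow (s ∷ []) (s ∷ []) (((λ ε≡s → s≢ε (≡.sym ε≡s)) ∷ []) ∷ [] ∷ []) (ks ∷ [])
        ((s , [] , [] , ↭-refl , ≡.sym (≈⇒≡ (identityʳ s))) ∷ []) zsf (growth [] ss [] kss (zsf-++ʳ (s ∷ []) zsf))
      where
      s≢ε : s ≢ ε
      s≢ε s≡ε = zsf s [] ss ↭-refl (trans (identityʳ s) (reflexive s≡ε))
    growth ((x , y) ∷ ds) ss (x≢y ∷ distinct) (kx ∷ ky ∷ ks) zsf =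
      grow (x ∷ y ∷ []) (x ∷ y ∷ x ∙ y ∷ []) ((nonzero x≢ε ∷ nonzero y≢ε ∷ nonzero xy≢ε ∷ []) ∷ (x≢y ∷ x≢xy ∷ []) ∷ (y≢xy ∷ []) ∷ [] ∷ [])
        (kx ∷ ky ∷ ≡.trans (β-∙ x y) (≡.trans (cong₂ _⊞_ kx ky) (⊞-self 𝟎)) ∷ [])
        ((x , [] , y ∷ [] , ↭-refl , ≡.sym (≈⇒≡ (identityʳ x))) ∷ (y , [] , x ∷ [] , swap y x ↭-refl , ≡.sym (≈⇒≡ (identityʳ y)))
          ∷ (x , y ∷ [] , [] , ↭-refl , cong (x ∙_) (≡.sym (≈⇒≡ (identityʳ y)))) ∷ [])
        zsf (growth ds ss distinct ks (zsf-++ʳ (x ∷ y ∷ []) zsf))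
      where
      L : List Carrier
      L = flatten ds ++ ss
      nonzero : ∀ {z} → z ≢ ε → ε ≢ z
      nonzero z≢ε ε≡z = z≢ε (≡.sym ε≡z)
      x≢ε : x ≢ ε
      x≢ε x≡ε = zsf x [] (y ∷ L) ↭-refl (trans (identityʳ x) (reflexive x≡ε))
      y≢ε : y ≢ ε
      y≢ε y≡ε = zsf y [] (x ∷ L) (swap y x ↭-refl) (trans (identityʳ y) (reflexive y≡ε))
      xy≢ε : x ∙ y ≢ ε
      xy≢ε xy≡ε = zsf x (y ∷ []) L ↭-refl (trans (∙-congˡ (identityʳ y)) (reflexive xy≡ε))
      x≢xy : x ≢ x ∙ y
      x≢xy x≡xy = y≢ε (≡.sym (≈⇒≡ (∙-cancelˡ x _ _ (trans (identityʳ x) (reflexive x≡xy)))))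
      y≢xy : y ≢ x ∙ y
      y≢xy y≡xy = x≢ε (≡.sym (≈⇒≡ (∙-cancelʳ y _ _ (trans (identityˡ y) (reflexive y≡xy)))))

  pairs-bound : ∀ ds ss → All (λ (x , y) → x ≢ y) ds → All Kernel (flatten ds ++ ss) → ZeroSumFree′ (flatten ds ++ ss) →
    length ds * 3 + length ss < n
  pairs-bound ds ss distinct kernel zsf =
    let C , distinct-C , _ , ker-C , _ , len = growth ds ss distinct kernel zsf in
    ≤-trans (≤-reflexive (≡.sym len)) (kernel-size C distinct-C ker-C)

-- Pairs with equal sum

half-≤-suc : ∀ {m k} → m + m ≤ suc (k + k) → m ≤ k
half-≤-suc {m} {k} le with m ≤? k
... | yes m≤k = m≤k
... | no  m≰k = contradiction (≤-trans (≤-trans (≤-reflexive (cong suc (≡.sym (+-suc k k)))) (+-mono-≤ (≰⇒> m≰k) (≰⇒> m≰k))) le) (<-irrefl ≡.refl)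

map-++⁻ : {A B : Set} (f : A → B) (ps : List A) (us : List B) {vs : List B} → map f ps ≡ us ++ vs → ∃₂ λ qs rs → ps ≡ qs ++ rs × map f qs ≡ us
map-++⁻ f ps [] eq = [] , ps , ≡.refl , ≡.refl
map-++⁻ f (p ∷ ps) (u ∷ us) eq with ∷-injective eq
... | eq₁ , eq₂ with map-++⁻ f ps us eq₂
...   | qs , rs , ps≡ , map≡ = p ∷ qs , rs , cong (p ∷_) ps≡ , cong₂ _∷_ eq₁ map≡

module _ {n : ℕ} (𝔾 : Ambient n) where
  open Ambient 𝔾
  open Solver using (solve; _⊜_) renaming (_⊕_ to _⊙_)

  Pair : Set
  Pair = Carrier × Carrier

  Paired : Pair → Set
  Paired (x , y) = β x ≡ β y

  fuse : Pair → Carrier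
  fuse (x , y) = x ∙ y

  flat : List Pair → List Carrier
  flat = flatten 𝔾

  flat-++ : ∀ ps qs → flat (ps ++ qs) ≡ flat ps ++ flat qs
  flat-++ []             qs = ≡.refl
  flat-++ ((x , y) ∷ ps) qs = cong (λ zs → x ∷ y ∷ zs) (flat-++ ps qs)

  flat-↭ : ∀ {ps qs} → ps ↭ qs → flat ps ↭ flat qs
  flat-↭ Perm.refl = ↭-refl
  flat-↭ (prep (x , y) π) = prep x (prep y (flat-↭ π))
  flat-↭ (swap (x , y) (u , v) π) = ↭-trans (shifts (x ∷ y ∷ []) (u ∷ v ∷ [])) (prep u (prep v (prep x (prep y (flat-↭ π)))))
  flat-↭ (Perm.trans π ρ) = ↭-trans (flat-↭ π) (flat-↭ ρ)

  σ-flat : ∀ ps → σ (flat ps) ≈ σ (map fuse ps)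
  σ-flat []             = refl
  σ-flat ((x , y) ∷ ps) = trans (sym (assoc x y _)) (∙-congˡ (σ-flat ps))

  length-flat : ∀ ps → length (flat ps) ≡ length ps + length ps
  length-flat []             = ≡.refl
  length-flat ((x , y) ∷ ps) = cong suc (≡.trans (cong suc (length-flat ps)) (≡.sym (+-suc _ _)))

  sum-kernel : ∀ {ps} → All Paired ps → All (λ x → β x ≡ 𝟎) (map fuse ps)
  sum-kernel []         = []
  sum-kernel {(x , y) ∷ _} (eq ∷ eqs) = ≡.trans (β-∙ x y) (≡.trans (cong (_⊞ β y) eq) (⊞-self (β y))) ∷ sum-kernel eqs

  -- 32 = 2^5 is the number of classes modulo 2G.
  pair-up : ∀ m xs → length xs ≤ m → ∃₂ λ ps rest → flat ps ++ rest ↭ xs × All Paired ps × length rest ≤ 32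
  pair-up m xs len≤ with length xs ≤? 32
  ... | yes short = [] , xs , ↭-refl , [] , short
  pair-up zero    [] len≤ | no long = contradiction z≤n long
  pair-up (suc m) xs len≤ | no long =
    let x , y , zs , π , βx≡βy = pigeonhole β xs (≰⇒> long)
        ps , rest , ρ , paired , short = pair-up m zs (≤-trans (n≤1+n _) (s≤s⁻¹ (≤-trans (≤-reflexive (↭-length π)) len≤)))
    in (x , y) ∷ ps , rest , ↭-trans (prep x (prep y ρ)) π , βx≡βy ∷ paired , short

  module _ {T : List Carrier} (zsf : ZeroSumFree′ T) where

    sums-zsf : ∀ {ps rest} → flat ps ++ rest ↭ T → ZeroSumFree′ (map fuse ps)
    sums-zsf {ps} {rest} π u us vs ρ with ↭-map-inv fuse (↭-sym ρ)
    ... | ps′ , eq , ps↭ps′ with map-++⁻ fuse ps′ (u ∷ us) (≡.sym eq)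
    ...   | [] , rs , _ , ()
    ...   | (x , y) ∷ qs , rs , ≡.refl , map≡ = λ σ≈ε → zsf x (y ∷ flat qs) (flat rs ++ rest) perm
              (trans (σ-flat ((x , y) ∷ qs)) (trans (reflexive (cong σ map≡)) σ≈ε))
      where
      perm : flat ((x , y) ∷ qs) ++ flat rs ++ rest ↭ T
      perm = ↭-trans (↭-reflexive (≡.trans (≡.sym (++-assoc (flat ((x , y) ∷ qs)) _ rest)) (cong (_++ rest) (≡.sym (flat-++ ((x , y) ∷ qs) rs)))))
        (↭-trans (++⁺ʳ rest (flat-↭ (↭-sym ps↭ps′))) π)

    private
      couple : ∀ k g gs bs → All (_≡ g) gs → All (_≢ g) bs → k ≤ length gs → k ≤ length bs →
        ∃₂ λ ds ss → flat ds ++ ss ↭ gs ++ bs × All (λ (x , y) → x ≢ y) ds × length ds ≡ k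
      couple zero g gs bs _ _ _ _ = [] , gs ++ bs , ↭-refl , [] , ≡.refl
      couple (suc k) g (x ∷ gs) (y ∷ bs) (x≡g ∷ ≡gs) (y≢g ∷ ≢bs) (s≤s k≤gs) (s≤s k≤bs) =
        let ds , ss , π , distinct , len = couple k g gs bs ≡gs ≢bs k≤gs k≤bs in
        (x , y) ∷ ds , ss , prep x (↭-trans (prep y π) (↭-sym (shift y gs bs))) ,
          (λ x≡y → y≢g (≡.trans (≡.sym x≡y) x≡g)) ∷ distinct , cong suc len

    record Pairing (g : Carrier) : Set where
      field
        good bad : List Pair
        rest     : List Carrier
        perm     : flat (good ++ bad) ++ rest ↭ T
        paired   : All Paired (good ++ bad)
        good-sum : All (λ q → fuse q ≡ g) good
        bad-sum  : All (λ q → fuse q ≢ g) bad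

      size : ℕ
      size = length good + length bad

    -- Each pair of unequal block sums uses up one more of the n − 1 nonzero elements.
    balance : ∀ {g} (P : Pairing g) → let open Pairing P in ∀ k → k ≤ length good → k ≤ length bad → size + k < n
    balance {g} P k k≤good k≤bad =
      let ds , ss , π , distinct , len-ds = couple k g (map fuse good) (map fuse bad) (Allₚ.map⁺ good-sum) (Allₚ.map⁺ bad-sum)
            (≤-trans k≤good (≤-reflexive (≡.sym (length-map fuse good)))) (≤-trans k≤bad (≤-reflexive (≡.sym (length-map fuse bad))))
          π′ = ↭-trans π (↭-reflexive (≡.sym (map-++ fuse good bad)))
      in ≤-trans (s≤s (≤-reflexive (tally ds ss π′ len-ds))) (pairs-bound 𝔾 ds ss distinct (All-resp-↭ (↭-sym π′) (sum-kernel paired)) (zsf-resp (↭-sym π′) (sums-zsf perm)))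
      where
      open Pairing P
      zsf-resp : ∀ {X Y} → X ↭ Y → ZeroSumFree′ X → ZeroSumFree′ Y
      zsf-resp ρ f y ys zs π = f y ys zs (↭-trans π (↭-sym ρ))
      tally : ∀ ds ss → flat ds ++ ss ↭ map fuse (good ++ bad) → length ds ≡ k → size + k ≡ length ds * 3 + length ss
      tally ds ss π len-ds = begin
        length good + length bad + k                ≡⟨ cong (_+ k) (≡.trans (≡.sym (length-++ good)) (≡.sym (length-map fuse (good ++ bad)))) ⟩
        length (map fuse (good ++ bad)) + k          ≡⟨ cong (_+ k) (↭-length π) ⟨
        length (flat ds ++ ss) + k                  ≡⟨ cong (_+ k) (≡.trans (length-++ (flat ds)) (cong (_+ length ss) (length-flat ds))) ⟩
        length ds + length ds + length ss + k       ≡⟨ cong (λ j → length ds + length ds + length ss + j) len-ds ⟨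
        length ds + length ds + length ss + length ds ≡⟨ arith (length ds) (length ss) ⟩
        length ds * 3 + length ss                   ∎
        where
        open ≡.≡-Reasoning
        arith : ∀ a b → a + a + b + a ≡ a * 3 + b
        arith = solve-∀

    private
      -- Greedy matching of unequal elements: what remains is constant, and for the sums of the
      -- pairs its value is the g sought.
      unpair : ∀ (xs : List Carrier) → ∃₂ λ ds (ss : List Carrier) → flat ds ++ ss ↭ xs × All (λ (x , y) → x ≢ y) ds × (∀ {x y} → x ∈ ss → y ∈ ss → x ≡ y)
      unpair [] = [] , [] , ↭-refl , [] , λ ()
      unpair (x ∷ xs) with unpair xs
      ... | ds , [] , π , distinct , equal = ds , x ∷ [] , ↭-trans (++-comm (flat ds) (x ∷ [])) (prep x (subst (_↭ xs) (++-identityʳ _) π)) , distinct ,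
        λ { (here ≡.refl) (here ≡.refl) → ≡.refl }
      ... | ds , s ∷ ss , π , distinct , equal with x ≟ᴬ s
      ...   | yes ≡.refl = ds , x ∷ x ∷ ss , ↭-trans (shift x (flat ds) (x ∷ ss)) (prep x π) , distinct ,
        λ { (here ≡.refl) (here ≡.refl) → ≡.refl ; (here ≡.refl) (there y∈) → equal (here ≡.refl) y∈
          ; (there x∈) (here ≡.refl) → equal x∈ (here ≡.refl) ; (there x∈) (there y∈) → equal x∈ y∈ }
      ...   | no x≢s = (x , s) ∷ ds , ss , prep x (↭-trans (↭-sym (shift s (flat ds) ss)) π) , x≢s ∷ distinct , λ x∈ y∈ → equal (there x∈) (there y∈)

      count-≤ : ∀ (g : Carrier) gs bs D ss → gs ++ bs ↭ D ++ ss → All (_≢ g) bs → All (_≡ g) ss → length ss ≤ length gs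
      count-≤ g gs bs D [] π ≢g [] = z≤n
      count-≤ g gs bs D (s ∷ ss) π ≢g (≡.refl ∷ ≡g) with Anyₚ.++⁻ gs (∈-resp-↭ (↭-sym (↭-trans π (shift s D ss))) (here ≡.refl))
      ... | inj₂ s∈bs = contradiction ≡.refl (All.lookup ≢g s∈bs)
      ... | inj₁ s∈gs = let gs′ , ρ = ∈⇒↭ s∈gs in
        ≤-trans (s≤s (count-≤ s gs′ bs D ss (drop-∷ (↭-trans (++⁺ʳ bs ρ) (↭-trans π (shift s D ss)))) ≢g ≡g)) (≤-reflexive (↭-length ρ))

    module _ (70<n : 70 < n) (len : length T ≡ 3 + (n + n)) where

      private
        57≤ : ∀ {m} → n ≤ m + 14 → 57 ≤ m
        57≤ n≤ = +-cancelʳ-≤ 14 57 _ (≤-trans 70<n n≤)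

      -- For the number m of pairs, 2m + 32 ≥ 2n + 3 gives n ≤ m + 14. If q disjoint couples of
      -- pairs have unequal sums, then m + q < n by `pairs-bound`, so q ≤ 13, and at least 57 - 26 =
      -- 31 sums are left over, all equal. `balance` then bounds the number of other sums by 13.
      start : ∃ λ g → ∃ λ (P : Pairing g) → let open Pairing P in n ≤ size + 14 × length bad ≤ 13
      start with pair-up (length T) T ≤-refl
      ... | ps , rest , π , paired , short with unpair (map fuse ps)
      ...   | ds , ss , ρ , distinct , equal = from-ss ss ρ equal (≤-trans ≤-refl long)
        where
        m : ℕ
        m = length ps
        n≤ : n ≤ m + 14
        n≤ = half-≤-suc (+-cancelˡ-≤ 3 _ _ (begin
          3 + (n + n)                    ≡⟨ len ⟨
          length T                       ≡⟨ ↭-length π ⟨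
          length (flat ps ++ rest)       ≡⟨ ≡.trans (length-++ (flat ps)) (cong (_+ length rest) (length-flat ps)) ⟩
          m + m + length rest            ≤⟨ +-monoʳ-≤ (m + m) short ⟩
          m + m + 32                     ≡⟨ arith m ⟩
          3 + suc (m + 14 + (m + 14))    ∎))
          where
          open ≤-Reasoning
          arith : ∀ m → m + m + 32 ≡ 3 + suc (m + 14 + (m + 14))
          arith = solve-∀
        m≡ : length ds + length ds + length ss ≡ m
        m≡ = ≡.trans (cong (_+ length ss) (≡.sym (length-flat ds))) (≡.trans (≡.sym (length-++ (flat ds))) (≡.trans (↭-length ρ) (length-map fuse ps)))
        zsf-sums : ZeroSumFree′ (flat ds ++ ss)
        zsf-sums y ys zs ρ′ = sums-zsf π y ys zs (↭-trans ρ′ ρ)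
        q≤13 : length ds ≤ 13
        q≤13 = s≤s⁻¹ (+-cancelˡ-≤ m _ _ (begin
          m + suc (length ds)                                    ≡⟨ cong (_+ suc (length ds)) m≡ ⟨
          length ds + length ds + length ss + suc (length ds)    ≡⟨ arith (length ds) (length ss) ⟩
          suc (length ds * 3 + length ss)                        ≤⟨ pairs-bound 𝔾 ds ss distinct (All-resp-↭ (↭-sym ρ) (sum-kernel paired)) zsf-sums ⟩
          n                                                      ≤⟨ n≤ ⟩
          m + 14                                                 ∎))
          where
          open ≤-Reasoning
          arith : ∀ a b → a + a + b + suc a ≡ suc (a * 3 + b)
          arith = solve-∀
        long : 31 ≤ length ss
        long = +-cancelˡ-≤ 26 31 _ (begin
          57                                    ≤⟨ 57≤ n≤ ⟩
          m                                     ≡⟨ m≡ ⟨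
          length ds + length ds + length ss     ≤⟨ +-monoˡ-≤ (length ss) (+-mono-≤ q≤13 q≤13) ⟩
          26 + length ss                        ∎)
          where open ≤-Reasoning
        from-ss : ∀ (ss : List Carrier) → flat ds ++ ss ↭ map fuse ps → (∀ {x y} → x ∈ ss → y ∈ ss → x ≡ y) → 31 ≤ length ss → _
        from-ss (g ∷ ss) ρ equal long = build (All-⊎ (All.universal classify ps))
          where
          classify : ∀ q → fuse q ≡ g ⊎ fuse q ≢ g
          classify q with fuse q ≟ᴬ g
          ... | yes eq = inj₁ eq
          ... | no  ne = inj₂ ne
          build : (∃₂ λ good bad → good ++ bad ↭ ps × All (λ q → fuse q ≡ g) good × All (λ q → fuse q ≢ g) bad) → _
          build (good , bad , ρ′ , good-sum , bad-sum) = g , P , ≤-trans n≤ (+-monoˡ-≤ 14 (≤-reflexive m≡size)) , bad≤13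
            where
            P : Pairing g
            P = record { good = good ; bad = bad ; rest = rest ; perm = ↭-trans (++⁺ʳ rest (flat-↭ ρ′)) π
              ; paired = All-resp-↭ (↭-sym ρ′) paired ; good-sum = good-sum ; bad-sum = bad-sum }
            m≡size : m ≡ length good + length bad
            m≡size = ≡.trans (≡.sym (↭-length ρ′)) (length-++ good)
            14≤good : 14 ≤ length good
            14≤good = ≤-trans (≤-trans (m≤m+n 14 17) long) (≤-trans (count-≤ g (map fuse good) (map fuse bad) (flat ds) (g ∷ ss)
              (↭-trans (↭-reflexive (≡.sym (map-++ fuse good bad))) (↭-trans (map⁺ fuse ρ′) (↭-sym ρ)))
              (Allₚ.map⁺ bad-sum) (All.tabulate λ x∈ → equal x∈ (here ≡.refl))) (≤-reflexive (length-map fuse good)))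
            bad≤13 : length bad ≤ 13
            bad≤13 with length bad ≤? 13
            ... | yes ≤13 = ≤13
            ... | no  ≰13 = contradiction (≤-trans (balance P 14 14≤good (≰⇒> ≰13)) (≤-trans n≤ (+-monoˡ-≤ 14 (≤-reflexive m≡size)))) (<-irrefl ≡.refl)

  -- In `large`, 28 = 14 + 13 + 1 accounts for the unpaired terms, for the pairs with a different
  -- sum and for the pair formed by the two copies of `e`.
  record Frame (T : List Carrier) : Set where
    field
      e       : Carrier
      ps      : List Pair
      S       : List Carrier
      perm    : e ∷ e ∷ flat ps ++ S ↭ T
      paired  : All Paired ps
      sums    : All (λ q → fuse q ≡ e ∙ e) ps
      large   : n ≤ length ps + 28

  private
    find-square : ∀ qs → (∃₂ λ x rs → (x , x) ∷ rs ↭ qs) ⊎ All (λ (x , y) → x ≢ y) qs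
    find-square [] = inj₂ []
    find-square ((x , y) ∷ qs) with x ≟ᴬ y | find-square qs
    ... | yes ≡.refl | _ = inj₁ (x , qs , ↭-refl)
    ... | no x≢y | inj₁ (z , rs , π) = inj₁ (z , (x , y) ∷ rs , ↭-trans (swap (z , z) (x , y) ↭-refl) (prep (x , y) π))
    ... | no x≢y | inj₂ distinct = inj₂ (x≢y ∷ distinct)

    cancel-left : ∀ {x y z} → x ∙ y ≡ x ∙ z → y ≡ z
    cancel-left {x} eq = ≈⇒≡ (∙-cancelˡ x _ _ (reflexive eq))

    cancel-right : ∀ {x y z} → y ∙ x ≡ z ∙ x → y ≡ z
    cancel-right {x} eq = ≈⇒≡ (∙-cancelʳ x _ _ (reflexive eq))

  module _ {T : List Carrier} (zsf : ZeroSumFree′ T) (70<n : 70 < n) where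
    private
      module _ {g : Carrier} (P : Pairing zsf g) where
        open Pairing P

        frame : ∀ {x qs} → (x , x) ∷ qs ↭ good → n ≤ size + 14 → length bad ≤ 13 → Frame T
        frame {x} {qs} π n≤ bad≤ = record
          { e = x ; ps = qs ; S = flat bad ++ rest
          ; perm = ↭-trans (prep x (prep x (↭-reflexive (≡.trans (≡.sym (++-assoc (flat qs) (flat bad) rest)) (cong (_++ rest) (≡.sym (flat-++ qs bad)))))))
              (↭-trans (++⁺ʳ rest (flat-↭ (++⁺ʳ bad π))) perm)
          ; paired = Allₚ.++⁻ˡ qs (All.tail (All-resp-↭ (↭-sym (++⁺ʳ bad π)) paired))
          ; sums = All.map (λ eq → ≡.trans eq (≡.sym (All.head good-sum′))) (All.tail good-sum′)
          ; large = begin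
              n                                        ≤⟨ n≤ ⟩
              length good + length bad + 14            ≡⟨ cong (λ k → k + length bad + 14) (↭-length π) ⟨
              suc (length qs) + length bad + 14        ≤⟨ +-monoˡ-≤ 14 (+-monoʳ-≤ (suc (length qs)) bad≤) ⟩
              suc (length qs) + 13 + 14                ≡⟨ arith (length qs) ⟩
              length qs + 28                           ∎
          }
          where
          open ≤-Reasoning
          arith : ∀ k → suc k + 13 + 14 ≡ k + 28
          arith = solve-∀
          good-sum′ : All (λ q → fuse q ≡ g) ((x , x) ∷ qs)
          good-sum′ = All-resp-↭ (↭-sym π) good-sum

        -- Two pairs of the same class with sum g, none of them a square, can be
        -- rearranged into two pairs with sums other than g.
        repair : ∀ {x y u v qs} → (x , y) ∷ (u , v) ∷ qs ↭ good → β x ≡ β u → All (λ (x , y) → x ≢ y) good →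
          ∃ λ (P′ : Pairing zsf g) → Pairing.good P′ ≡ qs × length (Pairing.bad P′) ≡ 2 + length bad
        repair {x} {y} {u} {v} {qs} π βx≡βu distinct with All-resp-↭ (↭-sym π) distinct | All-resp-↭ (↭-sym π) good-sum | All-resp-↭ (↭-sym (++⁺ʳ bad π)) paired
        ... | x≢y ∷ u≢v ∷ _ | xy≡g ∷ uv≡g ∷ good-sum′ | βx≡βy ∷ βu≡βv ∷ paired′ with x ≟ᴬ u
        ...   | yes ≡.refl = record
            { good = qs ; bad = (x , x) ∷ (y , v) ∷ bad ; rest = rest
            ; perm = ↭-trans (++⁺ʳ rest (↭-trans (flat-↭ (shifts qs ((x , x) ∷ (y , v) ∷ []))) (prep x (swap x y ↭-refl)))) perm′
            ; paired = All-resp-↭ (↭-sym (shifts qs ((x , x) ∷ (y , v) ∷ []))) (≡.refl ∷ ≡.trans (≡.sym βx≡βy) βu≡βv ∷ paired′)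
            ; good-sum = good-sum′
            ; bad-sum = (λ eq → x≢y (cancel-left (≡.trans eq (≡.sym xy≡g))))
                ∷ (λ eq → x≢y (≡.sym (cancel-right (≡.trans (≡.trans (cong (y ∙_) y≡v) eq) (≡.sym xy≡g))))) ∷ bad-sum
            } , ≡.refl , ≡.refl
          where
          y≡v : y ≡ v
          y≡v = cancel-left (≡.trans xy≡g (≡.sym uv≡g))
          perm′ : flat ((x , y) ∷ (x , v) ∷ qs ++ bad) ++ rest ↭ T
          perm′ = ↭-trans (++⁺ʳ rest (flat-↭ (++⁺ʳ bad π))) perm
        ...   | no x≢u = record
            { good = qs ; bad = (x , v) ∷ (u , y) ∷ bad ; rest = rest
            ; perm = ↭-trans (++⁺ʳ rest (↭-trans (flat-↭ (shifts qs ((x , v) ∷ (u , y) ∷ [])))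
                (prep x (↭-trans (swap v u ↭-refl) (↭-trans (prep u (swap v y ↭-refl)) (swap u y ↭-refl)))))) perm′
            ; paired = All-resp-↭ (↭-sym (shifts qs ((x , v) ∷ (u , y) ∷ [])))
                (≡.trans βx≡βu βu≡βv ∷ ≡.trans (≡.sym βx≡βu) βx≡βy ∷ paired′)
            ; good-sum = good-sum′
            ; bad-sum = (λ eq → x≢u (cancel-right (≡.trans eq (≡.sym uv≡g))))
                ∷ (λ eq → x≢u (≡.sym (cancel-right (≡.trans eq (≡.sym xy≡g))))) ∷ bad-sum
            } , ≡.refl , ≡.refl
          where
          perm′ : flat ((x , y) ∷ (u , v) ∷ qs ++ bad) ++ rest ↭ T
          perm′ = ↭-trans (++⁺ʳ rest (flat-↭ (++⁺ʳ bad π))) perm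

      good-large : ∀ {g b} (P : Pairing zsf g) → let open Pairing P in n ≤ size + 14 → length bad ≤ b → 57 ≤ length good + b
      good-large {b = b} P n≤ bad≤ = +-cancelʳ-≤ 14 57 _ (≤-trans 70<n (≤-trans n≤ (+-monoˡ-≤ 14 (+-monoʳ-≤ _ bad≤))))

      too-many : ∀ {g} (P : Pairing zsf g) → let open Pairing P in n ≤ size + 14 → length bad ≤ 15 → ¬ (14 ≤ length bad)
      too-many P n≤ bad≤15 14≤bad = <-irrefl ≡.refl (≤-trans
        (balance zsf P 14 (≤-trans (m≤m+n 14 28) (+-cancelʳ-≤ 15 42 _ (good-large P n≤ bad≤15))) 14≤bad) n≤)

      -- A repair keeps the number of pairs and adds two bad ones, while `balance` forbids 14 bad
      -- pairs; so a pair of equal terms must appear. `k` bounds the number of repairs, and 15 = 13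
      -- + 2.
      search : ∀ k {g} (P : Pairing zsf g) → let open Pairing P in n ≤ size + 14 → length bad ≤ 15 → 14 ≤ k + length bad → Frame T
      search zero P n≤ bad≤15 enough = contradiction enough (too-many P n≤ bad≤15)
      search (suc k) P n≤ bad≤15 enough with length (Pairing.bad P) ≤? 13
      ... | no  ≰13 = contradiction (≰⇒> ≰13) (too-many P n≤ bad≤15)
      ... | yes ≤13 = case find-square good of λ
        { (inj₁ (x , qs , π)) → frame P π n≤ ≤13
        ; (inj₂ distinct) →
            let (x , y) , (u , v) , qs , π , βx≡βu = pigeonhole (β ∘ proj₁) good (≤-trans (m≤m+n 33 11) (+-cancelʳ-≤ 13 44 _ (good-large P n≤ ≤13)))
                P′ , good≡ , bad≡ = repair P π βx≡βu distinct
            in search k P′ (≤-trans n≤ (+-monoˡ-≤ 14 (≤-reflexive (same-size {bad′ = Pairing.bad P′} π good≡ bad≡))))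
                 (≤-trans (≤-reflexive bad≡) (+-monoʳ-≤ 2 ≤13))
                 (≤-trans enough (≤-trans (≤-trans (s≤s (+-monoʳ-≤ k (n≤1+n _))) (≤-reflexive (≡.sym (+-suc k _)))) (≤-reflexive (cong (k +_) (≡.sym bad≡)))))
        }
        where
        open Pairing P
        same-size : ∀ {q q′ qs} {good′ bad′ : List Pair} → q ∷ q′ ∷ qs ↭ good → good′ ≡ qs → length bad′ ≡ 2 + length bad →
          length good + length bad ≡ length good′ + length bad′
        same-size {qs = qs} π ≡.refl bad≡ = ≡.trans (cong (_+ length bad) (≡.sym (↭-length π)))
          (≡.trans (arith (length qs) (length bad)) (cong (length qs +_) (≡.sym bad≡)))
          where
          arith : ∀ a b → suc (suc a) + b ≡ a + (2 + b)
          arith = solve-∀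

    frame-exists : length T ≡ 3 + (n + n) → Frame T
    frame-exists len =
      let g , P , n≤ , bad≤13 = start zsf 70<n len in
      search 14 P n≤ (≤-trans bad≤13 (m≤m+n 13 2)) (m≤m+n 14 _)

-- The context of a zero-sum free sequence

even-or-odd : ∀ c → (∃[ k ] c ≡ k + k) ⊎ (∃[ k ] c ≡ suc (k + k))
even-or-odd zero = inj₁ (0 , ≡.refl)
even-or-odd (suc c) with even-or-odd c
... | inj₁ (k , c≡) = inj₂ (k , cong suc c≡)
... | inj₂ (k , c≡) = inj₁ (suc k , ≡.trans (cong suc c≡) (cong suc (≡.sym (+-suc k k))))

double-<⁻ : ∀ {k n} → k + k < n + n → k < n
double-<⁻ {k} {n} lt with k <? n
... | yes k<n = k<n
... | no  k≮n = contradiction lt (≤⇒≯ (+-mono-≤ (≮⇒≥ k≮n) (≮⇒≥ k≮n)))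

module FrameContext {n : ℕ} (𝔾 : Ambient n) {T} (zsf : Ambient.ZeroSumFree′ 𝔾 T) (70<n : 70 < n) (frame : Frame 𝔾 T) where
  open Ambient 𝔾
  open Solver using (solve; _⊜_) renaming (_⊕_ to _⊙_)
  open Frame frame

  γ : ℕ
  γ = length ps

  opaque
    pair-multiple : ∀ j qs → All (λ q → fuse 𝔾 q ≡ e ∙ e) qs → j ≤ length qs →
      ∃₂ λ us vs → us ++ vs ≡ qs × length us ≡ j × σ (flat 𝔾 us) ≈ (j + j) · e
    pair-multiple zero    qs             _           _          = [] , qs , ≡.refl , ≡.refl , refl
    pair-multiple (suc j) ((x , y) ∷ qs) (xy ∷ sums) (s≤s j≤) =
      let us , vs , eq , len , σ≈ = pair-multiple j qs sums j≤ in
      (x , y) ∷ us , vs , cong ((x , y) ∷_) eq , cong suc len , (begin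
        x ∙ (y ∙ σ (flat 𝔾 us))  ≈⟨ assoc x y _ ⟨
        (x ∙ y) ∙ σ (flat 𝔾 us)  ≈⟨ ∙-cong (reflexive xy) σ≈ ⟩
        (e ∙ e) ∙ (j + j) · e    ≈⟨ assoc e e _ ⟩
        (2 + (j + j)) · e        ≡⟨ cong (λ k → suc k · e) (+-suc j j) ⟨
        (suc j + suc j) · e      ∎)
      where open ≈-Reasoning

  opaque
    n+n-torsion : (n + n) · e ≈ ε
    n+n-torsion = trans (double n) (kernel-torsion (e ∙ e) (≡.trans (β-∙ e e) (⊞-self (β e))))
      where
      double : ∀ k → (k + k) · e ≈ k · (e ∙ e)
      double zero    = refl
      double (suc k) = trans (∙-congˡ (reflexive (cong (_· e) (+-suc k k)))) (trans (sym (assoc e e _)) (∙-congˡ (double k)))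

  opaque
    few-multiples : ∀ j → 1 ≤ j → j ≤ γ → ¬ ((j + j) · e ≈ ε)
    few-multiples j 1≤j j≤γ eq with pair-multiple j ps sums j≤γ
    ... | [] , vs , _ , ≡.refl , _ = contradiction 1≤j λ ()
    ... | (x , y) ∷ us , vs , eq′ , _ , σ≈ = zsf x (y ∷ flat 𝔾 us) (flat 𝔾 vs ++ e ∷ e ∷ S)
      (↭-trans (↭-reflexive (≡.trans (≡.sym (++-assoc (x ∷ y ∷ flat 𝔾 us) (flat 𝔾 vs) _)) (cong (_++ e ∷ e ∷ S) (≡.trans (≡.sym (flat-++ 𝔾 ((x , y) ∷ us) vs)) (cong (flat 𝔾) eq′)))))
        (↭-trans (shifts (flat 𝔾 ps) (e ∷ e ∷ [])) perm))
      (trans σ≈ eq)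

  opaque
    complement : ∀ j k → (j + j) · e ≈ ε → j + k ≡ n → (k + k) · e ≈ ε
    complement j k eq j+k≡n = begin
      (k + k) · e                  ≈⟨ identityˡ _ ⟨
      ε ∙ (k + k) · e              ≈⟨ ∙-congʳ eq ⟨
      (j + j) · e ∙ (k + k) · e    ≈⟨ ·-homo-+ e (j + j) (k + k) ⟨
      (j + j + (k + k)) · e        ≡⟨ cong (_· e) (≡.trans (arith j k) (cong₂ _+_ j+k≡n j+k≡n)) ⟩
      (n + n) · e                  ≈⟨ n+n-torsion ⟩
      ε                            ∎
      where
      open ≈-Reasoning
      arith : ∀ j k → j + j + (k + k) ≡ j + k + (j + k)
      arith = solve-∀

  28≤γ : 28 ≤ γ
  28≤γ = +-cancelʳ-≤ 28 28 γ (≤-trans (m≤m+n 56 15) (≤-trans 70<n large))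

  opaque
    -- Up to γ, the multiple is a sum of j pairs. Beyond γ, n - j is at most 28 and hence at most γ,
    -- and if the multiple by 2j vanishes, so does that by 2(n - j).
    even-multiple : ∀ j → 1 ≤ j → j < n → ¬ ((j + j) · e ≈ ε)
    even-multiple j 1≤j j<n eq with j ≤? γ
    ... | yes j≤γ = few-multiples j 1≤j j≤γ eq
    ... | no  j≰γ = few-multiples (n ∸ j) (m<n⇒0<n∸m j<n) (≤-trans n∸j≤28 28≤γ) (complement j (n ∸ j) eq (m+[n∸m]≡n (<⇒≤ j<n)))
      where
      n∸j≤28 : n ∸ j ≤ 28
      n∸j≤28 = ≤-trans (∸-monoʳ-≤ n (<⇒≤ (≰⇒> j≰γ))) (≤-trans (∸-monoˡ-≤ γ large) (≤-reflexive (m+n∸m≡n γ 28)))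

  opaque
    -- The n even multiples of `e` are distinct and lie in the kernel of `β`, which has at most n
    -- elements.
    kernel-multiple : ∀ z → β z ≡ 𝟎 → ∃[ j ] j < n × z ≈ (j + j) · e
    kernel-multiple z βz with z ∈? applyUpTo (λ j → (j + j) · e) n
    ... | yes z∈ = let j , j<n , z≡ = ∈-applyUpTo⁻ (λ j → (j + j) · e) z∈ in j , j<n , reflexive z≡
    ... | no  z∉ = contradiction (kernel-size (z ∷ multiples) (fresh ∷ distinct) (βz ∷ kernel)) (<⇒≱ (s≤s (≤-reflexive (≡.sym (length-applyUpTo _ n)))))
      where
      multiples : List Carrier
      multiples = applyUpTo (λ j → (j + j) · e) n
      fresh : All (z ≢_) multiples
      fresh = All.tabulate λ x∈ z≡x → z∉ (subst (_∈ multiples) (≡.sym z≡x) x∈)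
      kernel : All (λ x → β x ≡ 𝟎) multiples
      kernel = Allₚ.applyUpTo⁺₂ (λ j → (j + j) · e) n λ j → ≡.trans (cong β (≈⇒≡ (·-homo-+ e j j))) (≡.trans (β-∙ _ _) (⊞-self (β (j · e))))
      distinct : AllPairs _≢_ multiples
      distinct = AllPairsₚ.applyUpTo⁺₁ _ n λ {i} {j} i<j j<n eq → even-multiple (j ∸ i) (m<n⇒0<n∸m i<j) (≤-<-trans (m∸n≤m j i) j<n)
        (∙-cancelˡ ((i + i) · e) _ _ (begin
          (i + i) · e ∙ (j ∸ i + (j ∸ i)) · e    ≈⟨ ·-homo-+ e (i + i) _ ⟨
          (i + i + (j ∸ i + (j ∸ i))) · e        ≡⟨ cong (_· e) (≡.trans (arith i (j ∸ i)) (cong₂ _+_ (m+[n∸m]≡n (<⇒≤ i<j)) (m+[n∸m]≡n (<⇒≤ i<j)))) ⟩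
          (j + j) · e                            ≡⟨ eq ⟨
          (i + i) · e                            ≈⟨ identityʳ _ ⟨
          (i + i) · e ∙ ε                        ∎))
        where
        open ≈-Reasoning
        arith : ∀ j k → j + j + (k + k) ≡ j + k + (j + k)
        arith = solve-∀

  private
    -- The equation would give (2i + 1) · 2e = 0.
    small-half : ∀ i → i ≤ 26 → ¬ (e ≈ (suc i + suc i) · e)
    small-half i i≤26 e≈ = even-multiple (suc (i + i)) (s≤s z≤n) (≤-trans (s≤s (s≤s (+-mono-≤ i≤26 i≤26))) (≤-trans (m≤m+n 54 17) 70<n)) (∙-cancelˡ (e ∙ e) _ _ (begin
      (e ∙ e) ∙ (suc (i + i) + suc (i + i)) · e      ≈⟨ assoc e e _ ⟩
      (2 + (suc (i + i) + suc (i + i))) · e          ≡⟨ cong (_· e) (arith i) ⟩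
      (suc i + suc i + (suc i + suc i)) · e          ≈⟨ ·-homo-+ e (suc i + suc i) _ ⟩
      (suc i + suc i) · e ∙ (suc i + suc i) · e      ≈⟨ ∙-cong e≈ e≈ ⟨
      e ∙ e                                          ≈⟨ identityʳ _ ⟨
      (e ∙ e) ∙ ε                                    ∎))
      where
      open ≈-Reasoning
      arith : ∀ i → 2 + (suc (i + i) + suc (i + i)) ≡ suc i + suc i + (suc i + suc i)
      arith = solve-∀

    -- For j ≥ 28 there are n - j pairs available, as n ≤ γ + 28. Their sum is - 2j e, so with one
    -- copy of `e` they would form a zero-sum.
    large-half : ∀ j → 28 ≤ j → j < n → ¬ (e ≈ (j + j) · e)
    large-half j 28≤j j<n e≈ =
      let us , vs , eq , _ , σ≈ = pair-multiple (n ∸ j) ps sums k≤γ in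
      zsf e (flat 𝔾 us) (e ∷ flat 𝔾 vs ++ S) (rearrange us vs eq) (trans (∙-cong e≈ σ≈) total≈)
      where
      open ≈-Reasoning
      k≤γ : n ∸ j ≤ γ
      k≤γ = ≤-trans (∸-monoˡ-≤ j large) (≤-trans (∸-monoʳ-≤ (γ + 28) 28≤j) (≤-reflexive (m+n∸n≡m γ 28)))
      rearrange : ∀ us vs → us ++ vs ≡ ps → e ∷ flat 𝔾 us ++ e ∷ flat 𝔾 vs ++ S ↭ T
      rearrange us vs eq = ↭-trans (prep e (↭-trans (shift e (flat 𝔾 us) _) (prep e (↭-reflexive (≡.trans (≡.sym (++-assoc (flat 𝔾 us) _ S))
        (cong (_++ S) (≡.trans (≡.sym (flat-++ 𝔾 us vs)) (cong (flat 𝔾) eq)))))))) perm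
      arith : ∀ j k → j + j + (k + k) ≡ j + k + (j + k)
      arith = solve-∀
      total≈ : (j + j) · e ∙ (n ∸ j + (n ∸ j)) · e ≈ ε
      total≈ = begin
        (j + j) · e ∙ (n ∸ j + (n ∸ j)) · e   ≈⟨ ·-homo-+ e (j + j) _ ⟨
        (j + j + (n ∸ j + (n ∸ j))) · e       ≡⟨ cong (_· e) (≡.trans (arith j (n ∸ j)) (cong₂ _+_ (m+[n∸m]≡n (<⇒≤ j<n)) (m+[n∸m]≡n (<⇒≤ j<n)))) ⟩
        (n + n) · e                           ≈⟨ n+n-torsion ⟩
        ε                                     ∎

    not-half : ∀ j → j < n → ¬ (e ≈ (j + j) · e)
    not-half zero j<n e≈ = zsf e [] (e ∷ flat 𝔾 ps ++ S) perm (trans (identityʳ e) e≈)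
    not-half (suc i) j<n e≈ = case suc i ≤? 27 of λ
      { (yes ≤27) → small-half i (s≤s⁻¹ ≤27) e≈
      ; (no  ≰27) → large-half (suc i) (≰⇒> ≰27) j<n e≈
      }

  e-nontrivial : β e ≢ 𝟎
  e-nontrivial βe = let j , j<n , e≈ = kernel-multiple e βe in not-half j j<n e≈

  opaque
    β-odd : ∀ k → β (suc (k + k) · e) ≡ β e
    β-odd k = ≡.trans (β-∙ e _) (≡.trans (cong (β e ⊞_) (≡.trans (cong β (≈⇒≡ (·-homo-+ e k k))) (≡.trans (β-∙ _ _) (⊞-self _)))) (⊞-identityʳ _))

  opaque
    multiple-nonzero : ∀ c → 1 ≤ c → c < n + n → ¬ (c · e ≈ ε)
    multiple-nonzero c 1≤c c<2n eq with even-or-odd c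
    ... | inj₂ (k , ≡.refl) = e-nontrivial (≡.trans (≡.sym (β-odd k)) (≡.trans (cong β (≈⇒≡ eq)) β-ε))
    ... | inj₁ (zero , ≡.refl) = contradiction 1≤c λ ()
    ... | inj₁ (suc k , ≡.refl) = even-multiple (suc k) (s≤s z≤n) (double-<⁻ c<2n) eq

  context : Context 4
  context = record
    { abelianGroup = abelianGroup
    ; e      = e
    ; p      = quot (β e) ∘ β
    ; p-cong = λ eq → cong (quot (β e) ∘ β) (≈⇒≡ eq)
    ; p-∙    = λ x y → ≡.trans (cong (quot (β e)) (β-∙ x y)) (quot-⊞ (β e) _ _)
    ; p-e    = quot-self (β e)
    ; e-even = even
    ; e-inj  = λ c d c< d< eq → injective c d c< d< eq (<-cmp c d)
    }
    where
    even : ∀ v c → v ∙ v ≈ c · e → ∃[ k ] c ≡ k + k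
    even v c eq with even-or-odd c
    ... | inj₁ even-c = even-c
    ... | inj₂ (k , ≡.refl) = contradiction (≡.trans (≡.sym (β-odd k)) (≡.trans (cong β (≡.sym (≈⇒≡ eq))) (≡.trans (β-∙ v v) (⊞-self _)))) e-nontrivial
    142≤ : 142 ≤ n + n
    142≤ = +-mono-≤ 70<n 70<n
    ordered : ∀ c d → c < d → d < 142 → ¬ (c · e ≈ d · e)
    ordered c d c<d d< eq = multiple-nonzero (d ∸ c) (m<n⇒0<n∸m c<d) (≤-<-trans (m∸n≤m d c) (<-≤-trans d< 142≤))
      (∙-cancelˡ (c · e) _ _ (trans (sym (·-homo-+ e c (d ∸ c))) (trans (reflexive (cong (_· e) (m+[n∸m]≡n (<⇒≤ c<d)))) (trans (sym eq) (sym (identityʳ _))))))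
    injective : ∀ c d → c < 142 → d < 142 → c · e ≈ d · e → _ → c ≡ d
    injective c d c< d< eq (tri< c<d _ _) = contradiction eq (ordered c d c<d d<)
    injective c d c< d< eq (tri≈ _ c≡d _) = c≡d
    injective c d c< d< eq (tri> _ _ d<c) = contradiction (sym eq) (ordered d c d<c c<)

  private
    p : Carrier → F 4
    p = Context.p context

    p-class : ∀ {x y} → β x ≡ β y → p x ≡ p y
    p-class = cong (quot (β e))

  -- The two copies of `e` provide the multiples 1 and 2, and every pair adds 2; so all multiples up
  -- to the number of terms occur.
  reserve : ∀ qs → All (λ q → fuse 𝔾 q ≡ e ∙ e) qs → ∀ c → c < 2 + (length qs + length qs) →
    ∃[ u ] ∃₂ λ us vs → u ∷ us ++ vs ↭ e ∷ e ∷ flat 𝔾 qs × σ (u ∷ us) ≈ suc c · e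
  reserve [] _ 0 _ = e , [] , e ∷ [] , ↭-refl , refl
  reserve [] _ 1 _ = e , e ∷ [] , [] , ↭-refl , refl
  reserve [] _ (suc (suc c)) (s≤s (s≤s ()))
  reserve ((x , y) ∷ qs) (xy ∷ sums) c c< with c <? 2 + (length qs + length qs)
  ... | yes c<′ = let u , us , vs , π , σ≈ = reserve qs sums c c<′ in
    u , us , x ∷ y ∷ vs , ↭-trans (shifts (u ∷ us) (x ∷ y ∷ [])) (↭-trans (prep x (prep y π)) (shifts (x ∷ y ∷ []) (e ∷ e ∷ []))) , σ≈
  reserve ((x , y) ∷ qs) (xy ∷ sums) zero c< | no c≮ = contradiction (s≤s z≤n) c≮
  reserve ((x , y) ∷ qs) (xy ∷ sums) (suc zero) c< | no c≮ = contradiction (s≤s (s≤s z≤n)) c≮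
  reserve ((x , y) ∷ qs) (xy ∷ sums) (suc (suc c)) c< | no _ =
    let u , us , vs , π , σ≈ = reserve qs sums c (s≤s⁻¹ (s≤s⁻¹ (≤-trans c< (≤-reflexive (cong (3 +_) (+-suc (length qs) (length qs))))))) in
    x , y ∷ u ∷ us , vs , ↭-trans (prep x (prep y π)) (shifts (x ∷ y ∷ []) (e ∷ e ∷ [])) ,
      trans (sym (assoc x y _)) (trans (∙-cong (reflexive xy) σ≈) (assoc e e _))

  p-multiple : ∀ z → p z ≡ 𝟎 → ∃[ c ] c < n + n × z ≈ c · e
  p-multiple z pz = case quot-kernel (β e) (β z) e-nontrivial pz of λ
    { (inj₁ βz) → let j , j<n , z≈ = kernel-multiple z βz in j + j , +-mono-< j<n j<n , z≈
    ; (inj₂ βz) → let j , j<n , z≈ = kernel-multiple (z ∙ e ⁻¹) (β-quotient βz) in suc (j + j) ,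
        ≤-trans (s≤s (≤-reflexive (≡.sym (+-suc j j)))) (+-mono-≤ j<n j<n) , (begin
          z                       ≈⟨ identityʳ z ⟨
          z ∙ ε                   ≈⟨ ∙-congˡ (inverseˡ e) ⟨
          z ∙ (e ⁻¹ ∙ e)          ≈⟨ assoc z _ e ⟨
          z ∙ e ⁻¹ ∙ e            ≈⟨ ∙-congʳ z≈ ⟩
          (j + j) · e ∙ e         ≈⟨ comm _ e ⟩
          suc (j + j) · e         ∎)
    }
    where
    open ≈-Reasoning
    β-⁻¹ : β (e ⁻¹) ≡ β e
    β-⁻¹ = ⊞-zero⇒≡ _ _ (≡.trans (≡.sym (β-∙ (e ⁻¹) e)) (≡.trans (cong β (≈⇒≡ (inverseˡ e))) β-ε))
    β-quotient : β z ≡ β e → β (z ∙ e ⁻¹) ≡ 𝟎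
    β-quotient βz = ≡.trans (β-∙ z _) (≡.trans (cong₂ _⊞_ βz β-⁻¹) (⊞-self (β e)))

  module _ {U : List Carrier} (zsf-U : ZeroSumFree′ U) (len-U : length U ≡ 4 + (n + n)) where

    module _ {X qs} (sums-qs : All (λ q → fuse 𝔾 q ≡ e ∙ e) qs) (π : X ++ e ∷ e ∷ flat 𝔾 qs ↭ U) where

      private
        ρ : ℕ
        ρ = 2 + (length qs + length qs)

        lengths : length X + ρ ≡ 4 + (n + n)
        lengths = ≡.trans (cong (length X +_) (cong (2 +_) (≡.sym (length-flat 𝔾 qs)))) (≡.trans (≡.sym (length-++ X)) (≡.trans (↭-length π) len-U))

      -- Otherwise the block could be completed to a zero-sum by the reserve.
      small-weight : ∀ ys zs → ys ++ zs ↭ X → ∀ c → c < n + n → σ ys ≈ c · e → c + ρ < n + n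
      small-weight ys zs ρ′ c c< σ≈ with c + ρ <? n + n
      ... | yes small = small
      ... | no  large = ⊥-elim (absurd (reserve qs sums-qs (n + n ∸ suc c) d<ρ))
        where
        suc-d : suc (n + n ∸ suc c) ≡ n + n ∸ c
        suc-d = ≡.sym (+-∸-assoc 1 c<)
        d<ρ : n + n ∸ suc c < ρ
        d<ρ = ≤-trans (≤-reflexive suc-d) (≤-trans (∸-monoˡ-≤ c (≮⇒≥ large)) (≤-reflexive (m+n∸m≡n c ρ)))
        absurd : (∃[ u ] ∃₂ λ us vs → u ∷ us ++ vs ↭ e ∷ e ∷ flat 𝔾 qs × σ (u ∷ us) ≈ suc (n + n ∸ suc c) · e) → ⊥
        absurd (u , us , vs , π′ , σ-us) = zsf-U u (us ++ ys) (vs ++ zs)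
          (↭-trans (↭-reflexive (++-assoc (u ∷ us) ys (vs ++ zs))) (↭-trans (++⁺ˡ (u ∷ us) (shifts ys vs))
            (↭-trans (↭-reflexive (≡.sym (++-assoc (u ∷ us) vs (ys ++ zs)))) (↭-trans (++⁺ π′ ρ′) (↭-trans (++-comm _ X) π)))))
          (begin
            σ (u ∷ us ++ ys)                 ≈⟨ σ-++ (u ∷ us) ys ⟩
            σ (u ∷ us) ∙ σ ys                ≈⟨ ∙-cong σ-us σ≈ ⟩
            suc (n + n ∸ suc c) · e ∙ c · e  ≈⟨ ·-homo-+ e (suc (n + n ∸ suc c)) c ⟨
            (suc (n + n ∸ suc c) + c) · e    ≡⟨ cong (_· e) (≡.trans (cong (_+ c) suc-d) (m∸n+n≡m (<⇒≤ c<))) ⟩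
            (n + n) · e                      ≈⟨ n+n-torsion ⟩
            ε                                ∎)
          where open ≈-Reasoning

      -- X and the reserve have 2n + 4 terms together, so c + ρ < 2n becomes c + 5 ≤ |X|: this is
      -- the deficiency 5. The bound 75 = 70 + 5 keeps c below 71.
      good-block : length X ≤ 75 → Good context (Qb 5 (length X)) X
      good-block short ys zs ρ′ pys =
        let c , c< , σ≈ = p-multiple (σ ys) pys
            c+5≤ = bound c (small-weight ys zs ρ′ c c< σ≈)
        in c , ≤-trans (≤-trans (≤-reflexive (+-comm 1 c)) (+-cancelʳ-≤ 4 (c + 1) 71 (≤-trans (≤-reflexive (+-assoc c 1 4)) (≤-trans c+5≤ short)))) ≤-refl ,
          σ≈ , (λ 1≤ → positive ys zs ρ′ 1≤ c σ≈) , c+5≤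
        where
        bound : ∀ c → c + ρ < n + n → c + 5 ≤ length X
        bound c c+ρ< = +-cancelʳ-≤ ρ _ _ (≤-trans (≤-reflexive (arith c ρ)) (≤-trans (+-monoʳ-≤ 4 c+ρ<) (≤-reflexive (≡.sym lengths))))
          where
          arith : ∀ c ρ → c + 5 + ρ ≡ 4 + suc (c + ρ)
          arith = solve-∀
        positive : ∀ ys zs → ys ++ zs ↭ X → 1 ≤ length ys → ∀ c → σ ys ≈ c · e → 1 ≤ c
        positive (y ∷ ys) zs ρ′ _ (suc c) _  = s≤s z≤n
        positive (y ∷ ys) zs ρ′ _ zero    eq = ⊥-elim (zsf-U y ys (zs ++ e ∷ e ∷ flat 𝔾 qs)
          (↭-trans (↭-reflexive (≡.sym (++-assoc (y ∷ ys) zs _))) (↭-trans (++⁺ʳ _ ρ′) π)) eq)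

  private
    find-partner : ∀ {x} qs → All (Paired 𝔾) qs → All (λ q → fuse 𝔾 q ≡ e ∙ e) qs → x ∈ flat 𝔾 qs →
      ∃₂ λ x′ rs → β x′ ≡ β x × All (λ q → fuse 𝔾 q ≡ e ∙ e) rs × x ∷ x′ ∷ flat 𝔾 rs ↭ flat 𝔾 qs
    find-partner ((x , y) ∷ qs) (eq ∷ _) (_ ∷ sums) (here ≡.refl) = y , qs , ≡.sym eq , sums , ↭-refl
    find-partner ((x , y) ∷ qs) (eq ∷ _) (_ ∷ sums) (there (here ≡.refl)) = x , qs , eq , sums , swap y x ↭-refl
    find-partner ((x , y) ∷ qs) (_ ∷ eqs) (s ∷ sums) (there (there x∈)) =
      let x′ , rs , eq , sums′ , π = find-partner qs eqs sums x∈ in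
      x′ , (x , y) ∷ rs , eq , s ∷ sums′ , ↭-trans (shifts (_ ∷ x′ ∷ []) (x ∷ y ∷ [])) (prep x (prep y π))

  length-S : length T ≡ 3 + (n + n) → length S ≤ 57
  length-S len = +-cancelˡ-≤ (2 + (γ + γ)) _ _ (begin
    2 + (γ + γ) + length S                ≡⟨ cong (λ k → 2 + k + length S) (length-flat 𝔾 ps) ⟨
    2 + length (flat 𝔾 ps) + length S     ≡⟨ cong (2 +_) (length-++ (flat 𝔾 ps)) ⟨
    length (e ∷ e ∷ flat 𝔾 ps ++ S)       ≡⟨ ↭-length perm ⟩
    length T                              ≡⟨ len ⟩
    3 + (n + n)                           ≤⟨ +-monoʳ-≤ 3 (+-mono-≤ large large) ⟩
    3 + (γ + 28 + (γ + 28))               ≡⟨ arith γ ⟩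
    2 + (γ + γ) + 57                      ∎)
    where
    open ≤-Reasoning
    arith : ∀ γ → 3 + (γ + 28 + (γ + 28)) ≡ 2 + (γ + γ) + 57
    arith = solve-∀

  -- A term of the reserve other than `e` can be moved to X with its partner, because the remaining
  -- pairs still form a reserve, with two terms less.
  extension-shape : length T ≡ 3 + (n + n) → ∀ g → ZeroSumFree′ (g ∷ T) → Shape context (g ∷ T)
  extension-shape len g zsf-U = Shape-resp (shape context (g ∷ S) R
    (good-block zsf-U len-U sums π (≤-trans short (m≤m+n 58 17))) (≤-trans short (m≤m+n 58 12)) partners)
    where
    R : List Carrier
    R = e ∷ e ∷ flat 𝔾 ps
    π : (g ∷ S) ++ R ↭ g ∷ T
    π = prep g (↭-trans (++-comm S R) perm)
    len-U : length (g ∷ T) ≡ 4 + (n + n)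
    len-U = cong suc len
    short : length (g ∷ S) ≤ 58
    short = s≤s (length-S len)
    Shape-resp : Shape context ((g ∷ S) ++ R) → Shape context (g ∷ T)
    Shape-resp s = record { xs = xs′ ; zs = zs ; es = es ; perm = ↭-trans perm′ π ; es≈e = es≈e ; p-code = p-code ; separating = separating ; extra = extra }
      where open Shape s renaming (xs to xs′; perm to perm′)
    partners : ∀ x R′ → x ∷ R′ ↭ R → x ≈ e ⊎ (∃[ x′ ] p x′ ≡ p x × Good context (Qb 5 (2 + length (g ∷ S))) (x ∷ x′ ∷ g ∷ S))
    partners x R′ ρ = case ∈-resp-↭ ρ (here ≡.refl) of λ
      { (here x≡e)         → inj₁ (reflexive x≡e)
      ; (there (here x≡e)) → inj₁ (reflexive x≡e)
      ; (there (there x∈)) → inj₂ (let x′ , rs , eq , sums′ , ρ′ = find-partner ps paired sums x∈ in x′ , p-class eq ,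
          good-block zsf-U len-U {X = x ∷ x′ ∷ g ∷ S} {qs = rs} sums′ (↭-trans (rearrange x x′ rs) (↭-trans (++⁺ˡ (g ∷ S) (prep e (prep e ρ′))) π))
            (s≤s (s≤s (≤-trans short (m≤m+n 58 15)))))
      }
      where
      rearrange : ∀ x x′ rs → (x ∷ x′ ∷ g ∷ S) ++ e ∷ e ∷ flat 𝔾 rs ↭ (g ∷ S) ++ e ∷ e ∷ x ∷ x′ ∷ flat 𝔾 rs
      rearrange x x′ rs = ↭-trans (shifts (x ∷ x′ ∷ []) (g ∷ S)) (++⁺ˡ (g ∷ S) (shifts (x ∷ x′ ∷ []) (e ∷ e ∷ [])))

-- One character for all extensions of T

module _ (K : Context 4) (l : F 4) where
  open Context K

  private
    defect : List Carrier → ℕ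
    defect []       = 0
    defect (x ∷ xs) = (if dot l (p x) then 0 else 1) + defect xs

    defect-↭ : ∀ {xs ys} → xs ↭ ys → defect xs ≡ defect ys
    defect-↭ Perm.refl = ≡.refl
    defect-↭ (prep x π) = cong ((if dot l (p x) then 0 else 1) +_) (defect-↭ π)
    defect-↭ (swap {xs = xs} {ys} x y π) = ≡.trans (arith (f x) (f y) (defect xs)) (cong (λ d → f y + (f x + d)) (defect-↭ π))
      where
      f : Carrier → ℕ
      f x = if dot l (p x) then 0 else 1
      arith : ∀ a b c → a + (b + c) ≡ b + (a + c)
      arith = solve-∀
    defect-↭ (Perm.trans π ρ) = ≡.trans (defect-↭ π) (defect-↭ ρ)

    defect-zero : ∀ {xs} → All (λ x → dot l (p x) ≡ true) xs → defect xs ≡ 0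
    defect-zero []         = ≡.refl
    defect-zero {x ∷ xs} (eq ∷ eqs) rewrite eq = defect-zero eqs

    falses-defect : ∀ {n} (xs : Vec Carrier n) → falses (Vec.map (dot l ∘ p) xs) ≡ defect (toList xs)
    falses-defect []       = ≡.refl
    falses-defect (x ∷ xs) = cong ((if dot l (p x) then 0 else 1) +_) (falses-defect xs)

    dot-sel : ∀ {n} (B : F n) (xs : Vec Carrier n) → dot B (Vec.map (dot l ∘ p) xs) ≡ dot l (vsum p (sel B xs))
    dot-sel []          []       = ≡.sym (dot-𝟎 l)
    dot-sel (true ∷ B)  (x ∷ xs) = ≡.trans (cong (dot l (p x) xor_) (dot-sel B xs)) (≡.sym (dot-⊞ʳ l (p x) _))
    dot-sel (false ∷ B) (x ∷ xs) = dot-sel B xs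

  -- Every one of the seven elements lies in a word of length four, so a functional
  -- that is 1 on the six others is 1 on it too.
  seventh : ∀ (xs : Vec Carrier 7) g Y → toList xs ↭ g ∷ Y → (∀ χ → p (σ (sel (code χ) xs)) ≡ 𝟎) →
    All (λ x → dot l (p x) ≡ true) Y → dot l (p g) ≡ true
  seventh xs g Y π p-code sep-Y with dot l (p g) in lg
  ... | true  = ≡.refl
  ... | false = contradiction (code-separates (Vec.map (dot l ∘ p) xs) one-defect) λ (χ , eq) → true≢false (≡.trans (≡.sym eq) (orthogonal χ))
    where
    true≢false : true ≢ false
    true≢false ()
    one-defect : falses (Vec.map (dot l ∘ p) xs) ≡ 1
    one-defect = ≡.trans (falses-defect xs) (≡.trans (defect-↭ π) (≡.trans (cong (λ b → (if b then 0 else 1) + defect Y) lg) (cong suc (defect-zero sep-Y))))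
    orthogonal : ∀ χ → dot (code χ) (Vec.map (dot l ∘ p) xs) ≡ false
    orthogonal χ = ≡.trans (dot-sel (code χ) xs) (≡.trans (cong (dot l) (≡.trans (≡.sym (p-σ (sel (code χ) xs))) (p-code χ))) (dot-𝟎 l))

module _ {n : ℕ} (𝔾 : Ambient n) {T} (zsf : Ambient.ZeroSumFree′ 𝔾 T) (70<n : 70 < n) (len : length T ≡ 3 + (n + n)) (frame : Frame 𝔾 T) where
  open Ambient 𝔾
  open FrameContext 𝔾 zsf 70<n frame
  open Frame frame using (e)

  private
    K : Context 4
    K = context
    p : Carrier → F 4
    p = Context.p K

    nontrivial? : ∀ x → Dec (x ≢ e)
    nontrivial? x = ¬? (x ≟ᴬ e)

    Y : List Carrier
    Y = filter nontrivial? T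

    p≢𝟎⇒≢e : ∀ {x} → p x ≢ 𝟎 → x ≢ e
    p≢𝟎⇒≢e px≢𝟎 ≡.refl = px≢𝟎 (Context.p-e K)

    separated≢𝟎 : ∀ {l x} → dot l (p x) ≡ true → p x ≢ 𝟎
    separated≢𝟎 {l} lx px≡𝟎 with () ← ≡.trans (≡.sym lx) (≡.trans (cong (dot l) px≡𝟎) (dot-𝟎 l))

    module _ {g : Carrier} (s : Shape K (g ∷ T)) where
      open Shape s

      xs≢𝟎 : All (λ x → p x ≢ 𝟎) (toList xs)
      xs≢𝟎 = All.map (separated≢𝟎 {separating .proj₁}) (separating .proj₂)

      zs≢𝟎 : All (λ z → p z ≢ 𝟎) zs
      zs≢𝟎 = by-extra extra
        where
        by-extra : ∀ {zs} → zs ≡ [] ⊎ (∃[ z ] zs ≡ z ∷ [] × p z ≢ 𝟎 × z ∙ σ (toList xs) ≈ 3 · e) → All (λ z → p z ≢ 𝟎) zs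
        by-extra (inj₁ ≡.refl) = []
        by-extra (inj₂ (z , ≡.refl , pz , _)) = pz ∷ []

      nontrivial-part : toList xs ++ zs ↭ filter nontrivial? (g ∷ T)
      nontrivial-part = ↭-trans (↭-reflexive (≡.sym (begin
        filter nontrivial? (toList xs ++ zs ++ es)                                 ≡⟨ cong (filter nontrivial?) (++-assoc (toList xs) zs es) ⟨
        filter nontrivial? ((toList xs ++ zs) ++ es)                               ≡⟨ filter-++ nontrivial? (toList xs ++ zs) es ⟩
        filter nontrivial? (toList xs ++ zs) ++ filter nontrivial? es              ≡⟨ cong₂ _++_ (filter-all nontrivial? (All.map p≢𝟎⇒≢e (Allₚ.++⁺ xs≢𝟎 zs≢𝟎)))
                                                                                        (filter-none nontrivial? (All.map (λ x≈e x≢e → x≢e (≈⇒≡ x≈e)) es≈e)) ⟩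
        (toList xs ++ zs) ++ []                                                    ≡⟨ ++-identityʳ _ ⟩
        toList xs ++ zs                                                            ∎))) (filter-↭ nontrivial? perm)
        where open ≡.≡-Reasoning

    -- `g ∷ T` has seven or eight terms other than e. As Y is independent of g, its length 6, 7 or 8
    -- restricts every g alike: to a seventh term, to e or an eighth term, or to e.
    data Extension (g : Carrier) : Set where
      repeat : g ≡ e → length Y ≡ 7 ⊎ length Y ≡ 8 → Extension g
      to-seven : length Y ≡ 6 → (s : Shape K (g ∷ T)) → toList (Shape.xs s) ↭ g ∷ Y → Extension g
      to-eight : length Y ≡ 7 → p g ≢ 𝟎 → g ∙ σ Y ≈ 3 · e → Extension g

    extension : ∀ g → ZeroSumFree′ (g ∷ T) → Extension g
    extension g zsf-g = by-cases (extension-shape len g zsf-g) (g ≟ᴬ e)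
      where
      by-cases : Shape K (g ∷ T) → Dec (g ≡ e) → Extension g
      by-cases s (yes g≡e) = repeat g≡e (lengths zs extra (↭-trans (nontrivial-part s) (↭-reflexive (filter-reject nontrivial? λ g≢e → g≢e g≡e))))
        where
        open Shape s
        lengths : ∀ zs → zs ≡ [] ⊎ (∃[ z ] zs ≡ z ∷ [] × p z ≢ 𝟎 × z ∙ σ (toList xs) ≈ 3 · e) → toList xs ++ zs ↭ Y → length Y ≡ 7 ⊎ length Y ≡ 8
        lengths _ (inj₁ ≡.refl) π = inj₁ (≡.trans (≡.sym (↭-length π)) (≡.trans (length-++ (toList xs)) (cong (_+ 0) (Vecₚ.length-toList xs))))
        lengths _ (inj₂ (z , ≡.refl , _)) π = inj₂ (≡.trans (≡.sym (↭-length π)) (≡.trans (length-++ (toList xs)) (cong (_+ 1) (Vecₚ.length-toList xs))))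
      by-cases s (no g≢e) = by-extra zs extra (↭-trans (nontrivial-part s) (↭-reflexive (filter-accept nontrivial? g≢e)))
        (Allₚ.++⁺ (xs≢𝟎 s) (zs≢𝟎 s))
        where
        open Shape s
        by-extra : ∀ zs → zs ≡ [] ⊎ (∃[ z ] zs ≡ z ∷ [] × p z ≢ 𝟎 × z ∙ σ (toList xs) ≈ 3 · e) → toList xs ++ zs ↭ g ∷ Y →
          All (λ z → p z ≢ 𝟎) (toList xs ++ zs) → Extension g
        by-extra _ (inj₁ ≡.refl) π _ = to-seven
          (suc-injective (≡.trans (≡.sym (↭-length π)) (≡.trans (length-++ (toList xs)) (cong (_+ 0) (Vecₚ.length-toList xs))))) s
          (↭-trans (↭-reflexive (≡.sym (++-identityʳ _))) π)
        by-extra _ (inj₂ (z , ≡.refl , _ , total≈)) π nz = to-eight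
          (suc-injective (≡.trans (≡.sym (↭-length π)) (≡.trans (length-++ (toList xs)) (cong (_+ 1) (Vecₚ.length-toList xs)))))
          (All.head (All-resp-↭ π nz)) (trans (sym (σ-↭ π)) (trans (σ-↭ (++-comm (toList xs) (z ∷ []))) total≈))

  Separated : (F 5 → Bool) → Set
  Separated θ = (∀ u v → θ (u ⊞ v) ≡ θ u xor θ v) × (∃[ a ] θ (β a) ≡ true) × (∀ g → ZeroSumFree′ (g ∷ T) → θ (β g) ≡ true)

  private
    via-detect : ∀ l → dot l (β e) ≡ true → (∀ g → ZeroSumFree′ (g ∷ T) → dot l (β g) ≡ true) → Separated (dot l)
    via-detect l le all = dot-⊞ʳ l , (e , le) , all

    8≢7 : 8 ≢ 7
    8≢7 ()
    8≢6 : 8 ≢ 6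
    8≢6 ()
    7≢6 : 7 ≢ 6
    7≢6 ()

    eight-case : length Y ≡ 8 → ∃[ θ ] Separated θ
    eight-case Y≡8 = let l , le = detect (β e) e-nontrivial in dot l , via-detect l le λ g zsf-g → by-extension l le g (extension g zsf-g)
      where
      by-extension : ∀ l → dot l (β e) ≡ true → ∀ g → Extension g → dot l (β g) ≡ true
      by-extension l le g (repeat ≡.refl _)  = le
      by-extension l le g (to-seven Y≡6 _ _)    = contradiction (≡.trans (≡.sym Y≡8) Y≡6) 8≢6
      by-extension l le g (to-eight Y≡7 _ _)  = contradiction (≡.trans (≡.sym Y≡8) Y≡7) 8≢7

    -- The only possible extensions are e and h.
    seven-case : length Y ≡ 7 → ∃[ θ ] Separated θ
    seven-case Y≡7 = case β h ≟ᶠ 𝟎 of λ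
      -- In this case h is not an extension through `to-eight`, because its p-value is 𝟎.
      { (yes βh≡𝟎) → let l , le = detect (β e) e-nontrivial in dot l , via-detect l le λ g zsf-g → by-extension l le g
          (λ g≡h pg≢𝟎 → contradiction (≡.trans (cong p g≡h) (≡.trans (cong (quot (β e)) βh≡𝟎) (quot-𝟎 (β e)))) pg≢𝟎) (extension g zsf-g)
      ; (no βh≢𝟎) → let l , le , lh = detect₂ (β e) (β h) e-nontrivial βh≢𝟎 in dot l , via-detect l le λ g zsf-g → by-extension l le g
          (λ g≡h _ → ≡.trans (cong (dot l ∘ β) g≡h) lh) (extension g zsf-g)
      }
      where
      h : Carrier
      h = 3 · e ∙ σ Y ⁻¹
      solve-h : ∀ {g} → g ∙ σ Y ≈ 3 · e → g ≡ h
      solve-h {g} eq = ≈⇒≡ (begin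
        g                    ≈⟨ identityʳ g ⟨
        g ∙ ε                ≈⟨ ∙-congˡ (inverseʳ (σ Y)) ⟨
        g ∙ (σ Y ∙ σ Y ⁻¹)   ≈⟨ assoc g _ _ ⟨
        g ∙ σ Y ∙ σ Y ⁻¹     ≈⟨ ∙-congʳ eq ⟩
        h                    ∎)
        where open ≈-Reasoning
      by-extension : ∀ l → dot l (β e) ≡ true → ∀ g → (g ≡ h → p g ≢ 𝟎 → dot l (β g) ≡ true) → Extension g → dot l (β g) ≡ true
      by-extension l le g f (repeat ≡.refl _)       = le
      by-extension l le g f (to-seven Y≡6 _ _)         = contradiction (≡.trans (≡.sym Y≡7) Y≡6) 7≢6
      by-extension l le g f (to-eight _ pg≢𝟎 eq)     = f (solve-h eq) pg≢𝟎

    -- The functional of one extension is 1 on the six terms of Y. These belong to the seven of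
    -- every other extension, so `seventh` forces the value 1 there as well; with six terms, e is
    -- not an extension.
    six-case : ∀ g → ZeroSumFree′ (g ∷ T) → length Y ≡ 6 → (s : Shape K (g ∷ T)) → toList (Shape.xs s) ↭ g ∷ Y → ∃[ θ ] Separated θ
    six-case g₀ zsf₀ Y≡6 s₀ π₀ = dot l ∘ quot (β e) , additive , (g₀ , head-true (All-resp-↭ π₀ sep₀)) , λ g zsf-g → by-extension g (extension g zsf-g)
      where
      l : F 4
      l = Shape.separating s₀ .proj₁
      sep₀ : All (λ x → dot l (p x) ≡ true) (toList (Shape.xs s₀))
      sep₀ = Shape.separating s₀ .proj₂
      head-true : All (λ x → dot l (p x) ≡ true) (g₀ ∷ Y) → dot l (p g₀) ≡ true
      head-true (eq ∷ _) = eq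
      tail-true : All (λ x → dot l (p x) ≡ true) (g₀ ∷ Y) → All (λ x → dot l (p x) ≡ true) Y
      tail-true (_ ∷ eqs) = eqs
      additive : ∀ u v → dot l (quot (β e) (u ⊞ v)) ≡ dot l (quot (β e) u) xor dot l (quot (β e) v)
      additive u v = ≡.trans (cong (dot l) (quot-⊞ (β e) u v)) (dot-⊞ʳ l _ _)
      by-extension : ∀ g → Extension g → dot l (p g) ≡ true
      by-extension g (repeat _ (inj₁ Y≡7)) = contradiction (≡.trans (≡.sym Y≡7) Y≡6) 7≢6
      by-extension g (repeat _ (inj₂ Y≡8)) = contradiction (≡.trans (≡.sym Y≡8) Y≡6) 8≢6
      by-extension g (to-seven _ s π)         = seventh K l (Shape.xs s) g Y π (Shape.p-code s) (tail-true (All-resp-↭ π₀ sep₀))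
      by-extension g (to-eight Y≡7 _ _)     = contradiction (≡.trans (≡.sym Y≡7) Y≡6) 7≢6

  -- If T has no extension, any nontrivial character serves; otherwise a single extension already
  -- determines which case T belongs to.
  separation : (∃[ g ] ZeroSumFree′ (g ∷ T)) ⊎ (∀ g → ¬ ZeroSumFree′ (g ∷ T)) → ∃[ θ ] Separated θ
  separation (inj₂ none) = let l , le = detect (β e) e-nontrivial in dot l , via-detect l le λ g zsf-g → contradiction zsf-g (none g)
  separation (inj₁ (g , zsf-g)) = by-extension (extension g zsf-g)
    where
    by-extension : Extension g → ∃[ θ ] Separated θ
    by-extension (repeat _ (inj₁ Y≡7)) = seven-case Y≡7
    by-extension (repeat _ (inj₂ Y≡8)) = eight-case Y≡8
    by-extension (to-seven Y≡6 s π)       = six-case g zsf-g Y≡6 s π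
    by-extension (to-eight Y≡7 _ _)     = seven-case Y≡7

-- The group C₂⁴ ⊕ C₂ₙ

parity-of : ℕ → Bool
parity-of zero    = false
parity-of (suc k) = not (parity-of k)

parity-+ : ∀ j k → parity-of (j + k) ≡ parity-of j xor parity-of k
parity-+ zero    k = ≡.refl
parity-+ (suc j) k = ≡.trans (cong not (parity-+ j k)) (Boolₚ.not-distribˡ-xor (parity-of j) (parity-of k))

parity-double : ∀ k → parity-of (k + k) ≡ false
parity-double k = ≡.trans (parity-+ k k) (xor-same (parity-of k))

even-half : ∀ k → parity-of k ≡ false → ⌊ k /2⌋ + ⌊ k /2⌋ ≡ k
even-half zero          _  = ≡.refl
even-half (suc (suc k)) eq = cong suc (≡.trans (+-suc _ _) (cong suc (even-half k (≡.trans (≡.sym (Boolₚ.not-involutive (parity-of k))) eq))))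

half-< : ∀ k n → k < n + n → ⌊ k /2⌋ < n
half-< zero          (suc n) _  = s≤s z≤n
half-< (suc zero)    (suc n) _  = s≤s z≤n
half-< (suc (suc k)) (suc n) lt = s≤s (half-< k n (s≤s⁻¹ (s≤s⁻¹ (≤-trans lt (≤-reflexive (cong suc (+-suc n n)))))))

lookup-distinct : ∀ {A : Set} {xs : List A} → AllPairs _≢_ xs → ∀ {i j} → i Fin.< j → List.lookup xs i ≢ List.lookup xs j
lookup-distinct (x≢ ∷ distinct) {Fin.zero}  {Fin.suc j} _         = All.lookup x≢ (∈-lookup j)
lookup-distinct (x≢ ∷ distinct) {Fin.suc i} {Fin.suc j} (s≤s i<j) = lookup-distinct distinct i<j

module Group (n : ℕ) .{{_ : NonZero n}} where

  instance
    2n≢0 : NonZero (2 * n)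
    2n≢0 = m*n≢0 2 n

  G : AbelianGroup 0ℓ 0ℓ
  G = (C 2 ⊕ C 2 ⊕ C 2 ⊕ C 2) ⊕ C (2 * n) {{m*n≢0 2 n}}

  open AbelianGroup G
  open Sum G

  bit : Fin 2 → Bool
  bit Fin.zero    = false
  bit (Fin.suc _) = true

  bits : Carrier → F 4
  bits ((a , b , c , d) , _) = bit a ∷ bit b ∷ bit c ∷ bit d ∷ []

  residue : Carrier → ℕ
  residue (_ , x) = toℕ x

  bit-+ : ∀ i j → bit (AbelianGroup._∙_ (C 2) i j) ≡ bit i xor bit j
  bit-+ Fin.zero           Fin.zero           = ≡.refl
  bit-+ Fin.zero           (Fin.suc Fin.zero) = ≡.refl
  bit-+ (Fin.suc Fin.zero) Fin.zero           = ≡.refl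
  bit-+ (Fin.suc Fin.zero) (Fin.suc Fin.zero) = ≡.refl

  bits-∙ : ∀ x y → bits (x ∙ y) ≡ bits x ⊞ bits y
  bits-∙ ((a , b , c , d) , _) ((a′ , b′ , c′ , d′) , _) =
    cong₂ _∷_ (bit-+ a a′) (cong₂ _∷_ (bit-+ b b′) (cong₂ _∷_ (bit-+ c c′) (cong (_∷ []) (bit-+ d d′))))

  residue-∙ : ∀ x y → residue (x ∙ y) ≡ (residue x + residue y) % (2 * n)
  residue-∙ (_ , x) (_ , y) = Finₚ.toℕ-fromℕ< (m%n<n (toℕ x + toℕ y) (2 * n))

  parity-% : ∀ k → parity-of (k % (2 * n)) ≡ parity-of k
  parity-% k = ≡.sym (≡.trans (cong parity-of (m≡m%n+[m/n]*n k (2 * n))) (≡.trans (parity-+ (k % (2 * n)) _)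
    (≡.trans (cong (parity-of (k % (2 * n)) xor_) (≡.trans (cong parity-of (arith (k / (2 * n)) n)) (parity-double (k / (2 * n) * n)))) (Boolₚ.xor-identityʳ _))))
    where
    arith : ∀ q n → q * (2 * n) ≡ q * n + q * n
    arith = solve-∀

  β : Carrier → F 5
  β x = parity-of (residue x) ∷ bits x

  β-∙ : ∀ x y → β (x ∙ y) ≡ β x ⊞ β y
  β-∙ x y = cong₂ _∷_ (≡.trans (cong parity-of (residue-∙ x y)) (≡.trans (parity-% (residue x + residue y)) (parity-+ (residue x) _))) (bits-∙ x y)

  ≈⇒≡ : ∀ {x y} → x ≈ y → x ≡ y
  ≈⇒≡ ((≡.refl , ≡.refl , ≡.refl , ≡.refl) , ≡.refl) = ≡.refl

  _≟ᴳ_ : (x y : Carrier) → Dec (x ≡ y)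
  _≟ᴳ_ = Productₚ.≡-dec (Productₚ.≡-dec Finₚ._≟_ (Productₚ.≡-dec Finₚ._≟_ (Productₚ.≡-dec Finₚ._≟_ Finₚ._≟_))) Finₚ._≟_

  any-element? : ∀ {P : Carrier → Set} → (∀ x → Dec (P x)) → Dec (∃ P)
  any-element? P? = map′ (λ { (a , b , c , d , x , px) → ((a , b , c , d) , x) , px }) (λ { (((a , b , c , d) , x) , px) → a , b , c , d , x , px })
    (Finₚ.any? λ a → Finₚ.any? λ b → Finₚ.any? λ c → Finₚ.any? λ d → Finₚ.any? λ x → P? ((a , b , c , d) , x))

  determined : ∀ {x y} → bits x ≡ bits y → residue x ≡ residue y → x ≡ y
  determined {(a , b , c , d) , x} {(a′ , b′ , c′ , d′) , y} bits≡ residue≡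
    with Vecₚ.∷-injective bits≡
  ... | a≡ , bits₁ with Vecₚ.∷-injective bits₁
  ... | b≡ , bits₂ with Vecₚ.∷-injective bits₂
  ... | c≡ , bits₃ with Vecₚ.∷-injective bits₃
  ... | d≡ , _ = cong₂ _,_ (cong₂ _,_ (bit-injective a≡) (cong₂ _,_ (bit-injective b≡) (cong₂ _,_ (bit-injective c≡) (bit-injective d≡)))) (Finₚ.toℕ-injective residue≡)
    where
    bit-injective : ∀ {i j} → bit i ≡ bit j → i ≡ j
    bit-injective {Fin.zero}         {Fin.zero}         _ = ≡.refl
    bit-injective {Fin.suc Fin.zero} {Fin.suc Fin.zero} _ = ≡.refl

  residue-σ : ∀ xs → residue (σ xs) ≡ ℕsum (map residue xs) % (2 * n)
  residue-σ []       = Finₚ.toℕ-fromℕ< (m%n<n 0 (2 * n))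
  residue-σ (x ∷ xs) = ≡.trans (residue-∙ x (σ xs)) (≡.trans (cong (λ k → (residue x + k) % (2 * n)) (residue-σ xs))
    (≡.trans (%-distribˡ-+ (residue x) _ (2 * n)) (≡.trans (cong (λ k → (residue x % (2 * n) + k) % (2 * n)) (m%n%n≡m%n _ (2 * n)))
      (≡.sym (%-distribˡ-+ (residue x) _ (2 * n))))))

  bits-σ : ∀ xs → bits (σ xs) ≡ vsum bits xs
  bits-σ []       = ≡.refl
  bits-σ (x ∷ xs) = ≡.trans (bits-∙ x (σ xs)) (cong (bits x ⊞_) (bits-σ xs))

  residue-< : ∀ x → residue x < n + n
  residue-< (_ , x) = ≤-trans (Finₚ.toℕ<n x) (≤-reflexive (cong (n +_) (+-identityʳ n)))

  ambient : Ambient n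
  ambient = record
    { abelianGroup   = G
    ; ≈⇒≡            = ≈⇒≡
    ; _≟ᴬ_           = _≟ᴳ_
    ; β              = β
    ; β-∙            = β-∙
    ; kernel-size    = kernel-size
    ; kernel-torsion = kernel-torsion
    }
    where
    -- Kernel elements have zero bits and even residue, so half the residue, a number below n,
    -- determines them.
    kernel-size : ∀ xs → AllPairs _≢_ xs → All (λ x → β x ≡ 𝟎) xs → length xs ≤ n
    kernel-size xs distinct kernel with length xs ≤? n
    ... | yes ≤n = ≤n
    ... | no  ≰n = ⊥-elim (collision (Finₚ.pigeonhole (≰⇒> ≰n) λ i → fromℕ< (half-< (residue (List.lookup xs i)) n (residue-< (List.lookup xs i)))))
      where
      kernel-at : ∀ i → β (List.lookup xs i) ≡ 𝟎
      kernel-at i = All.lookup kernel (∈-lookup i)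
      residue≡ : ∀ i → ⌊ residue (List.lookup xs i) /2⌋ + ⌊ residue (List.lookup xs i) /2⌋ ≡ residue (List.lookup xs i)
      residue≡ i = even-half _ (Vecₚ.∷-injective (kernel-at i) .proj₁)
      collision : _ → ⊥
      collision (i , j , i<j , eq) = lookup-distinct distinct i<j (determined
        (≡.trans (Vecₚ.∷-injective (kernel-at i) .proj₂) (≡.sym (Vecₚ.∷-injective (kernel-at j) .proj₂)))
        (≡.trans (≡.sym (residue≡ i)) (≡.trans (cong (λ k → k + k) (≡.trans (≡.sym (Finₚ.toℕ-fromℕ< _)) (≡.trans (cong toℕ eq) (Finₚ.toℕ-fromℕ< _)))) (residue≡ j))))
    kernel-torsion : ∀ x → β x ≡ 𝟎 → n · x ≈ ε
    kernel-torsion x βx = reflexive (determined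
      (≡.trans (bits-σ (List.replicate n x)) (≡.trans (bits-zero n) ≡.refl))
      (≡.trans (residue-σ (List.replicate n x)) (≡.trans (cong (_% (2 * n)) (sum-replicate n))
        (≡.trans (cong (_% (2 * n)) (≡.trans (cong (n *_) (≡.sym (even-half (residue x) (Vecₚ.∷-injective βx .proj₁)))) (arith n ⌊ residue x /2⌋)))
          (≡.trans (m*n%n≡0 ⌊ residue x /2⌋ (2 * n)) (≡.sym (≡.trans (Finₚ.toℕ-fromℕ< (m%n<n 0 (2 * n))) (m*n%n≡0 0 (2 * n)))))))))
      where
      arith : ∀ n k → n * (k + k) ≡ k * (2 * n)
      arith = solve-∀
      bits-zero : ∀ k → vsum bits (List.replicate k x) ≡ 𝟎
      bits-zero zero    = ≡.refl
      bits-zero (suc k) = ≡.trans (cong₂ _⊞_ (Vecₚ.∷-injective βx .proj₂) (bits-zero k)) (⊞-self 𝟎)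
      sum-replicate : ∀ k → ℕsum (map residue (List.replicate k x)) ≡ k * residue x
      sum-replicate zero    = ≡.refl
      sum-replicate (suc k) = cong (residue x +_) (sum-replicate k)

-- From extensions to missed elements, and the extremal sequence

⊆-++⁻ : ∀ (xs : List E) {ys zs} → zs ⊆ xs ++ ys → ∃₂ λ us vs → zs ≡ us ++ vs × us ⊆ xs × vs ⊆ ys
⊆-++⁻ [] s = [] , _ , ≡.refl , [] , s
⊆-++⁻ (x ∷ xs) (.x ∷ʳ s) = let us , vs , eq , s₁ , s₂ = ⊆-++⁻ xs s in us , vs , eq , x ∷ʳ s₁ , s₂
⊆-++⁻ (x ∷ xs) (≡.refl ∷ s) = let us , vs , eq , s₁ , s₂ = ⊆-++⁻ xs s in x ∷ us , vs , cong (x ∷_) eq , ≡.refl ∷ s₁ , s₂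

⊆-replicate : ∀ {x : E} k {us} → us ⊆ replicate k x → ∃[ c ] c ≤ k × us ≡ replicate c x
⊆-replicate zero    [] = 0 , z≤n , ≡.refl
⊆-replicate (suc k) (_ ∷ʳ s) = let c , c≤k , eq = ⊆-replicate k s in c , m≤n⇒m≤1+n c≤k , eq
⊆-replicate (suc k) (≡.refl ∷ s) = let c , c≤k , eq = ⊆-replicate k s in suc c , s≤s c≤k , cong (_ ∷_) eq

Σ-mono : ∀ (G : AbelianGroup 0ℓ 0ℓ) {S T g} → S ⊆ T → Σ G S g → Σ G T g
Σ-mono G S⊆T (R , R⊆S , R≢[] , eq) = R , ⊆-trans R⊆S S⊆T , R≢[] , eq

module _ (G : AbelianGroup 0ℓ 0ℓ) where
  open AbelianGroup G
  open AbelianGroupProperties G using (⁻¹-∙-comm; ⁻¹-involutive)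
  open Relation.Binary.Reasoning.Setoid setoid
  module Solver = CommutativeMonoidSolver commutativeMonoid
  open Solver using (solve; _⊜_) renaming (_⊕_ to _⊙_)

  private
    flip-sign : ∀ {x y} → x ≈ y ⁻¹ → y ∙ x ≈ ε
    flip-sign {x} {y} eq = trans (∙-congˡ eq) (inverseʳ y)

  -- The three elements −u, −v, −(u + v) are missed by Σ T, but no coset of a
  -- subgroup other than the subgroup itself contains all of them.
  two-extensions-absurd : ∀ {u v T H} → ZeroSumFree G (u ∷ v ∷ T) → IsSubgroup G H → ¬ MissesOnlyCoset G T H
  two-extensions-absurd {u} {v} {T} {H} zsf H-subgroup (α , α∉H , misses) =
    let h₁ , h₁∈ , u≈ = misses (negative-missed (u ∷ []) (λ ()) (≡.refl ∷ (v ∷ʳ ⊆-refl)))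
        h₂ , h₂∈ , v≈ = misses (negative-missed (v ∷ []) (λ ()) (u ∷ʳ ⊆-refl))
        h₃ , h₃∈ , uv≈ = misses (negative-missed (u ∷ v ∷ []) (λ ()) ⊆-refl)
    in α∉H (resp-≈ (α-value h₁ h₂ h₃ u≈ v≈ uv≈) (+-closed h₃∈ (neg-closed (+-closed h₁∈ h₂∈))))
    where
    open IsSubgroup H-subgroup
    negative-missed : ∀ S → S ≢ [] → S ++ T ⊆ u ∷ v ∷ T → (G• G ∖ Σ G T) ((sum G S) ⁻¹)
    negative-missed S S≢[] S++T⊆ = (λ eq → zsf (S , ⊆-trans (⊆-++ʳ T ⊆-refl) S++T⊆ , S≢[] ,
        trans (sym (identityʳ _)) (trans (∙-congˡ (sym eq)) (inverseʳ _))))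
      , λ (R , R⊆T , _ , eq) → zsf (S ++ R , ⊆-trans (++-mono S R⊆T) S++T⊆ , nonempty S S≢[] ,
          trans (sum-++ᴳ S R) (flip-sign eq))
      where
      nonempty : ∀ S {R} → S ≢ [] → S ++ R ≢ []
      nonempty []      S≢[] _ = S≢[] ≡.refl
      nonempty (_ ∷ _) _    ()
      ++-mono : ∀ (S : List Carrier) {R T} → R ⊆ T → S ++ R ⊆ S ++ T
      ++-mono []      s = s
      ++-mono (x ∷ S) s = ≡.refl ∷ ++-mono S s
      sum-++ᴳ : ∀ S R → sum G (S ++ R) ≈ sum G S ∙ sum G R
      sum-++ᴳ = Sum.σ-++ G
    α-value : ∀ h₁ h₂ h₃ → (u ∙ ε) ⁻¹ ≈ α ∙ h₁ → (v ∙ ε) ⁻¹ ≈ α ∙ h₂ → (u ∙ (v ∙ ε)) ⁻¹ ≈ α ∙ h₃ → h₃ ∙ (h₁ ∙ h₂) ⁻¹ ≈ α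
    α-value h₁ h₂ h₃ u≈ v≈ uv≈ = begin
      h₃ ∙ (h₁ ∙ h₂) ⁻¹                        ≈⟨ ∙-congʳ h₃≈ ⟩
      (α ∙ (h₁ ∙ h₂)) ∙ (h₁ ∙ h₂) ⁻¹           ≈⟨ assoc α _ _ ⟩
      α ∙ ((h₁ ∙ h₂) ∙ (h₁ ∙ h₂) ⁻¹)           ≈⟨ ∙-congˡ (inverseʳ _) ⟩
      α ∙ ε                                    ≈⟨ identityʳ α ⟩
      α                                        ∎
      where
      open AbelianGroupProperties G using (∙-cancelˡ)
      h₃≈ : h₃ ≈ α ∙ (h₁ ∙ h₂)
      h₃≈ = ∙-cancelˡ α _ _ (begin
        α ∙ h₃                        ≈⟨ uv≈ ⟨
        (u ∙ (v ∙ ε)) ⁻¹              ≈⟨ ⁻¹-cong (∙-congʳ (sym (identityʳ u))) ⟩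
        ((u ∙ ε) ∙ (v ∙ ε)) ⁻¹        ≈⟨ ⁻¹-∙-comm _ _ ⟨
        (u ∙ ε) ⁻¹ ∙ (v ∙ ε) ⁻¹       ≈⟨ ∙-cong u≈ v≈ ⟩
        (α ∙ h₁) ∙ (α ∙ h₂)           ≈⟨ solve 3 (λ a h k → (a ⊙ h) ⊙ (a ⊙ k) ⊜ a ⊙ (a ⊙ (h ⊙ k))) refl α h₁ h₂ ⟩
        α ∙ (α ∙ (h₁ ∙ h₂))           ∎)

  -- A zero-sum through - g would make g zero or exhibit g as a sum over T.
  negative-extension : ∀ {T g} → ZeroSumFree G T → ¬ (g ≈ ε) → ¬ Σ G T g → ZeroSumFree G (g ⁻¹ ∷ T)
  negative-extension zsf g≉0 g∉Σ (S , (_ ∷ʳ S⊆T) , S≢[] , eq) = zsf (S , S⊆T , S≢[] , eq)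
  negative-extension {g = g} zsf g≉0 g∉Σ (_ ∷ [] , (≡.refl ∷ _) , _ , eq) = g≉0 (begin
    g               ≈⟨ identityʳ g ⟨
    g ∙ ε           ≈⟨ ∙-congˡ (trans (sym eq) (identityʳ (g ⁻¹))) ⟩
    g ∙ g ⁻¹        ≈⟨ inverseʳ g ⟩
    ε               ∎)
  negative-extension {g = g} zsf g≉0 g∉Σ (_ ∷ R@(_ ∷ _) , (≡.refl ∷ R⊆T) , _ , eq) = g∉Σ (R , R⊆T , (λ ()) , (begin
    sum G R                  ≈⟨ identityˡ _ ⟨
    ε ∙ sum G R              ≈⟨ ∙-congʳ (inverseʳ g) ⟨
    (g ∙ g ⁻¹) ∙ sum G R     ≈⟨ assoc g _ _ ⟩
    g ∙ (g ⁻¹ ∙ sum G R)     ≈⟨ ∙-congˡ eq ⟩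
    g ∙ ε                    ≈⟨ identityʳ g ⟩
    g                        ∎))

module Main (n : ℕ) .{{_ : NonZero n}} (70<n : n > 70) where
  open Group n
  open AbelianGroup G
  open Sum G
  open Ambient ambient using (ZeroSumFree′; β-ε)

  to : ∀ {T} → ZeroSumFree G T → ZeroSumFree′ T
  to zsf y ys zs π σ≈ε with ↭⇒⊆ (y ∷ ys) zs π
  ... | S , S⊆T , ρ = zsf (S , S⊆T , nonempty , trans (σ-↭ (↭-sym ρ)) σ≈ε)
    where
    nonempty : S ≢ []
    nonempty ≡.refl with () ← ↭-empty-inv ρ

  from : ∀ {T} → ZeroSumFree′ T → ZeroSumFree G T
  from zsf ([] , S⊆T , S≢[] , eq) = S≢[] ≡.refl
  from zsf (y ∷ ys , S⊆T , _ , eq) = let zs , π = ⊆⇒↭ S⊆T in zsf y ys zs π eq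

  zero-sum-free? : ∀ T → Dec (ZeroSumFree′ T)
  zero-sum-free? T with search-⊆ T (λ ys → ys ≡ [] ⊎ σ ys ≢ ε) (λ ys → ys ≢ [] × σ ys ≡ ε) decide
    where
    decide : ∀ ys → ys ⊆ T → (ys ≡ [] ⊎ σ ys ≢ ε) ⊎ (ys ≢ [] × σ ys ≡ ε)
    decide [] _ = inj₁ (inj₁ ≡.refl)
    decide (y ∷ ys) _ with σ (y ∷ ys) ≟ᴳ ε
    ... | yes eq = inj₂ ((λ ()) , eq)
    ... | no  ne = inj₁ (inj₂ ne)
  ... | inj₁ free = yes (to λ (S , S⊆T , S≢[] , eq) → case free S S⊆T of λ
          { (inj₁ S≡[]) → S≢[] S≡[] ; (inj₂ ne) → ne (≈⇒≡ eq) })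
  ... | inj₂ (S , S⊆T , S≢[] , eq) = no λ zsf → from zsf (S , S⊆T , S≢[] , reflexive eq)

  module _ (θ : F 5 → Bool) (θ-⊞ : ∀ u v → θ (u ⊞ v) ≡ θ u xor θ v) (a : Carrier) (θa : θ (β a) ≡ true) where

    private
      χ : Carrier → Bool
      χ x = θ (β x)

      χ-∙ : ∀ x y → χ (x ∙ y) ≡ χ x xor χ y
      χ-∙ x y = ≡.trans (cong θ (β-∙ x y)) (θ-⊞ _ _)

      χ-ε : χ ε ≡ false
      χ-ε = ≡.trans (≡.sym (xor-cancel (χ ε))) (≡.trans (cong (_xor χ ε) (≡.trans (≡.sym (χ-∙ ε ε)) (cong χ (≈⇒≡ (identityˡ ε))))) (xor-same (χ ε)))
        where
        xor-cancel : ∀ b → (b xor b) xor b ≡ b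
        xor-cancel true  = ≡.refl
        xor-cancel false = ≡.refl

      χ-⁻¹ : ∀ x → χ (x ⁻¹) ≡ χ x
      χ-⁻¹ x = equal (χ (x ⁻¹)) (χ x) (≡.trans (≡.sym (χ-∙ (x ⁻¹) x)) (≡.trans (cong χ (≈⇒≡ (inverseˡ x))) χ-ε))
        where
        equal : ∀ b c → b xor c ≡ false → b ≡ c
        equal true  true  _ = ≡.refl
        equal false false _ = ≡.refl

    Kernel : Pred Carrier 0ℓ
    Kernel x = χ x ≡ false

    private
      coset : ∀ {x y} → χ x ≡ χ y → Coset G x Kernel y
      coset {x} {y} eq = x ⁻¹ ∙ y , ≡.trans (χ-∙ _ y) (≡.trans (cong₂ _xor_ (≡.trans (χ-⁻¹ x) eq) ≡.refl) (xor-same (χ y))) ,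
        sym (trans (sym (assoc x _ y)) (trans (∙-congʳ (inverseʳ x)) (identityˡ y)))

      coset⁻ : ∀ {x y} → Coset G x Kernel y → χ y ≡ χ x
      coset⁻ {x} {y} (h , χh , eq) = ≡.trans (cong χ (≈⇒≡ eq)) (≡.trans (χ-∙ x h) (≡.trans (cong (χ x xor_) χh) (Boolₚ.xor-identityʳ (χ x))))

    kernel-subgroup : IsSubgroup G Kernel
    kernel-subgroup = record
      { resp-≈     = λ eq χx → ≡.trans (cong χ (≡.sym (≈⇒≡ eq))) χx
      ; 0-closed   = χ-ε
      ; +-closed   = λ {x} {y} χx χy → ≡.trans (χ-∙ x y) (cong₂ _xor_ χx χy)
      ; neg-closed = λ {x} χx → ≡.trans (χ-⁻¹ x) χx
      }

    kernel-index : HasIndex G Kernel 2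
    kernel-index = representative , λ g → choose g (χ g) ≡.refl
      where
      representative : Fin 2 → Carrier
      representative Fin.zero    = ε
      representative (Fin.suc _) = a
      χ-rep : ∀ i → χ (representative i) ≡ bit i
      χ-rep Fin.zero    = χ-ε
      χ-rep (Fin.suc _) = θa
      bit-injective : ∀ {i j} → bit i ≡ bit j → i ≡ j
      bit-injective {Fin.zero}         {Fin.zero}         _ = ≡.refl
      bit-injective {Fin.suc Fin.zero} {Fin.suc Fin.zero} _ = ≡.refl
      choose : ∀ g b → χ g ≡ b → ∃ λ i → Coset G (representative i) Kernel g × (∀ {j} → Coset G (representative j) Kernel g → i ≡ j)
      choose g b χg = let i , bi = index b in i , coset (≡.trans (χ-rep i) (≡.trans bi (≡.sym χg))) ,
        λ {j} g∈ → bit-injective (≡.trans bi (≡.trans (≡.sym χg) (≡.trans (coset⁻ g∈) (χ-rep j))))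
        where
        index : ∀ b → ∃[ i ] bit i ≡ b
        index false = Fin.zero , ≡.refl
        index true  = Fin.suc Fin.zero , ≡.refl

    kernel-proper : Kernel ⊂ U
    kernel-proper = _ , λ all → contradiction (≡.trans (≡.sym θa) (all {a} _)) λ ()

    kernel-misses : ∀ {T} → ZeroSumFree G T → (∀ g → ZeroSumFree′ (g ∷ T) → χ g ≡ true) → MissesOnlyCoset G T Kernel
    kernel-misses {T} zsf extensions = a , (λ χa → contradiction (≡.trans (≡.sym θa) χa) λ ()) , λ {g} (g≉0 , g∉Σ) →
      coset (≡.trans θa (≡.sym (≡.trans (≡.sym (χ-⁻¹ g)) (extensions (g ⁻¹) (to (negative-extension G zsf g≉0 g∉Σ))))))

  missed-coset : ∀ T → ZeroSumFree G T → length T ≡ 3 + (n + n) →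
    ∃[ H ] IsSubgroup G H × HasIndex G H 2 × H ⊂ U × MissesOnlyCoset G T H
  missed-coset T zsf len = from-character (separation ambient (to zsf) 70<n len (frame-exists ambient (to zsf) 70<n len) extendable)
    where
    extendable : (∃[ g ] ZeroSumFree′ (g ∷ T)) ⊎ (∀ g → ¬ ZeroSumFree′ (g ∷ T))
    extendable = case any-element? (λ g → zero-sum-free? (g ∷ T)) of λ
      { (yes found) → inj₁ found ; (no none) → inj₂ λ g zsf-g → none (g , zsf-g) }
    from-character : (∃[ θ ] (∀ u v → θ (u ⊞ v) ≡ θ u xor θ v) × (∃[ a ] θ (β a) ≡ true) × (∀ g → ZeroSumFree′ (g ∷ T) → θ (β g) ≡ true)) →
      ∃[ H ] IsSubgroup G H × HasIndex G H 2 × H ⊂ U × MissesOnlyCoset G T H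
    from-character (θ , θ-⊞ , (a , θa) , extensions) = Kernel θ θ-⊞ a θa , kernel-subgroup θ θ-⊞ a θa ,
      kernel-index θ θ-⊞ a θa , kernel-proper θ θ-⊞ a θa , kernel-misses θ θ-⊞ a θa zsf extensions

  -- A prefix of length 2n + 3 suffices, because a longer sequence misses no further elements.
  long-missed-coset : ∀ T → ZeroSumFree G T → length T ≥ 3 + (n + n) →
    ∃[ H ] IsSubgroup G H × HasIndex G H 2 × H ⊂ U × MissesOnlyCoset G T H
  long-missed-coset T zsf long =
    let ys , zs , ys++zs≡T , len = prefix (3 + (n + n)) T long
        ys⊆T = subst (ys ⊆_) ys++zs≡T (⊆-++ʳ zs ⊆-refl)
        H , subgroup , index , proper , α , α∉H , misses = missed-coset ys (zsf ∘ Σ-mono G ys⊆T) len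
    in H , subgroup , index , proper , α , α∉H , λ (g≉0 , g∉Σ) → misses (g≉0 , g∉Σ ∘ Σ-mono G ys⊆T)

  -- e^(2n − 3) together with seven elements of the form (l , 1 , (n + 1) / 2).
  module Example (k : ℕ) (n≡ : n ≡ suc (k + k)) where

    private
      m : ℕ
      m = 2 * n

      1<m : 1 < m
      1<m = ≤-trans (s≤s (s≤s z≤n)) (≤-trans 70<n (m≤m+n n (n + 0)))

      k<m : suc k < m
      k<m = ≤-trans (s≤s (s≤s (m≤m+n k k))) (≤-trans (≤-reflexive (≡.trans (cong suc (≡.sym n≡)) (+-comm 1 n)))
        (+-monoʳ-≤ n (≤-trans (s≤s z≤n) (≤-trans 70<n (≤-reflexive (≡.sym (+-identityʳ n)))))))

      residue-mod : ∀ j → j < m → toℕ (j mod m) ≡ j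
      residue-mod j j<m = ≡.trans (Finₚ.toℕ-fromℕ< (m%n<n j m)) (m<n⇒m%n≡m j<m)

      unbit : Bool → Fin 2
      unbit false = Fin.zero
      unbit true  = Fin.suc Fin.zero

      bit-unbit : ∀ b → bit (unbit b) ≡ b
      bit-unbit false = ≡.refl
      bit-unbit true  = ≡.refl

      e₀ : Carrier
      e₀ = (Fin.zero , Fin.zero , Fin.zero , Fin.zero) , 1 mod m

      point : F 3 → Carrier
      point (a ∷ b ∷ c ∷ []) = (unbit a , unbit b , unbit c , Fin.suc Fin.zero) , suc k mod m

      lifted : F 3 → F 4
      lifted (a ∷ b ∷ c ∷ []) = a ∷ b ∷ c ∷ true ∷ []

      bits-point : ∀ l → bits (point l) ≡ lifted l
      bits-point (a ∷ b ∷ c ∷ []) = cong₂ _∷_ (bit-unbit a) (cong₂ _∷_ (bit-unbit b) (cong₂ _∷_ (bit-unbit c) ≡.refl))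

      residue-point : ∀ l → residue (point l) ≡ suc k
      residue-point (a ∷ b ∷ c ∷ []) = residue-mod (suc k) k<m

      pts : Vec (F 3) 7
      pts = fromList points

      sel-map : ∀ {j} (B : F j) (ls : Vec (F 3) j) → sel B (Vec.map point ls) ≡ map point (sel B ls)
      sel-map []          []       = ≡.refl
      sel-map (true ∷ B)  (l ∷ ls) = cong (point l ∷_) (sel-map B ls)
      sel-map (false ∷ B) (l ∷ ls) = sel-map B ls

      vsum-points : ∀ ls → vsum bits (map point ls) ≡ vsum lifted ls
      vsum-points []       = ≡.refl
      vsum-points (l ∷ ls) = cong₂ _⊞_ (bits-point l) (vsum-points ls)

      residue-points : ∀ ls → ℕsum (map residue (map point ls)) ≡ length ls * suc k
      residue-points []       = ≡.refl
      residue-points (l ∷ ls) = cong₂ _+_ (residue-point l) (residue-points ls)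

      vsum-e₀ : ∀ c → vsum bits (replicate c e₀) ≡ 𝟎
      vsum-e₀ zero    = ≡.refl
      vsum-e₀ (suc c) = ≡.trans (⊞-identityˡ _) (vsum-e₀ c)

      residue-e₀ : ∀ c → ℕsum (map residue (replicate c e₀)) ≡ c
      residue-e₀ zero    = ≡.refl
      residue-e₀ (suc c) = cong₂ _+_ (residue-mod 1 1<m) (residue-e₀ c)

      opaque
        -- The added coordinate excludes odd lengths, two points are distinct, and six points of F₂³
        -- sum to the seventh, which is not 𝟎.
        relation-lengths : ∀ (B : F 7) → vsum lifted (sel B pts) ≡ 𝟎 → B ≡ 𝟎 ⊎ length (sel B pts) ≡ 4
        relation-lengths = toWitness {a? = ∀F? 7 λ B → (_ ≟ᶠ _) →-dec ((B ≟ᶠ 𝟎) ⊎-dec (length (sel B pts) ≟ 4))} tt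

    long-sequence : List Carrier
    long-sequence = replicate (n + n ∸ 3) e₀ ++ toList (Vec.map point pts)

    length-long-sequence : length long-sequence ≡ 4 + (n + n)
    length-long-sequence = ≡.trans (length-++ (replicate (n + n ∸ 3) e₀)) (≡.trans (cong (_+ 7) (length-replicate (n + n ∸ 3)))
      (≡.trans (≡.sym (+-assoc (n + n ∸ 3) 3 4)) (≡.trans (cong (_+ 4) (m∸n+n≡m 3≤2n)) (+-comm (n + n) 4))))
      where
      3≤2n : 3 ≤ n + n
      3≤2n = ≤-trans (≤-trans (m≤m+n 3 68) 70<n) (m≤m+n n n)

    private
      -- Here the oddness n = 2k + 1 enters: four points contribute 4(k + 1) = 2n + 2, that is 2
      -- modulo 2n, and at most 2n - 3 copies of `e₀` cannot complete this to 0.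
      no-zero-sum : ∀ c (B : F 7) → c ≤ n + n ∸ 3 → σ (replicate c e₀ ++ map point (sel B pts)) ≈ ε →
        replicate c e₀ ++ map point (sel B pts) ≡ []
      no-zero-sum c B c≤ eq = case relation-lengths B relation of λ
        { (inj₁ B≡𝟎) → empty (cong (λ D → sel D pts) B≡𝟎)
        ; (inj₂ len) → ⊥-elim (four len)
        }
        where
        open ≡.≡-Reasoning
        ls : List (F 3)
        ls = sel B pts
        relation : vsum lifted ls ≡ 𝟎
        relation = begin
          vsum lifted ls                                             ≡⟨ vsum-points ls ⟨
          vsum bits (map point ls)                                   ≡⟨ ⊞-identityˡ _ ⟨
          𝟎 ⊞ vsum bits (map point ls)                               ≡⟨ cong (_⊞ vsum bits (map point ls)) (vsum-e₀ c) ⟨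
          vsum bits (replicate c e₀) ⊞ vsum bits (map point ls)      ≡⟨ vsum-++ bits (replicate c e₀) _ ⟨
          vsum bits (replicate c e₀ ++ map point ls)                 ≡⟨ bits-σ (replicate c e₀ ++ map point ls) ⟨
          bits (σ (replicate c e₀ ++ map point ls))                  ≡⟨ cong bits (≈⇒≡ eq) ⟩
          𝟎                                                          ∎
        residues : (c + length ls * suc k) % m ≡ 0
        residues = begin
          (c + length ls * suc k) % m                                            ≡⟨ cong (_% m) (cong₂ _+_ (residue-e₀ c) (residue-points ls)) ⟨
          (ℕsum (map residue (replicate c e₀)) + ℕsum (map residue (map point ls))) % m  ≡⟨ cong (_% m) (sum-++ (map residue (replicate c e₀)) _) ⟨
          ℕsum (map residue (replicate c e₀) ++ map residue (map point ls)) % m  ≡⟨ cong (λ xs → ℕsum xs % m) (map-++ residue (replicate c e₀) _) ⟨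
          ℕsum (map residue (replicate c e₀ ++ map point ls)) % m                ≡⟨ residue-σ (replicate c e₀ ++ map point ls) ⟨
          residue (σ (replicate c e₀ ++ map point ls))                           ≡⟨ cong residue (≈⇒≡ eq) ⟩
          residue ε                                                              ≡⟨ residue-mod 0 (<-trans (s≤s z≤n) 1<m) ⟩
          0                                                                      ∎
        c+3≤m : c + 3 ≤ m
        c+3≤m = ≤-trans (+-monoˡ-≤ 3 c≤) (≤-trans (≤-reflexive (m∸n+n≡m (≤-trans (≤-trans (m≤m+n 3 68) 70<n) (m≤m+n n n)))) (≤-reflexive (cong (n +_) (≡.sym (+-identityʳ n)))))
        empty : ls ≡ sel 𝟎 pts → replicate c e₀ ++ map point ls ≡ []
        empty ls≡ = ≡.trans (cong₂ (λ j us → replicate j e₀ ++ map point us) c≡0 ls≡) ≡.refl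
          where
          c≡0 : c ≡ 0
          c≡0 = begin
            c                             ≡⟨ m<n⇒m%n≡m (≤-trans (≤-trans (≤-reflexive (+-comm 1 c)) (+-monoʳ-≤ c (s≤s z≤n))) c+3≤m) ⟨
            c % m                         ≡⟨ cong (_% m) (+-identityʳ c) ⟨
            (c + 0) % m                   ≡⟨ cong (λ us → (c + length us * suc k) % m) ls≡ ⟨
            (c + length ls * suc k) % m   ≡⟨ residues ⟩
            0                             ∎
        four : length ls ≡ 4 → ⊥
        four len = contradiction c+2≡0 (λ eq → contradiction (m+n≡0⇒n≡0 c eq) λ ())
          where
          arith : ∀ c k → c + 4 * suc k ≡ c + 2 + 1 * (2 * suc (k + k))
          arith = solve-∀
          c+2≡0 : c + 2 ≡ 0
          c+2≡0 = begin
            c + 2                           ≡⟨ m<n⇒m%n≡m (≤-trans (≤-reflexive (≡.sym (+-suc c 2))) c+3≤m) ⟨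
            (c + 2) % m                     ≡⟨ [m+kn]%n≡m%n (c + 2) 1 m ⟨
            (c + 2 + 1 * m) % m             ≡⟨ cong (_% m) (≡.trans (cong (λ j → c + 2 + 1 * (2 * j)) n≡) (≡.sym (arith c k))) ⟩
            (c + 4 * suc k) % m             ≡⟨ cong (λ j → (c + j * suc k) % m) len ⟨
            (c + length ls * suc k) % m     ≡⟨ residues ⟩
            0                               ∎

    long-sequence-zero-sum-free : ZeroSumFree G long-sequence
    long-sequence-zero-sum-free (S , S⊆ , S≢[] , eq) =
      let us , vs , S≡ , us⊆ , vs⊆ = ⊆-++⁻ (replicate (n + n ∸ 3) e₀) S⊆
          c , c≤ , us≡ = ⊆-replicate (n + n ∸ 3) us⊆
          B , B≡ = sel-⊆ (Vec.map point pts) vs⊆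
          S≡′ = ≡.trans S≡ (cong₂ _++_ us≡ (≡.trans (≡.sym B≡) (sel-map B pts)))
      in S≢[] (≡.trans S≡′ (no-zero-sum c B c≤ (trans (reflexive (cong σ (≡.sym S≡′))) eq)))

theorem5p5 : (n : ℕ) .{{_ : NonZero n}} → n > 70 → 2 ∤ n →
    let G = (C 2 ⊕ C 2 ⊕ C 2 ⊕ C 2) ⊕ C (2 * n) {{m*n≢0 2 n}} in
    ∃[ d ] Is-d G d × Is-ν G (d ∸ 1) × Is-νₚ G 2 (d ∸ 1)
theorem5p5 n 70<n 2∤n = 4 + (n + n) , d-value , ν-value , νₚ-value
  where
  open Group n using (G)
  open Main n 70<n
  odd : ∃[ k ] n ≡ suc (k + k)
  odd = case even-or-odd n of λ
    { (inj₁ (k , n≡)) → contradiction (divides k (≡.trans n≡ (≡.trans (cong (k +_) (≡.sym (+-identityʳ k))) (*-comm 2 k)))) 2∤n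
    ; (inj₂ odd-n) → odd-n
    }
  open Example (odd .proj₁) (odd .proj₂)

  -- The extremal sequence without two of its terms has length 2n + 2 and, by
  -- `two-extensions-absurd`, lacks the property.
  short : ∀ {ℓ} → (∀ {T} → ZeroSumFree G T → length T ≥ ℓ → ∃[ H ] IsSubgroup G H × MissesOnlyCoset G T H) → 3 + (n + n) ≤ ℓ
  short {ℓ} property = bound long-sequence long-sequence-zero-sum-free length-long-sequence
    where
    bound : ∀ T → ZeroSumFree G T → length T ≡ 4 + (n + n) → 3 + (n + n) ≤ ℓ
    bound (u ∷ v ∷ T) zsf len with 3 + (n + n) ≤? ℓ
    ... | yes ≤ℓ = ≤ℓ
    ... | no  ≰ℓ = let H , subgroup , misses = property (zsf ∘ Σ-mono G (u ∷ʳ v ∷ʳ ⊆-refl))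
                         (≤-trans (s≤s⁻¹ (≰⇒> ≰ℓ)) (≤-reflexive (≡.sym (suc-injective (suc-injective len)))))
                   in ⊥-elim (two-extensions-absurd G zsf subgroup misses)

  d-value : Is-d G (4 + (n + n))
  d-value = (long-sequence , long-sequence-zero-sum-free , length-long-sequence) , λ ℓ (T , zsf , len) → bound ℓ T zsf len
    where
    bound : ∀ ℓ T → ZeroSumFree G T → length T ≡ ℓ → ℓ ≤ 4 + (n + n)
    bound _ []          _   ≡.refl = z≤n
    bound _ (u ∷ [])    _   ≡.refl = s≤s z≤n
    bound _ (u ∷ v ∷ T) zsf ≡.refl with length T ≤? 2 + (n + n)
    ... | yes ≤2n+2 = s≤s (s≤s ≤2n+2)
    -- Even without its first two terms the sequence has length at least 2n + 3, so a coset contains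
    -- all missed elements.
    ... | no  ≰2n+2 = let H , subgroup , _ , _ , misses = long-missed-coset T (zsf ∘ Σ-mono G (u ∷ʳ v ∷ʳ ⊆-refl)) (≰⇒> ≰2n+2)
                      in ⊥-elim (two-extensions-absurd G zsf subgroup misses)

  ν-value : Is-ν G (3 + (n + n))
  ν-value = (λ T zsf long → let H , subgroup , _ , proper , misses = long-missed-coset T zsf long in H , subgroup , proper , misses) ,
    λ ℓ property → short λ zsf long → let H , subgroup , _ , misses = property _ zsf long in H , subgroup , misses

  νₚ-value : Is-νₚ G 2 (3 + (n + n))
  νₚ-value = (λ T zsf long → let H , subgroup , index , _ , misses = long-missed-coset T zsf long in H , subgroup , index , misses) ,
    λ ℓ property → short λ zsf long → let H , subgroup , _ , misses = property _ zsf long in H , subgroup , misses
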